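{- Let $\mathbb{F}_q$ be a finite field of odd characteristic with $q\equiv 1\pmod 6$, and let $T$ be a generator of the group of multiplicative characters of $\mathbb{F}_q$. Let $a,b,c\in\mathbb{F}_q^\times$, and suppose $h\in\mathbb{F}_q^\times$ satisfies both $$3h^2+2\,\frac{ab+bc+ca}{bc}\,h+\frac{ab+ca+a^2}{bc}=0\qquad\text{and}\qquad 3h^2+2(a+b+c)h+ab+bc+ca=0.$$ Set $$d=3h+a+b+c,\qquad e=h^3+(a+b+c)h^2+(ab+bc+ca)h+abc,$$ $$f=3h+\frac{ab+bc+ca}{bc},\qquad g=h^3+\frac{ab+bc+ca}{bc}h^2+\frac{ab+ca+a^2}{bc}h+\frac{a^2}{bc},$$ and assume that $a,b,c,d,e,f$ all lie in $\mathbb{F}_q^\times$ and are pairwise distinct. Then $$\psi_{(2,2,2)}(a,b,c)=-1+q\,\varphi(-3d)\;{_2}F_1\left(\begin{array}{cc}T^{\frac{q-1}{6}},&T^{\frac{5(q-1)}{6}}\\ &\varepsilon\end{array}\Big|\ -\frac{3^3e}{2^2d^3}\right)+q\,\varphi(bc)\,\varphi(-3f)\;{_2}F_1\left(\begin{array}{cc}T^{\frac{q-1}{6}},&T^{\frac{5(q-1)}{6}}\\ &\varepsilon\end{array}\Big|\ -\frac{3^3g}{2^2f^3}\right).$$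
   Context: Multiplicative characters $\chi:\mathbb{F}_q^\times\to\mathbb{C}^\times$ are extended to $\mathbb{F}_q$ by $\chi(0):=0$, including the trivial character $\varepsilon$; $\overline{\chi}$ is the inverse of $\chi$. $\varphi$ is the quadratic character and $\varepsilon$ the trivial character of $\mathbb{F}_q$. $\psi_{(2,2,2)}(a,b,c):=\sum_{x\in\mathbb{F}_q}\varphi(x^2+a)\varphi(x^2+b)\varphi(x^2+c)$. For characters $A,B,C$ and $x\in\mathbb{F}_q$, Greene's finite field hypergeometric series is $${_2}F_1\left(\begin{array}{cc}A,&B\\ &C\end{array}\Big|\ x\right):=\varepsilon(x)\frac{BC(-1)}{q}\sum_{y\in\mathbb{F}_q}B(y)\,\overline{B}C(1-y)\,\overline{A}(1-xy).$$ -}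

module Defs where

open import Level using (Level; _⊔_; suc)
open import Algebra.Bundles using (Group; AbelianGroup; CommutativeRing; Semiring)
open import Algebra.Apartness.Bundles using (HeytingCommutativeRing; HeytingField)
open import Algebra.Morphism.Bundles using (GroupHomomorphism)
open import Algebra.Definitions using (Invertible)
import Algebra.Definitions.RawMonoid as Multiples
import Algebra.Definitions.RawSemiring as RawSemiringDefinitions
import Algebra.Properties.AbelianGroup as AbelianGroupProperties
import Algebra.Properties.CommutativeSemigroup as CommutativeSemigroupProperties
import Algebra.Properties.Semiring.Sum as Summation
open import Data.Fin.Base using (Fin; toℕ)
import Data.Fin.Properties as Fin
open import Data.Integer.Base using (ℤ; +_; -[1+_])
open import Data.Nat.Base as ℕ using (ℕ)
open import Data.Nat.Divisibility using (_∣_)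
open import Data.Product.Base using (Σ; ∃; _,_; proj₁; proj₂)
open import Data.Vec.Functional using (Vector)
open import Function.Bundles using (Inverse; _⇔_)
open import Relation.Binary.Definitions using (Decidable)
import Relation.Binary.PropositionalEquality as ≡
import Relation.Binary.Reasoning.Setoid as SetoidReasoning
open import Relation.Nullary.Decidable using (Dec; yes; no; map′)

private
  variable
    a b c c′ ℓ ℓ′ ℓ₁ ℓ₂ ℓ₁′ ℓ₂′ : Level

module _ (G : Group c ℓ) where
  open Group G

  power : Carrier → ℕ → Carrier
  power x n = Multiples._×_ rawMonoid n x

  powerℤ : Carrier → ℤ → Carrier
  powerℤ x (+ n)    = power x n
  powerℤ x -[1+ n ] = power x (ℕ.suc n) ⁻¹

  IsGenerator : Carrier → Set (c ⊔ ℓ)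
  IsGenerator g = ∀ x → ∃ λ (k : ℤ) → x ≈ powerℤ g k

homGroup : AbelianGroup a ℓ → AbelianGroup b ℓ′ → AbelianGroup (a ⊔ b ⊔ ℓ ⊔ ℓ′) (a ⊔ ℓ′)
homGroup A B = record
  { Carrier = Hom
  ; _≈_     = λ f g → ∀ x → ⟦ f ⟧ x B.≈ ⟦ g ⟧ x
  ; _∙_     = λ f g → hom (λ x → ⟦ f ⟧ x B.∙ ⟦ g ⟧ x)
      (λ p → B.∙-cong (⟦⟧-cong f p) (⟦⟧-cong g p))
      (λ x y → B.trans (B.∙-cong (homo f x y) (homo g x y)) (interchange _ _ _ _))
      (B.trans (B.∙-cong (ε-homo f) (ε-homo g)) (B.identityˡ _))
      (λ x → B.trans (B.∙-cong (⁻¹-homo f x) (⁻¹-homo g x)) (⁻¹-∙-comm _ _))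
  ; ε       = hom (λ _ → B.ε)
      (λ _ → B.refl)
      (λ _ _ → B.sym (B.identityˡ _))
      B.refl
      (λ _ → B.sym ε⁻¹≈ε)
  ; _⁻¹     = λ f → hom (λ x → ⟦ f ⟧ x B.⁻¹)
      (λ p → B.⁻¹-cong (⟦⟧-cong f p))
      (λ x y → B.trans (B.⁻¹-cong (homo f x y)) (B.sym (⁻¹-∙-comm _ _)))
      (B.trans (B.⁻¹-cong (ε-homo f)) ε⁻¹≈ε)
      (λ x → B.⁻¹-cong (⁻¹-homo f x))
  ; isAbelianGroup = record
      { isGroup = record
          { isMonoid = record
              { isSemigroup = record
                  { isMagma = record
                      { isEquivalence = record
                          { refl  = λ _ → B.refl
                          ; sym   = λ p x → B.sym (p x)
                          ; trans = λ p q x → B.trans (p x) (q x)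
                          }
                      ; ∙-cong = λ p q x → B.∙-cong (p x) (q x)
                      }
                  ; assoc = λ _ _ _ _ → B.assoc _ _ _
                  }
              ; identity = (λ _ _ → B.identityˡ _) , (λ _ _ → B.identityʳ _)
              }
          ; inverse = (λ _ _ → B.inverseˡ _) , (λ _ _ → B.inverseʳ _)
          ; ⁻¹-cong = λ p x → B.⁻¹-cong (p x)
          }
      ; comm = λ _ _ _ → B.comm _ _
      }
  }
  where
  module A = AbelianGroup A
  module B = AbelianGroup B
  open AbelianGroupProperties B using (⁻¹-∙-comm; ε⁻¹≈ε)
  open CommutativeSemigroupProperties B.commutativeSemigroup using (interchange)

  Hom = GroupHomomorphism A.rawGroup B.rawGroup
  open GroupHomomorphism using (⟦_⟧; ⟦⟧-cong; homo; ε-homo; ⁻¹-homo)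

  hom : (f : A.Carrier → B.Carrier) →
        (∀ {x y} → x A.≈ y → f x B.≈ f y) →
        (∀ x y → f (x A.∙ y) B.≈ f x B.∙ f y) →
        f A.ε B.≈ B.ε →
        (∀ x → f (x A.⁻¹) B.≈ f x B.⁻¹) →
        Hom
  hom f f-cong f-homo f-ε f-⁻¹ = record
    { ⟦_⟧ = f
    ; isGroupHomomorphism = record
        { isMonoidHomomorphism = record
            { isMagmaHomomorphism = record
                { isRelHomomorphism = record { cong = f-cong }
                ; homo = f-homo
                }
            ; ε-homo = f-ε
            }
        ; ⁻¹-homo = f-⁻¹
        }
    }

unitGroup : CommutativeRing c ℓ → AbelianGroup (c ⊔ ℓ) ℓ
unitGroup R = record
  { Carrier = Σ Carrier (Invertible _≈_ 1# _*_)
  ; _≈_     = λ u v → proj₁ u ≈ proj₁ v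
  ; _∙_     = λ (x , x⁻¹ , l , r) (y , y⁻¹ , l′ , r′) →
                x * y , x⁻¹ * y⁻¹ , product-one l l′ , product-one r r′
  ; ε       = 1# , 1# , *-identityˡ 1# , *-identityˡ 1#
  ; _⁻¹     = λ (x , x⁻¹ , l , r) → x⁻¹ , x , r , l
  ; isAbelianGroup = record
      { isGroup = record
          { isMonoid = record
              { isSemigroup = record
                  { isMagma = record
                      { isEquivalence = record { refl = refl ; sym = sym ; trans = trans }
                      ; ∙-cong = *-cong
                      }
                  ; assoc = λ _ _ _ → *-assoc _ _ _
                  }
              ; identity = (λ _ → *-identityˡ _) , (λ _ → *-identityʳ _)
              }
          ; inverse = (λ (_ , _ , l , _) → l) , (λ (_ , _ , _ , r) → r)
          ; ⁻¹-cong = λ {u} {v} → inverse-cong u v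
          }
      ; comm = λ _ _ → *-comm _ _
      }
  }
  where
  open CommutativeRing R
  open CommutativeSemigroupProperties *-commutativeSemigroup using (interchange)
  open SetoidReasoning setoid

  product-one : ∀ {x y z w} → x * y ≈ 1# → z * w ≈ 1# → (x * z) * (y * w) ≈ 1#
  product-one p q = trans (interchange _ _ _ _) (trans (*-cong p q) (*-identityˡ 1#))

  inverse-cong : (u v : Σ Carrier (Invertible _≈_ 1# _*_)) →
                 proj₁ u ≈ proj₁ v → proj₁ (proj₂ u) ≈ proj₁ (proj₂ v)
  inverse-cong (x , x⁻¹ , l , r) (y , y⁻¹ , l′ , r′) x≈y = begin
    x⁻¹             ≈⟨ *-identityʳ x⁻¹ ⟨
    x⁻¹ * 1#        ≈⟨ *-congˡ r′ ⟨
    x⁻¹ * (y * y⁻¹) ≈⟨ *-assoc x⁻¹ y y⁻¹ ⟨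
    x⁻¹ * y * y⁻¹   ≈⟨ *-congʳ (*-congˡ x≈y) ⟨
    x⁻¹ * x * y⁻¹   ≈⟨ *-congʳ l ⟩
    1# * y⁻¹        ≈⟨ *-identityˡ y⁻¹ ⟩
    y⁻¹             ∎

-- The complex numbers enter only as the values of characters; they are
-- replaced by an arbitrary algebraically closed field of characteristic zero.
-- Invertibility is governed by apartness, and equality need not be decidable,
-- so that the field of complex numbers is an instance constructively as well.
record AlgebraicallyClosedField₀ c ℓ₁ ℓ₂ : Set (suc (c ⊔ ℓ₁ ⊔ ℓ₂)) where
  field
    heytingField : HeytingField c ℓ₁ ℓ₂

  open HeytingField heytingField public

  commutativeRing : CommutativeRing c ℓ₁
  commutativeRing = HeytingCommutativeRing.commutativeRing heytingCommutativeRing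

  open CommutativeRing commutativeRing public using (semiring)

  private
    module RS = RawSemiringDefinitions (Semiring.rawSemiring semiring)

  fromℕ : ℕ → Carrier
  fromℕ n = n RS.× 1#

  field
    characteristic-zero : ∀ n .{{_ : ℕ.NonZero n}} → fromℕ n # 0#

    -- Every monic polynomial X^(n+1) + coeff n · X^n + … + coeff 0 has a root.
    algebraically-closed :
      ∀ {n} (coeff : Vector Carrier (ℕ.suc n)) →
      ∃ λ x → x RS.^ ℕ.suc n + RS.sum (λ i → coeff i * x RS.^ toℕ i) ≈ 0#

record FiniteField c ℓ₁ ℓ₂ : Set (suc (c ⊔ ℓ₁ ⊔ ℓ₂)) where
  field
    heytingField : HeytingField c ℓ₁ ℓ₂

  open HeytingField heytingField public

  commutativeRing : CommutativeRing c ℓ₁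
  commutativeRing = HeytingCommutativeRing.commutativeRing heytingCommutativeRing

  open CommutativeRing commutativeRing public using (semiring)

  field
    q           : ℕ
    enumeration : Inverse (≡.setoid (Fin q)) setoid

  module enumeration = Inverse enumeration

  element : Fin q → Carrier
  element = enumeration.to

  instance
    q-nonZero : ℕ.NonZero q
    q-nonZero = Fin.nonZeroIndex (enumeration.from 0#)

  open RawSemiringDefinitions (Semiring.rawSemiring semiring) public using (_^_) renaming (_×_ to _·_)

  HasCharacteristic : ℕ → Set ℓ₁
  HasCharacteristic p = ∀ n → n · 1# ≈ 0# ⇔ p ∣ n

  infix 4 _≟_

  _≟_ : Decidable _≈_
  x ≟ y = map′
    (λ eq → trans (sym (enumeration.strictlyInverseˡ x))
              (trans (enumeration.to-cong eq) (enumeration.strictlyInverseˡ y)))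
    enumeration.from-cong
    (enumeration.from x Fin.≟ enumeration.from y)

  search : ∀ {f : Carrier → Carrier} {y} →
           (∀ {u v} → u ≈ v → f u ≈ f v) → Dec (∃ λ x → f x ≈ y)
  search {f} {y} f-cong = map′
    (λ (i , eq) → element i , eq)
    (λ (x , eq) → enumeration.from x , trans (f-cong (enumeration.strictlyInverseˡ x)) eq)
    (Fin.any? (λ i → f (element i) ≟ y))

  invertible? : ∀ x → Dec (Invertible _≈_ 1# _*_ x)
  invertible? x = map′
    (λ (y , eq) → y , trans (*-comm y x) eq , eq)
    (λ (y , _ , eq) → y , eq)
    (search (*-cong refl))

  isSquare? : ∀ x → Dec (∃ λ y → y * y ≈ x)
  isSquare? x = search (λ eq → *-cong eq eq)

  -- The inverse of zero is zero, as is every quotient with denominator zero.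
  inv : Carrier → Carrier
  inv x with invertible? x
  ... | yes (x⁻¹ , _) = x⁻¹
  ... | no _          = 0#

  infixl 7 _/_

  _/_ : Carrier → Carrier → Carrier
  x / y = x * inv y

module Characters (F : FiniteField c ℓ₁ ℓ₂) (K : AlgebraicallyClosedField₀ c′ ℓ₁′ ℓ₂′) where
  private
    module F = FiniteField F
    module K = AlgebraicallyClosedField₀ K

  characterGroup : AbelianGroup (c ⊔ ℓ₁ ⊔ c′ ⊔ ℓ₁′) (c ⊔ ℓ₁ ⊔ ℓ₁′)
  characterGroup = homGroup (unitGroup F.commutativeRing) (unitGroup K.commutativeRing)

  open AbelianGroup characterGroup public
    using (group; ε) renaming (Carrier to Character; _∙_ to _·χ_; _⁻¹ to conj)

  infixr 8 _^χ_

  _^χ_ : Character → ℕ → Character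
  _^χ_ = power group

  -- χ ⟨ x ⟩ is the extension of χ to the whole field, zero at zero (for ε too).
  infix 9 _⟨_⟩

  _⟨_⟩ : Character → F.Carrier → K.Carrier
  χ ⟨ x ⟩ with F.invertible? x
  ... | yes x-inv = proj₁ (GroupHomomorphism.⟦_⟧ χ (x , x-inv))
  ... | no _      = K.0#

  φ : F.Carrier → K.Carrier
  φ x with x F.≟ F.0# | F.isSquare? x
  ... | yes _ | _     = K.0#
  ... | no _  | yes _ = K.1#
  ... | no _  | no _  = K.- K.1#

  ∑ : (F.Carrier → K.Carrier) → K.Carrier
  ∑ f = Summation.sum K.semiring (λ i → f (F.element i))

  q⁻¹ : K.Carrier
  q⁻¹ = proj₁ (K.#⇒invertible (K.characteristic-zero F.q))

  ψ₂₂₂ : F.Carrier → F.Carrier → F.Carrier → K.Carrier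
  ψ₂₂₂ a b c = ∑ λ x →
    φ (x F.^ 2 F.+ a) K.* φ (x F.^ 2 F.+ b) K.* φ (x F.^ 2 F.+ c)

  ₂F₁ : (A B C : Character) → F.Carrier → K.Carrier
  ₂F₁ A B C x =
    ε ⟨ x ⟩ K.* ((B ·χ C) ⟨ F.- F.1# ⟩ K.* q⁻¹) K.*
    ∑ λ y → B ⟨ y ⟩ K.* (conj B ·χ C) ⟨ F.1# F.- y ⟩ K.* conj A ⟨ F.1# F.- x F.* y ⟩

{-# OPTIONS --safe #-}

-- Substituting u = x² gives ψ₂₂₂(a,b,c) = ∑ (1 + φ(u)) φ((u+a)(u+b)(u+c)), and
-- u = a/w turns the part weighted by φ(u) into the sum for the cubic with roots
-- −1, −a/b, −a/c. As h is a critical point of both cubics, translation by h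
-- brings each of them to the form u³ + d u² + e, and a further affine
-- substitution to v³ − 3v + 2 − 4x with x = −27e/(4d³).
--
-- Cardano's substitution v = s + 1/s, r = s³ gives v³ − 3v = r + 1/r, whence
--   ∑ φ(v³ − 3v + 2 − 4x) = ∑ η(r) φ(r + 1/r + 2 − 4x) = ∑ (ηφ)(r) φ((r+1)² − 4xr)
-- with η a cubic character. The last argument is the discriminant of the
-- quadratic equation y(1 − xy) = r(1 − y) in y, so the sum over r becomes
-- Greene's sum over y for the sextic character ηφ. That T^((q−1)/6) has exact
-- order 6 follows from exhibiting one character, on a primitive root, with this
-- property.

module Submission where

open import Defs
open import Algebra.Apartness.Bundles using (HeytingField)
import Algebra.Apartness.Properties.HeytingCommutativeRing as HeytingProperties
open import Algebra.Bundles using (CommutativeRing; AbelianGroup; CommutativeMonoid)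
open import Algebra.Definitions using (Invertible)
open import Algebra.Morphism.Bundles using (GroupHomomorphism)
import Algebra.Properties.AbelianGroup as AbelianGroupProperties
import Algebra.Properties.CommutativeMonoid.Mult as MonoidMult
import Algebra.Properties.CommutativeMonoid.Sum as MonoidSum
import Algebra.Properties.Group as GroupProperties
import Algebra.Properties.Ring as RingProperties
import Algebra.Properties.Semiring.Exp as SemiringExp
import Algebra.Properties.Semiring.Mult.TCOptimised as SemiringMult
import Algebra.Properties.Semiring.Sum as SemiringSum
import Algebra.Solver.Ring as RingSolver
open import Algebra.Solver.Ring.AlmostCommutativeRing using (fromCommutativeRing; _-Raw-AlmostCommutative⟶_)
open import Data.Empty using (⊥)
open import Data.Fin.Base as Fin using (Fin; zero; suc; toℕ; punchOut)
open import Data.Fin.Permutation using (Permutation; permutation; _⟨$⟩ʳ_)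
import Data.Fin.Properties as Fin
open import Data.Integer.Base as ℤ using (ℤ; +_; -[1+_])
import Data.Integer.Properties as ℤ
open import Data.List.Base using (_∷_; [])
open import Data.List.Relation.Unary.All using (All; _∷_; [])
open import Data.List.Relation.Unary.AllPairs using (_∷_)
open import Data.List.Relation.Unary.Unique.Setoid using (Unique)
open import Data.Maybe.Base as Maybe using (Maybe)
open import Data.Nat.Base as ℕ using (ℕ; zero; suc; _∸_; s≤s)
open import Data.Nat.DivMod using (m%n<n; m≡m%n+[m/n]*n; m*n/n≡m)
open import Data.Nat.Divisibility as ℕ using (_∣_; divides; _∣?_)
open import Data.Nat.GCD using (module Bézout; GCD; gcd-GCD; gcd; gcd[m,n]∣m; gcd[m,n]∣n)
open import Data.Nat.Induction using (<-wellFounded)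
open import Data.Nat.ListAction using (product)
open import Data.Nat.Primality as ℕ using (Prime; prime?; euclidsLemma; prime⇒irreducible; prime⇒nonZero; ¬prime[1])
open import Data.Nat.Primality.Factorisation using (factorise)
import Data.Nat.Properties as ℕ
open import Data.Product.Base using (Σ; ∃; ∃₂; _×_; _,_; proj₁; proj₂)
import Data.Sign.Base as Sign
open import Data.Sum.Base as Sum using (_⊎_; inj₁; inj₂)
open import Data.Vec.Base using (Vec; _∷_; []; replicate)
open import Data.Vec.Functional using (Vector)
open import Function.Base using (_∘_; id)
open import Function.Definitions using (Injective)
open import Induction.WellFounded using (Acc; acc)
open import Level using (Level; _⊔_)
open import Relation.Binary.PropositionalEquality as ≡ using (_≡_; _≢_)
import Relation.Binary.Reasoning.Setoid as SetoidReasoning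
open import Relation.Nullary.Decidable using (dec⇒maybe; Dec; yes; no; ¬?; _×-dec_; decidable-stable)
open import Relation.Nullary.Negation using (¬_; contradiction)

-- Equality in `K` need not be decidable, so no argument may ask whether an element of `K` vanishes.
-- A primitive sixth root of unity is therefore given by an equation, `Φ₆ x ≈ 0#`, and whatever is
-- cancelled in `K` is a nonzero integer or a value with an exhibited inverse. Case distinctions are
-- made in the finite field, by search, or on exponents. Cardano's substitution reaches v only if v²
-- - 4 is a square. On the other v the polynomial v³ - 3v is injective and keeps v² - 4 a nonsquare,
-- because -3 is a square when q ≡ 1 mod 3; so these v contribute the same to a sum over v³ - 3v as
-- to a sum over v. The weights 1 ± φ(v² - 4) separate the two kinds, and adding both sums gives the
-- identity twice over. The step to Greene's series needs x ≠ 0 and x ≠ 1. Both come from the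
-- discriminant -e(4d³ + 27e) of u³ + du² + e, which is nonzero because a, b, c (for the second
-- cubic 1, a/b, a/c) are distinct. The -1 in the formula is the contribution of w = 0 under u =
-- a/w.

private
  variable
    a c ℓ ℓ₁ ℓ₂ c′ ℓ₁′ ℓ₂′ : Level
    n : ℕ

-- Ring identities with integer coefficients

module IntegerSolver {c ℓ : Level} (R : CommutativeRing c ℓ) where
  open CommutativeRing R
  open RingProperties ring using (-‿distribˡ-*; -‿distribʳ-*; -‿involutive; -0#≈0#)
  open AbelianGroupProperties +-abelianGroup using (⁻¹-∙-comm)
  open SemiringMult semiring using (×-homo-+; ×1-homo-*; 1+×) renaming (_×_ to _⊗_)
  open SetoidReasoning setoid

  -- With this form of multiples `fromℤ (+ 1)` computes to `1#` and `fromℤ (+ 0)` to `0#`, so the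
  -- constants of the solver match those of the goals.
  fromℤ : ℤ → Carrier
  fromℤ (+ n)    = n ⊗ 1#
  fromℤ -[1+ n ] = - (suc n ⊗ 1#)

  private
    cancel-one : ∀ x y → (1# + x) - (1# + y) ≈ x - y
    cancel-one x y = begin
      (1# + x) - (1# + y)       ≈⟨ +-congˡ (⁻¹-∙-comm 1# y) ⟨
      (1# + x) + (- 1# + - y)   ≈⟨ +-congʳ (+-comm 1# x) ⟩
      (x + 1#) + (- 1# + - y)   ≈⟨ +-assoc x 1# _ ⟩
      x + (1# + (- 1# + - y))   ≈⟨ +-congˡ (+-assoc 1# (- 1#) (- y)) ⟨
      x + ((1# + - 1#) + - y)   ≈⟨ +-congˡ (+-congʳ (-‿inverseʳ 1#)) ⟩
      x + (0# + - y)            ≈⟨ +-congˡ (+-identityˡ (- y)) ⟩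
      x - y                     ∎

    ⊖-homo : ∀ m n → fromℤ (m ℤ.⊖ n) ≈ m ⊗ 1# - n ⊗ 1#
    ⊖-homo m       zero    = sym (trans (+-congˡ -0#≈0#) (+-identityʳ _))
    ⊖-homo zero    (suc n) = sym (+-identityˡ _)
    ⊖-homo (suc m) (suc n) = begin
      fromℤ (suc m ℤ.⊖ suc n)  ≡⟨ ≡.cong fromℤ (ℤ.[1+m]⊖[1+n]≡m⊖n m n) ⟩
      fromℤ (m ℤ.⊖ n)          ≈⟨ ⊖-homo m n ⟩
      m ⊗ 1# - n ⊗ 1#          ≈⟨ cancel-one _ _ ⟨
      (1# + m ⊗ 1#) - (1# + n ⊗ 1#)  ≈⟨ +-cong (1+× m 1#) (-‿cong (1+× n 1#)) ⟨
      suc m ⊗ 1# - suc n ⊗ 1#  ∎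

    +◃-homo : ∀ n → fromℤ (Sign.+ ℤ.◃ n) ≈ n ⊗ 1#
    +◃-homo zero    = refl
    +◃-homo (suc n) = refl

    -◃-homo : ∀ n → fromℤ (Sign.- ℤ.◃ n) ≈ - (n ⊗ 1#)
    -◃-homo zero    = sym -0#≈0#
    -◃-homo (suc n) = refl

  +-homo : ∀ i j → fromℤ (i ℤ.+ j) ≈ fromℤ i + fromℤ j
  +-homo (+ m)    (+ n)    = ×-homo-+ 1# m n
  +-homo (+ m)    -[1+ n ] = ⊖-homo m (suc n)
  +-homo -[1+ m ] (+ n)    = trans (⊖-homo n (suc m)) (+-comm _ _)
  +-homo -[1+ m ] -[1+ n ] = begin
    - (suc (suc (m ℕ.+ n)) ⊗ 1#)       ≡⟨ ≡.cong (λ k → - (suc k ⊗ 1#)) (ℕ.+-suc m n) ⟨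
    - ((suc m ℕ.+ suc n) ⊗ 1#)         ≈⟨ -‿cong (×-homo-+ 1# (suc m) (suc n)) ⟩
    - (suc m ⊗ 1# + suc n ⊗ 1#)        ≈⟨ ⁻¹-∙-comm _ _ ⟨
    - (suc m ⊗ 1#) + - (suc n ⊗ 1#)    ∎

  *-homo : ∀ i j → fromℤ (i ℤ.* j) ≈ fromℤ i * fromℤ j
  *-homo (+ m)    (+ n)    = trans (+◃-homo (m ℕ.* n)) (×1-homo-* m n)
  *-homo (+ m)    -[1+ n ] = begin
    fromℤ (Sign.- ℤ.◃ m ℕ.* suc n)  ≈⟨ -◃-homo (m ℕ.* suc n) ⟩
    - ((m ℕ.* suc n) ⊗ 1#)          ≈⟨ -‿cong (×1-homo-* m (suc n)) ⟩
    - (m ⊗ 1# * (suc n ⊗ 1#))       ≈⟨ -‿distribʳ-* _ _ ⟩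
    m ⊗ 1# * - (suc n ⊗ 1#)         ∎
  *-homo -[1+ m ] (+ n)    = begin
    fromℤ (Sign.- ℤ.◃ suc m ℕ.* n)  ≈⟨ -◃-homo (suc m ℕ.* n) ⟩
    - ((suc m ℕ.* n) ⊗ 1#)          ≈⟨ -‿cong (×1-homo-* (suc m) n) ⟩
    - (suc m ⊗ 1# * (n ⊗ 1#))       ≈⟨ -‿distribˡ-* _ _ ⟩
    - (suc m ⊗ 1#) * (n ⊗ 1#)       ∎
  *-homo -[1+ m ] -[1+ n ] = begin
    (suc m ℕ.* suc n) ⊗ 1#             ≈⟨ ×1-homo-* (suc m) (suc n) ⟩
    (suc m ⊗ 1#) * (suc n ⊗ 1#)        ≈⟨ -‿involutive _ ⟨
    - - ((suc m ⊗ 1#) * (suc n ⊗ 1#))  ≈⟨ -‿cong (-‿distribˡ-* _ _) ⟩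
    - (- (suc m ⊗ 1#) * (suc n ⊗ 1#))  ≈⟨ -‿distribʳ-* _ _ ⟩
    - (suc m ⊗ 1#) * - (suc n ⊗ 1#)    ∎

  -‿homo : ∀ i → fromℤ (ℤ.- i) ≈ - fromℤ i
  -‿homo (+ zero)  = sym -0#≈0#
  -‿homo (+ suc n) = refl
  -‿homo -[1+ n ]  = sym (-‿involutive _)

  private
    morphism : ℤ.+-*-rawRing -Raw-AlmostCommutative⟶ fromCommutativeRing R
    morphism = record
      { ⟦_⟧    = fromℤ
      ; +-homo = +-homo
      ; *-homo = *-homo
      ; -‿homo = -‿homo
      ; 0-homo = refl
      ; 1-homo = refl
      }

  -- Coefficients are compared as integers, since equality in `R` need not be decidable. The
  -- identities proved this way hold over ℤ; relations special to a field enter as explicit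
  -- multiples of an expression that vanishes.
  open RingSolver ℤ.+-*-rawRing (fromCommutativeRing R) morphism
    (λ i j → Maybe.map (λ eq → reflexive (≡.cong fromℤ eq)) (dec⇒maybe (i ℤ.≟ j)))
    public using (solve; _:=_; _:+_; _:*_; _:-_; :-_; _:^_; _:×_; con; Polynomial)

  𝟙 : ∀ {n} → Polynomial n
  𝟙 = con (+ 1)

-- Injections of finite sets, and divisibility

injective⇒surjective : {f : Fin n → Fin n} → Injective _≡_ _≡_ f → ∀ j → ∃ λ i → f i ≡ j
injective⇒surjective {n = suc n} {f} f-inj j with Fin.any? (λ i → f i Fin.≟ j)
... | yes hit = hit
... | no miss = contradiction (Fin.injective⇒≤ squeezed-inj) ℕ.1+n≰n
  where
  j≢f : ∀ i → j ≢ f i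
  j≢f i eq = miss (i , ≡.sym eq)

  squeezed : Fin (suc n) → Fin n
  squeezed i = punchOut (j≢f i)

  squeezed-inj : Injective _≡_ _≡_ squeezed
  squeezed-inj {x} {y} eq = f-inj (Fin.punchOut-injective (j≢f x) (j≢f y) eq)

-- Justifies substitutions in sums over the field: only injectivity has to be checked, and
-- surjectivity comes from the pigeonhole principle.
injective⇒permutation : {f : Fin n → Fin n} → Injective _≡_ _≡_ f →
                        Σ (Permutation n n) λ π → ∀ i → π ⟨$⟩ʳ i ≡ f i
injective⇒permutation {f = f} f-inj =
  permutation f f⁻¹ ff⁻¹ (λ i → f-inj (ff⁻¹ (f i))) , λ _ → ≡.refl
  where
  f⁻¹ = λ j → proj₁ (injective⇒surjective f-inj j)
  ff⁻¹ = λ j → proj₂ (injective⇒surjective f-inj j)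

-- Applied to q - 1: raising a nonzero field element to the cofactor `u` leaves an element whose
-- order is a power of p.
split-prime-power : ∀ {p} → Prime p → ∀ n → .{{ℕ.NonZero n}} →
                    ∃₂ λ k u → n ≡ p ℕ.^ k ℕ.* u × ¬ p ∣ u
split-prime-power {p} p-prime n = go n (<-wellFounded n)
  where
  instance _ = prime⇒nonZero p-prime

  go : ∀ n → .{{ℕ.NonZero n}} → Acc ℕ._<_ n → ∃₂ λ k u → n ≡ p ℕ.^ k ℕ.* u × ¬ p ∣ u
  go n (acc rec) with p ∣? n
  ... | no p∤n = 0 , n , ≡.sym (ℕ.*-identityˡ n) , p∤n
  ... | yes (divides r ≡.refl) with go r {{r≢0}} (rec r<rp)
    where
    r≢0 : ℕ.NonZero r
    r≢0 = ℕ.m*n≢0⇒m≢0 r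
    r<rp : r ℕ.< r ℕ.* p
    r<rp = ℕ.m<m*n r p {{r≢0}} (ℕ.nonTrivial⇒n>1 p {{ℕ.prime⇒nonTrivial p-prime}})
  ... | k , u , eq , p∤u =
    suc k , u , ≡.trans (≡.cong (ℕ._* p) eq) (≡.trans (ℕ.*-comm _ p) (≡.sym (ℕ.*-assoc p _ u))) , p∤u

prime-divisor : ∀ n → 1 ℕ.< n → ∃ λ p → Prime p × p ∣ n
prime-divisor n 1<n with factorise n {{ℕ.>-nonZero (ℕ.<-trans (ℕ.n<1+n 0) 1<n)}}
... | record { factors = [] ; isFactorisation = ≡.refl } = contradiction 1<n (ℕ.<-irrefl ≡.refl)
... | record { factors = p ∷ ps ; isFactorisation = eq ; factorsPrime = p-prime ∷ _ } =
  p , p-prime , divides (product ps) (≡.trans eq (ℕ.*-comm p _))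

parity : ∀ n → ∃ λ k → n ≡ k ℕ.+ k ⊎ n ≡ suc (k ℕ.+ k)
parity zero = 0 , inj₁ ≡.refl
parity (suc n) with parity n
... | k , inj₁ eq = k , inj₂ (≡.cong suc eq)
... | k , inj₂ eq = suc k , inj₁ (≡.cong suc (≡.trans eq (≡.sym (ℕ.+-suc k k))))

-- Sums over finite families

module _ (M : CommutativeMonoid a ℓ) where
  open CommutativeMonoid M
  open MonoidSum M using (sum; sum-remove; sum-cong-≋; sum-replicate; sum-replicate-zero)
  open MonoidMult M using () renaming (_×_ to _⊗_)

  sum-single : ∀ (t : Vector Carrier n) i → (∀ j → j ≢ i → t j ≈ ε) → sum t ≈ t i
  sum-single {n = suc n} t i rest = trans (sum-remove {i = i} t)
    (trans (∙-congˡ (trans (sum-cong-≋ (λ j → rest _ (Fin.punchInᵢ≢i i j))) (sum-replicate-zero n)))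
      (identityʳ (t i)))

  -- Read multiplicatively, this supplies the exponent q - 1 in Fermat's theorem: the factor at zero
  -- is neutral, all others agree.
  sum-except : ∀ (t : Vector Carrier n) i {x} → t i ≈ ε → (∀ j → j ≢ i → t j ≈ x) →
               sum t ≈ (n ℕ.∸ 1) ⊗ x
  sum-except {n = suc n} t i tᵢ≈ε rest = trans (sum-remove {i = i} t)
    (trans (∙-cong tᵢ≈ε (trans (sum-cong-≋ (λ j → rest _ (Fin.punchInᵢ≢i i j))) (sum-replicate n)))
      (identityˡ _))

-- Fields with apartness

module HeytingFieldProperties (H : HeytingField c ℓ₁ ℓ₂) where
  open HeytingField H
  open HeytingProperties heytingCommutativeRing public using (1#0; x-0≈x)
  open SetoidReasoning setoid

  #⇒≉ : ∀ {x y} → x # y → ¬ x ≈ y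
  #⇒≉ x#y x≈y = #-irrefl x≈y x#y

  1≉0 : ¬ 1# ≈ 0#
  1≉0 = #⇒≉ 1#0

  #0⇒invertible : ∀ {x} → x # 0# → Invertible _≈_ 1# _*_ x
  #0⇒invertible {x} x#0 with #⇒invertible x#0
  ... | y , l , r = y , trans (*-congˡ (sym (x-0≈x x))) l , trans (*-congʳ (sym (x-0≈x x))) r

  cancel-invertible : ∀ {x y z} → Invertible _≈_ 1# _*_ x → x * y ≈ x * z → y ≈ z
  cancel-invertible {x} {y} {z} (w , wx≈1 , _) eq = begin
    y            ≈⟨ *-identityˡ y ⟨
    1# * y       ≈⟨ *-congʳ wx≈1 ⟨
    w * x * y    ≈⟨ *-assoc w x y ⟩
    w * (x * y)  ≈⟨ *-congˡ eq ⟩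
    w * (x * z)  ≈⟨ *-assoc w x z ⟨
    w * x * z    ≈⟨ *-congʳ wx≈1 ⟩
    1# * z       ≈⟨ *-identityˡ z ⟩
    z            ∎

  #0-cancel : ∀ {x y z} → x # 0# → x * y ≈ x * z → y ≈ z
  #0-cancel x#0 = cancel-invertible (#0⇒invertible x#0)

-- Inverses, polynomials, sums and Fermat's theorem in a finite field

module FiniteFieldProperties (F : FiniteField c ℓ₁ ℓ₂) where
  open FiniteField F hiding (zero)
  open CommutativeRing commutativeRing public
    using (*-commutativeMonoid; +-group; ring)
  open HeytingFieldProperties heytingField public
  open IntegerSolver commutativeRing
  open SemiringExp semiring public using (^-congˡ; ^-congʳ; ^-homo-*; ^-assocʳ)
  open import Algebra.Properties.Group +-group public using () renaming (x∙y⁻¹≈ε⇒x≈y to x-y≈0⇒x≈y; x≈y⇒x∙y⁻¹≈ε to x≈y⇒x-y≈0)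
  open SetoidReasoning setoid

  -- Inequality is in general weaker than apartness. Here invertibility is decided by search, and
  -- tightness turns its failure into equality with zero.
  ≉0⇒invertible : ∀ {x} → ¬ x ≈ 0# → Invertible _≈_ 1# _*_ x
  ≉0⇒invertible {x} x≉0 with invertible? x
  ... | yes x-inv = x-inv
  ... | no ¬x-inv = contradiction (proj₁ (tight x 0#) (λ x#0 → ¬x-inv (#0⇒invertible x#0))) x≉0

  invertible⇒≉0 : ∀ {x} → Invertible _≈_ 1# _*_ x → ¬ x ≈ 0#
  invertible⇒≉0 (y , yx≈1 , _) x≈0 = 1≉0 (trans (sym yx≈1) (trans (*-congˡ x≈0) (zeroʳ y)))

  *-cancelˡ : ∀ {x y z} → ¬ x ≈ 0# → x * y ≈ x * z → y ≈ z
  *-cancelˡ x≉0 = cancel-invertible (≉0⇒invertible x≉0)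

  zero-product : ∀ {x y} → x * y ≈ 0# → x ≈ 0# ⊎ y ≈ 0#
  zero-product {x} {y} xy≈0 with x ≟ 0#
  ... | yes x≈0 = inj₁ x≈0
  ... | no x≉0  = inj₂ (*-cancelˡ x≉0 (trans xy≈0 (sym (zeroʳ x))))

  *-≉0 : ∀ {x y} → ¬ x ≈ 0# → ¬ y ≈ 0# → ¬ x * y ≈ 0#
  *-≉0 x≉0 y≉0 xy≈0 with zero-product xy≈0
  ... | inj₁ x≈0 = x≉0 x≈0
  ... | inj₂ y≈0 = y≉0 y≈0

  factors-≉0 : ∀ {x y} → ¬ x * y ≈ 0# → ¬ x ≈ 0# × ¬ y ≈ 0#
  factors-≉0 xy≉0 =
    (λ x≈0 → xy≉0 (trans (*-congʳ x≈0) (zeroˡ _))) ,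
    (λ y≈0 → xy≉0 (trans (*-congˡ y≈0) (zeroʳ _)))

  ^-≉0 : ∀ {x} n → ¬ x ≈ 0# → ¬ x ^ n ≈ 0#
  ^-≉0 zero    x≉0 = 1≉0
  ^-≉0 (suc n) x≉0 = *-≉0 x≉0 (^-≉0 n x≉0)

  ≉0-cong : ∀ {x y} → x ≈ y → ¬ x ≈ 0# → ¬ y ≈ 0#
  ≉0-cong x≈y x≉0 y≈0 = x≉0 (trans x≈y y≈0)

  inv-inverseʳ : ∀ {x} → ¬ x ≈ 0# → x * inv x ≈ 1#
  inv-inverseʳ {x} x≉0 with invertible? x
  ... | yes (_ , _ , r) = r
  ... | no ¬x-inv       = contradiction (≉0⇒invertible x≉0) ¬x-inv

  inv-inverseˡ : ∀ {x} → ¬ x ≈ 0# → inv x * x ≈ 1#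
  inv-inverseˡ x≉0 = trans (*-comm _ _) (inv-inverseʳ x≉0)

  inv-zero : ∀ {x} → x ≈ 0# → inv x ≈ 0#
  inv-zero {x} x≈0 with invertible? x
  ... | yes x-inv = contradiction x≈0 (invertible⇒≉0 x-inv)
  ... | no _      = refl

  inv-cong : ∀ {x y} → x ≈ y → inv x ≈ inv y
  inv-cong {x} {y} x≈y with x ≟ 0#
  ... | yes x≈0 = trans (inv-zero x≈0) (sym (inv-zero (trans (sym x≈y) x≈0)))
  ... | no x≉0  = *-cancelˡ x≉0 (trans (inv-inverseʳ x≉0)
      (trans (sym (inv-inverseʳ (≉0-cong x≈y x≉0))) (*-congʳ (sym x≈y))))

  inv-≉0 : ∀ {x} → ¬ x ≈ 0# → ¬ inv x ≈ 0#
  inv-≉0 x≉0 = invertible⇒≉0 (_ , inv-inverseʳ x≉0 , inv-inverseˡ x≉0)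

  inv-unique : ∀ {x y} → x * y ≈ 1# → y ≈ inv x
  inv-unique {x} {y} xy≈1 = *-cancelˡ x≉0 (trans xy≈1 (sym (inv-inverseʳ x≉0)))
    where
    x≉0 : ¬ x ≈ 0#
    x≉0 x≈0 = 1≉0 (trans (sym xy≈1) (trans (*-congʳ x≈0) (zeroˡ y)))

  -- Valid at zero too, which `inv` fixes. Hence `inv` permutes the whole field and is an admissible
  -- substitution in sums.
  inv-involutive : ∀ x → inv (inv x) ≈ x
  inv-involutive x with x ≟ 0#
  ... | yes x≈0 = trans (inv-zero (inv-zero x≈0)) (sym x≈0)
  ... | no x≉0  = sym (inv-unique (inv-inverseˡ x≉0))

  1^n≈1 : ∀ n → 1# ^ n ≈ 1#
  1^n≈1 zero    = refl
  1^n≈1 (suc n) = trans (*-identityˡ _) (1^n≈1 n)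

  ^-assocˡ : ∀ x m n → (x ^ m) ^ n ≈ x ^ (n ℕ.* m)
  ^-assocˡ x m n = trans (^-assocʳ x m n) (^-congʳ x (ℕ.*-comm m n))

  ^-distrib-* : ∀ x y n → (x * y) ^ n ≈ x ^ n * y ^ n
  ^-distrib-* = MonoidMult.×-distrib-+ *-commutativeMonoid

  ^≈1-multiple : ∀ {x m} n → m ∣ n → x ^ m ≈ 1# → x ^ n ≈ 1#
  ^≈1-multiple {x} {m} _ (divides k ≡.refl) xᵐ≈1 = begin
    x ^ (k ℕ.* m)  ≈⟨ ^-assocˡ x m k ⟨
    (x ^ m) ^ k    ≈⟨ ^-congˡ k xᵐ≈1 ⟩
    1# ^ k         ≈⟨ 1^n≈1 k ⟩
    1#             ∎

  -- Bézout over ℕ reads d + jn = im or d + im = jn. Either way `x ^ d` is multiplied by a power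
  -- already known to be 1, so that negative exponents do not occur.
  ^≈1-gcd : ∀ {x m n d} → GCD m n d → x ^ m ≈ 1# → x ^ n ≈ 1# → x ^ d ≈ 1#
  ^≈1-gcd {x} {m} {n} {d} g xᵐ≈1 xⁿ≈1 with Bézout.identity g
  ... | Bézout.+- i j eq = begin
    x ^ d                ≈⟨ *-identityʳ _ ⟨
    x ^ d * 1#           ≈⟨ *-congˡ (^≈1-multiple (j ℕ.* n) (divides j ≡.refl) xⁿ≈1) ⟨
    x ^ d * x ^ (j ℕ.* n) ≈⟨ ^-homo-* x d _ ⟨
    x ^ (d ℕ.+ j ℕ.* n)  ≈⟨ ^-congʳ x eq ⟩
    x ^ (i ℕ.* m)        ≈⟨ ^≈1-multiple (i ℕ.* m) (divides i ≡.refl) xᵐ≈1 ⟩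
    1#                   ∎
  ... | Bézout.-+ i j eq = begin
    x ^ d                ≈⟨ *-identityʳ _ ⟨
    x ^ d * 1#           ≈⟨ *-congˡ (^≈1-multiple (i ℕ.* m) (divides i ≡.refl) xᵐ≈1) ⟨
    x ^ d * x ^ (i ℕ.* m) ≈⟨ ^-homo-* x d _ ⟨
    x ^ (d ℕ.+ i ℕ.* m)  ≈⟨ ^-congʳ x eq ⟩
    x ^ (j ℕ.* n)        ≈⟨ ^≈1-multiple (j ℕ.* n) (divides j ≡.refl) xⁿ≈1 ⟩
    1#                   ∎

  -- The coefficients of a monic polynomial of degree n, constant term first,
  -- the leading one left out.
  MonicPolynomial : ℕ → Set c
  MonicPolynomial = Vec Carrier

  eval : MonicPolynomial n → Carrier → Carrier
  eval []       x = 1#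
  eval (c ∷ cs) x = c + x * eval cs x

  quotient : MonicPolynomial (suc n) → Carrier → MonicPolynomial n
  quotient (c ∷ [])         a = []
  quotient (c ∷ cs@(_ ∷ _)) a = eval cs a ∷ quotient cs a

  -- Synthetic division: for f = c + X f₁ one has f(x) - f(a) = x (f₁(x) - f₁(a)) + (x - a) f₁(a),
  -- and the bracket is divisible by x - a by induction.
  eval-quotient : ∀ (cs : MonicPolynomial (suc n)) a x →
                  eval cs x - eval cs a ≈ (x - a) * eval (quotient cs a) x
  eval-quotient (c ∷ []) a x =
    solve 4 (λ c x a o → (c :+ x :* o) :- (c :+ a :* o) := (x :- a) :* o) refl c x a 1#
  eval-quotient (c ∷ cs@(_ ∷ _)) a x = begin
    (c + x * E x) - (c + a * E a)
      ≈⟨ solve 5 (λ c x a e f → (c :+ x :* e) :- (c :+ a :* f) := x :* (e :- f) :+ (x :- a) :* f) refl c x a (E x) (E a) ⟩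
    x * (E x - E a) + (x - a) * E a
      ≈⟨ +-congʳ (*-congˡ (eval-quotient cs a x)) ⟩
    x * ((x - a) * Q) + (x - a) * E a
      ≈⟨ solve 4 (λ x y z w → x :* (y :* z) :+ y :* w := y :* (w :+ x :* z)) refl x (x - a) Q (E a) ⟩
    (x - a) * (E a + x * Q) ∎
    where
    E = eval cs
    Q = eval (quotient cs a) x

  -- Dividing by X minus the first root leaves the other roots, which differ from it, as roots of
  -- the quotient.
  too-many-roots : ∀ (cs : MonicPolynomial n) (root : Fin (suc n) → Carrier) →
                   Injective _≡_ _≈_ root → (∀ i → eval cs (root i) ≈ 0#) → ⊥
  too-many-roots []         root inj vanish = 1≉0 (vanish zero)
  too-many-roots cs@(_ ∷ _) root inj vanish =
    too-many-roots (quotient cs (root zero)) (root ∘ suc) (Fin.suc-injective ∘ inj) vanish′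
    where
    vanish′ : ∀ i → eval (quotient cs (root zero)) (root (suc i)) ≈ 0#
    vanish′ i with zero-product (trans (sym (eval-quotient cs (root zero) (root (suc i))))
                     (x≈y⇒x-y≈0 (trans (vanish (suc i)) (sym (vanish zero)))))
    ... | inj₁ eq with () ← inj (x-y≈0⇒x≈y _ _ eq)
    ... | inj₂ eq = eq

  element-injective : Injective _≡_ _≈_ element
  element-injective {i} {j} eq =
    ≡.trans (≡.sym (enumeration.strictlyInverseʳ i))
      (≡.trans (enumeration.from-cong eq) (enumeration.strictlyInverseʳ j))

  index : Carrier → Fin q
  index = enumeration.from

  element-index : ∀ x → element (index x) ≈ x
  element-index = enumeration.strictlyInverseˡ

  module Sums {a ℓ} (M : CommutativeMonoid a ℓ) where
    private module M = CommutativeMonoid M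
    open MonoidSum M using (sum; sum-permute; sum-cong-≋)

    -- The change of variables used throughout. The summand must respect `_≈_` because
    -- `element (index x)` agrees with `x` only up to it.
    ∑-injective : ∀ {f : Carrier → M.Carrier} {σ : Carrier → Carrier} →
      (∀ {x y} → x ≈ y → f x M.≈ f y) →
      (∀ {x y} → σ x ≈ σ y → x ≈ y) →
      sum (f ∘ σ ∘ element) M.≈ sum (f ∘ element)
    ∑-injective {f} {σ} f-cong σ-inj = M.sym (M.trans
      (sum-permute (f ∘ element) (proj₁ π))
      (sum-cong-≋ (λ i → f-cong (trans (reflexive (≡.cong element (proj₂ π i))) (element-index _)))))
      where
      onFin : Fin q → Fin q
      onFin i = index (σ (element i))

      onFin-injective : Injective _≡_ _≡_ onFin
      onFin-injective {i} {j} eq = element-injective (σ-inj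
        (trans (sym (element-index _)) (trans (reflexive (≡.cong element eq)) (element-index _))))

      π = injective⇒permutation onFin-injective

    ∑-single : ∀ {f : Carrier → M.Carrier} y → (∀ {x y} → x ≈ y → f x M.≈ f y) →
      (∀ x → ¬ x ≈ y → f x M.≈ M.ε) → sum (f ∘ element) M.≈ f y
    ∑-single {f} y f-cong rest = M.trans
      (sum-single M (f ∘ element) (index y)
        (λ j j≢i → rest (element j) (λ eq → j≢i (element-injective (trans eq (sym (element-index y)))))))
      (f-cong (element-index y))

  private
    open MonoidSum *-commutativeMonoid using () renaming (sum to ∏; ∑-distrib-+ to ∏-distrib-*)
    open Sums *-commutativeMonoid

    ∏-≉0 : ∀ (t : Vector Carrier n) → (∀ i → ¬ t i ≈ 0#) → ¬ ∏ t ≈ 0#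
    ∏-≉0 {n = zero}  t t≉0 = 1≉0
    ∏-≉0 {n = suc n} t t≉0 = *-≉0 (t≉0 zero) (∏-≉0 (t ∘ suc) (t≉0 ∘ suc))

    -- Products run over the whole enumeration, so the factor at zero is replaced by 1: `support`
    -- lists the nonzero elements, and `unless-zero x` repeats `x` once for each of them.
    unless-zero : Carrier → Carrier → Carrier
    unless-zero x y with y ≟ 0#
    ... | yes _ = 1#
    ... | no _  = x

    unless-zero-0 : ∀ {x y} → y ≈ 0# → unless-zero x y ≈ 1#
    unless-zero-0 {y = y} y≈0 with y ≟ 0#
    ... | yes _  = refl
    ... | no y≉0 = contradiction y≈0 y≉0

    unless-zero-≉0 : ∀ {x y} → ¬ y ≈ 0# → unless-zero x y ≈ x
    unless-zero-≉0 {y = y} y≉0 with y ≟ 0#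
    ... | yes y≈0 = contradiction y≈0 y≉0
    ... | no _    = refl

    support : Carrier → Carrier
    support y = unless-zero y y

    support-≉0 : ∀ y → ¬ support y ≈ 0#
    support-≉0 y with y ≟ 0#
    ... | yes _  = 1≉0
    ... | no y≉0 = y≉0

    support-cong : ∀ {x y} → x ≈ y → support x ≈ support y
    support-cong {x} {y} x≈y with x ≟ 0# | y ≟ 0#
    ... | yes _   | yes _   = refl
    ... | yes x≈0 | no y≉0  = contradiction (trans (sym x≈y) x≈0) y≉0
    ... | no x≉0  | yes y≈0 = contradiction (trans x≈y y≈0) x≉0
    ... | no _    | no _    = x≈y

    support-* : ∀ {x} → ¬ x ≈ 0# → ∀ y → support (x * y) ≈ unless-zero x y * support y
    support-* {x} x≉0 y with y ≟ 0#
    ... | yes y≈0 = trans (unless-zero-0 (trans (*-congˡ y≈0) (zeroʳ x))) (sym (*-identityˡ 1#))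
    ... | no y≉0  = unless-zero-≉0 (*-≉0 x≉0 y≉0)

  -- Multiplication by `x` permutes the nonzero elements, so their product P satisfies x^(q-1) P =
  -- P.
  fermat : ∀ {x} → ¬ x ≈ 0# → x ^ (q ℕ.∸ 1) ≈ 1#
  fermat {x} x≉0 = trans (sym ∏-unless-zero) (*-cancelˡ (∏-≉0 _ (support-≉0 ∘ element)) (begin
    P * ∏ (unless-zero x ∘ element)           ≈⟨ *-comm _ _ ⟩
    ∏ (unless-zero x ∘ element) * P           ≈⟨ ∏-distrib-* (unless-zero x ∘ element) (support ∘ element) ⟨
    ∏ (λ i → unless-zero x (element i) * support (element i))
      ≈⟨ MonoidSum.sum-cong-≋ *-commutativeMonoid (λ i → sym (support-* x≉0 (element i))) ⟩
    ∏ (λ i → support (x * element i))         ≈⟨ ∑-injective support-cong (*-cancelˡ x≉0) ⟩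
    P                                         ≈⟨ *-identityʳ P ⟨
    P * 1#                                    ∎))
    where
    P = ∏ (support ∘ element)

    ∏-unless-zero : ∏ (unless-zero x ∘ element) ≈ x ^ (q ℕ.∸ 1)
    ∏-unless-zero = sum-except *-commutativeMonoid _ (index 0#)
      (unless-zero-0 (element-index 0#))
      (λ j j≢i → unless-zero-≉0 (λ eq → j≢i (element-injective (trans eq (sym (element-index 0#))))))

-- Existence of a primitive root

module PrimitiveRoot (F : FiniteField c ℓ₁ ℓ₂) where
  open FiniteField F hiding (zero)
  open FiniteFieldProperties F
  open SetoidReasoning setoid

  N : ℕ
  N = q ℕ.∸ 1

  q≡1+N : q ≡ suc N
  q≡1+N = ≡.sym (ℕ.m+[n∸m]≡n {1} (ℕ.>-nonZero⁻¹ q))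

  instance
    N-nonZero : ℕ.NonZero N
    N-nonZero = ℕ.≢-nonZero λ N≡0 → 1≉0 (trans (sym (element-index 1#))
      (trans (reflexive (≡.cong element (unique (≡.trans q≡1+N (≡.cong suc N≡0)) _ _))) (element-index 0#)))
      where
      unique : ∀ {n} → n ≡ 1 → (i j : Fin n) → i ≡ j
      unique ≡.refl zero zero = ≡.refl

  -- Otherwise X^(r+1) - X, of degree r + 1 < q, would vanish on the whole field. The extra factor X
  -- makes zero a root as well, so any r + 2 elements of the enumeration serve as roots.
  ∃-power≉1 : ∀ r → .{{ℕ.NonZero r}} → r ℕ.< N → ∃ λ x → ¬ x ≈ 0# × ¬ x ^ r ≈ 1#
  ∃-power≉1 r@(suc s) r<N
    with Fin.any? (λ i → ¬? (element i ≟ 0#) ×-dec ¬? (element i ^ r ≟ 1#))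
  ... | yes (i , x≉0 , xʳ≉1) = element i , x≉0 , xʳ≉1
  ... | no none = contradiction vanish (too-many-roots X^[1+r]-X root
      (λ eq → Fin.inject≤-injective 2+r≤q 2+r≤q _ _ (element-injective eq)))
    where
    2+r≤q : 2 ℕ.+ r ℕ.≤ q
    2+r≤q = ℕ.≤-trans (s≤s r<N) (ℕ.≤-reflexive (≡.sym q≡1+N))

    root : Fin (2 ℕ.+ r) → Carrier
    root i = element (Fin.inject≤ i 2+r≤q)

    X^ : ∀ n x → eval (replicate n 0#) x ≈ x ^ n
    X^ zero    x = refl
    X^ (suc n) x = trans (+-identityˡ _) (*-congˡ (X^ n x))

    X^[1+r]-X : MonicPolynomial (suc r)
    X^[1+r]-X = 0# ∷ - 1# ∷ replicate s 0#

    eval-X^[1+r]-X : ∀ x → eval X^[1+r]-X x ≈ x * (x ^ r - 1#)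
    eval-X^[1+r]-X x = begin
      0# + x * (- 1# + x * eval (replicate s 0#) x) ≈⟨ +-identityˡ _ ⟩
      x * (- 1# + x * eval (replicate s 0#) x)      ≈⟨ *-congˡ (+-comm _ _) ⟩
      x * (x * eval (replicate s 0#) x - 1#)        ≈⟨ *-congˡ (+-congʳ (*-congˡ (X^ s x))) ⟩
      x * (x ^ r - 1#)                              ∎

    vanish : ∀ i → eval X^[1+r]-X (root i) ≈ 0#
    vanish i with root i ≟ 0#
    ... | yes x≈0 = trans (eval-X^[1+r]-X _) (trans (*-congʳ x≈0) (zeroˡ _))
    ... | no x≉0  = trans (eval-X^[1+r]-X _) (trans
      (*-congˡ (x≈y⇒x-y≈0 (decidable-stable (root i ^ r ≟ 1#) (λ xʳ≉1 → none (_ , x≉0 , xʳ≉1)))))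
      (zeroʳ _))

  private
    -- For nonzero x and prime p dividing N: x^(N/p) ≠ 1, that is, the order of x contains the full
    -- power of p in N. The condition is empty if p does not divide N.
    Avoids : Carrier → ℕ → Set ℓ₁
    Avoids x p = ∀ r → N ≡ r ℕ.* p → ¬ x ^ r ≈ 1#

  -- Take x with x^(N/p) ≠ 1 and y = x^u, where u is the part of N prime to p. If y^(N/p) =
  -- (x^(N/p))^u were 1, then x^(N/p), whose p-th power is 1, would be 1 because gcd(p, u) = 1. Any
  -- other prime p′ dividing N divides u, so that y^(N/p′) is a power of x^N = 1.
  prime-part : ∀ {p} → Prime p → p ∣ N →
    ∃ λ y → ¬ y ≈ 0# × Avoids y p × (∀ {p′} → Prime p′ → p′ ≢ p → ∀ r → N ≡ r ℕ.* p′ → y ^ r ≈ 1#)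
  prime-part {p} p-prime p∣N with split-prime-power p-prime N
  ... | zero , u , N≡u , p∤u = contradiction (≡.subst (p ∣_) (≡.trans N≡u (ℕ.*-identityˡ u)) p∣N) p∤u
  ... | suc k , u , N≡pᵏu , p∤u with p∣N
  ... | divides r₀ N≡r₀p = y , ^-≉0 u x≉0 , avoids , kills
    where
    instance
      r₀-nonZero : ℕ.NonZero r₀
      r₀-nonZero = ℕ.≢-nonZero λ r₀≡0 → ℕ.≢-nonZero⁻¹ N (≡.trans N≡r₀p (≡.cong (ℕ._* p) r₀≡0))

      p-nonZero : ℕ.NonZero p
      p-nonZero = prime⇒nonZero p-prime

    r₀<N : r₀ ℕ.< N
    r₀<N = ≡.subst (r₀ ℕ.<_) (≡.sym N≡r₀p)
      (ℕ.m<m*n r₀ p (ℕ.nonTrivial⇒n>1 p {{ℕ.prime⇒nonTrivial p-prime}}))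

    x = proj₁ (∃-power≉1 r₀ r₀<N)
    x≉0 = proj₁ (proj₂ (∃-power≉1 r₀ r₀<N))
    xʳ≉1 = proj₂ (proj₂ (∃-power≉1 r₀ r₀<N))
    y = x ^ u

    gcd[p,u] : GCD p u 1
    gcd[p,u] with prime⇒irreducible p-prime (gcd[m,n]∣m p u)
    ... | inj₁ eq = ≡.subst (GCD p u) eq (gcd-GCD p u)
    ... | inj₂ eq = contradiction (≡.subst (_∣ u) eq (gcd[m,n]∣n p u)) p∤u

    swap : ∀ r → y ^ r ≈ (x ^ r) ^ u
    swap r = trans (^-assocʳ x u r) (sym (^-assocˡ x r u))

    avoids : Avoids y p
    avoids r N≡rp yʳ≈1 = xʳ≉1 (trans (^-congʳ x (ℕ.*-cancelʳ-≡ r₀ r p (≡.trans (≡.sym N≡r₀p) N≡rp)))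
      (trans (sym (*-identityʳ _)) (^≈1-gcd gcd[p,u]
        (trans (^-assocʳ x r p) (trans (^-congʳ x (≡.sym N≡rp)) (fermat x≉0)))
        (trans (sym (swap r)) yʳ≈1))))

    prime∣power : ∀ {p′} k → Prime p′ → p′ ∣ p ℕ.^ k → p′ ≡ p
    prime∣power zero p′-prime p′∣1 = contradiction (≡.subst Prime (ℕ.∣1⇒≡1 p′∣1) p′-prime) ¬prime[1]
    prime∣power (suc k) p′-prime p′∣ with euclidsLemma p (p ℕ.^ k) p′-prime p′∣
    ... | inj₂ p′∣pᵏ = prime∣power k p′-prime p′∣pᵏ
    ... | inj₁ p′∣p with prime⇒irreducible p-prime p′∣p
    ...   | inj₁ p′≡1 = contradiction (≡.subst Prime p′≡1 p′-prime) ¬prime[1]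
    ...   | inj₂ p′≡p = p′≡p

    kills : ∀ {p′} → Prime p′ → p′ ≢ p → ∀ r → N ≡ r ℕ.* p′ → y ^ r ≈ 1#
    kills {p′} p′-prime p′≢p r N≡rp′
      with euclidsLemma (p ℕ.^ suc k) u p′-prime (divides r (≡.trans (≡.sym N≡pᵏu) N≡rp′))
    ... | inj₁ p′∣pᵏ = contradiction (prime∣power (suc k) p′-prime p′∣pᵏ) p′≢p
    ... | inj₂ (divides v ≡.refl) = trans (^-assocʳ x u r)
      (^≈1-multiple (v ℕ.* p′ ℕ.* r) (divides v (≡.trans (ℕ.*-assoc v p′ r)
        (≡.cong (v ℕ.*_) (≡.trans (ℕ.*-comm p′ r) (≡.sym N≡rp′))))) (fermat x≉0))

  -- Multiplying γ by the p-part found above repairs the prime p without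
  -- disturbing the other ones.
  avoids-below : ∀ n → ∃ λ γ → ¬ γ ≈ 0# × (∀ {p} → p ℕ.< n → Prime p → Avoids γ p)
  avoids-below zero = 1# , 1≉0 , λ ()
  avoids-below (suc n) with avoids-below n
  ... | γ , γ≉0 , avoids with prime? n | n ∣? N
  ... | no ¬n-prime | _ = γ , γ≉0 , λ p<1+n p-prime →
    avoids (ℕ.≤∧≢⇒< (ℕ.≤-pred p<1+n) λ p≡n → ¬n-prime (≡.subst Prime p≡n p-prime)) p-prime
  ... | yes _ | no n∤N = γ , γ≉0 , λ p<1+n p-prime r N≡rp →
    avoids (ℕ.≤∧≢⇒< (ℕ.≤-pred p<1+n) λ p≡n → n∤N (≡.subst (_∣ N) p≡n (divides r N≡rp))) p-prime r N≡rp
  ... | yes n-prime | yes n∣N@(divides r₀ N≡r₀n) with γ ^ r₀ ≟ 1# | prime-part n-prime n∣N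
  ... | no γʳ≉1 | _ = γ , γ≉0 , avoids′
    where
    instance _ = prime⇒nonZero n-prime
    avoids′ : ∀ {p} → p ℕ.< suc n → Prime p → Avoids γ p
    avoids′ {p} p<1+n p-prime r N≡rp with p ℕ.≟ n
    ... | yes ≡.refl = λ γʳ≈1 → γʳ≉1 (trans (^-congʳ γ
      (ℕ.*-cancelʳ-≡ r₀ r n (≡.trans (≡.sym N≡r₀n) N≡rp))) γʳ≈1)
    ... | no p≢n = avoids (ℕ.≤∧≢⇒< (ℕ.≤-pred p<1+n) p≢n) p-prime r N≡rp
  ... | yes γʳ≈1 | y , y≉0 , y-avoids , y-kills = γ * y , *-≉0 γ≉0 y≉0 , avoids′
    where
    instance _ = prime⇒nonZero n-prime
    avoids′ : ∀ {p} → p ℕ.< suc n → Prime p → Avoids (γ * y) p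
    avoids′ {p} p<1+n p-prime r N≡rp with p ℕ.≟ n
    ... | yes ≡.refl = λ eq → y-avoids r N≡rp (begin
      y ^ r            ≈⟨ *-identityˡ _ ⟨
      1# * y ^ r       ≈⟨ *-congʳ (trans (^-congʳ γ (ℕ.*-cancelʳ-≡ r r₀ n (≡.trans (≡.sym N≡rp) N≡r₀n))) γʳ≈1) ⟨
      γ ^ r * y ^ r    ≈⟨ ^-distrib-* γ y r ⟨
      (γ * y) ^ r      ≈⟨ eq ⟩
      1#               ∎)
    ... | no p≢n = λ eq → avoids (ℕ.≤∧≢⇒< (ℕ.≤-pred p<1+n) p≢n) p-prime r N≡rp (begin
      γ ^ r            ≈⟨ *-identityʳ _ ⟨
      γ ^ r * 1#       ≈⟨ *-congˡ (y-kills p-prime p≢n r N≡rp) ⟨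
      γ ^ r * y ^ r    ≈⟨ ^-distrib-* γ y r ⟨
      (γ * y) ^ r      ≈⟨ eq ⟩
      1#               ∎)

  -- A prime dividing N is at most N, so repairing the primes below N + 1 repairs all of them. The
  -- element is kept opaque and known by these properties only.
  abstract
    γ : Carrier
    γ = proj₁ (avoids-below (suc N))

    γ≉0 : ¬ γ ≈ 0#
    γ≉0 = proj₁ (proj₂ (avoids-below (suc N)))

    γ-avoids : ∀ {p} → Prime p → Avoids γ p
    γ-avoids p-prime r N≡rp =
      proj₂ (proj₂ (avoids-below (suc N))) (s≤s (ℕ.∣⇒≤ (divides r N≡rp))) p-prime r N≡rp

  -- Let g = gcd(N, n), so that γ^g = 1, and N = sg. If s > 1, a prime p dividing s makes N/p a
  -- multiple of g, whence γ^(N/p) = 1, which `γ-avoids` excludes. So s = 1 and N = g divides n.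
  γ-order : ∀ n → γ ^ n ≈ 1# → N ∣ n
  γ-order n γⁿ≈1 with gcd[m,n]∣m N n
  ... | divides s N≡sg with s ℕ.≤? 1
  ... | yes s≤1 = ≡.subst (_∣ n) (≡.sym (≡.trans N≡sg (≡.trans (≡.cong (ℕ._* gcd N n) s≡1) (ℕ.*-identityˡ _))))
                    (gcd[m,n]∣n N n)
    where
    s≡1 : s ≡ 1
    s≡1 = ℕ.≤-antisym s≤1 (ℕ.n≢0⇒n>0 λ s≡0 →
      ℕ.≢-nonZero⁻¹ N (≡.trans N≡sg (≡.cong (ℕ._* gcd N n) s≡0)))
  ... | no s≰1 with prime-divisor s (ℕ.≰⇒> s≰1)
  ... | p , p-prime , divides t s≡tp = contradiction
    (^≈1-multiple (t ℕ.* gcd N n) (divides t ≡.refl) (^≈1-gcd (gcd-GCD N n) (fermat γ≉0) γⁿ≈1))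
    (γ-avoids p-prime (t ℕ.* gcd N n)
      (≡.trans N≡sg (≡.trans (≡.cong (ℕ._* gcd N n) s≡tp) (*-rearrange t p (gcd N n)))))
    where
    *-rearrange : ∀ a b c → a ℕ.* b ℕ.* c ≡ a ℕ.* c ℕ.* b
    *-rearrange a b c = ≡.trans (ℕ.*-assoc a b c)
      (≡.trans (≡.cong (a ℕ.*_) (ℕ.*-comm b c)) (≡.sym (ℕ.*-assoc a c b)))

  γ-difference : ∀ {i j} → i ℕ.≤ j → γ ^ i ≈ γ ^ j → N ∣ j ℕ.∸ i
  γ-difference {i} {j} i≤j eq = γ-order (j ℕ.∸ i) (*-cancelˡ (^-≉0 i γ≉0) (begin
    γ ^ i * γ ^ (j ℕ.∸ i)    ≈⟨ ^-homo-* γ i _ ⟨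
    γ ^ (i ℕ.+ (j ℕ.∸ i))    ≈⟨ ^-congʳ γ (ℕ.m+[n∸m]≡n i≤j) ⟩
    γ ^ j                    ≈⟨ eq ⟨
    γ ^ i                    ≈⟨ *-identityʳ _ ⟨
    γ ^ i * 1#               ∎))

  private
    small-multiple : ∀ {d} → d ℕ.< N → N ∣ d → d ≡ 0
    small-multiple {zero}  _   _   = ≡.refl
    small-multiple {suc d} d<N N∣d = contradiction (ℕ.∣⇒≤ N∣d) (ℕ.<⇒≱ d<N)

    γ-injective-≤ : ∀ {i j} → i ℕ.≤ j → j ℕ.< N → γ ^ i ≈ γ ^ j → i ≡ j
    γ-injective-≤ {i} {j} i≤j j<N eq = ℕ.≤-antisym i≤j
      (ℕ.m∸n≡0⇒m≤n (small-multiple (ℕ.≤-<-trans (ℕ.m∸n≤m j i) j<N) (γ-difference i≤j eq)))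

  γ-injective : ∀ {i j} → i ℕ.< N → j ℕ.< N → γ ^ i ≈ γ ^ j → i ≡ j
  γ-injective {i} {j} i<N j<N eq with ℕ.≤-total i j
  ... | inj₁ i≤j = γ-injective-≤ i≤j j<N eq
  ... | inj₂ j≤i = ≡.sym (γ-injective-≤ j≤i i<N (sym eq))

  -- If `z` were no power of γ, then zero, `z` and the N distinct powers of γ would be q + 1
  -- different elements.
  discrete-log : ∀ z → ¬ z ≈ 0# → ∃ λ i → γ ^ i ≈ z
  discrete-log z z≉0 with Fin.any? {n = N} (λ i → γ ^ toℕ i ≟ z)
  ... | yes (i , γⁱ≈z) = toℕ i , γⁱ≈z
  ... | no none = contradiction (Fin.injective⇒≤ list-injective) (ℕ.<⇒≱ (ℕ.≤-reflexive (≡.cong suc q≡1+N)))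
    where
    list : Fin (2 ℕ.+ N) → Carrier
    list zero          = 0#
    list (suc zero)    = z
    list (suc (suc i)) = γ ^ toℕ i

    list-distinct : ∀ i j → list i ≈ list j → i ≡ j
    list-distinct zero          zero          _  = ≡.refl
    list-distinct zero          (suc zero)    eq = contradiction (sym eq) z≉0
    list-distinct zero          (suc (suc j)) eq = contradiction (sym eq) (^-≉0 (toℕ j) γ≉0)
    list-distinct (suc zero)    zero          eq = contradiction eq z≉0
    list-distinct (suc zero)    (suc zero)    _  = ≡.refl
    list-distinct (suc zero)    (suc (suc j)) eq = contradiction (j , sym eq) none
    list-distinct (suc (suc i)) zero          eq = contradiction eq (^-≉0 (toℕ i) γ≉0)
    list-distinct (suc (suc i)) (suc zero)    eq = contradiction (i , eq) none
    list-distinct (suc (suc i)) (suc (suc j)) eq =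
      ≡.cong (λ k → suc (suc k)) (Fin.toℕ-injective (γ-injective (Fin.toℕ<n i) (Fin.toℕ<n j) eq))

    list-injective : Injective _≡_ _≡_ (index ∘ list)
    list-injective {i} {j} eq = list-distinct i j
      (trans (sym (element-index _)) (trans (reflexive (≡.cong element eq)) (element-index _)))

-- Sixth roots of unity in characteristic zero

module AlgebraicallyClosedFieldProperties (K : AlgebraicallyClosedField₀ c ℓ₁ ℓ₂) where
  open AlgebraicallyClosedField₀ K hiding (zero)
  open CommutativeRing commutativeRing using (+-commutativeMonoid; *-commutativeMonoid; +-group)
  open HeytingFieldProperties heytingField public
  open IntegerSolver commutativeRing
  open SemiringExp semiring public using (_^_; ^-congˡ; ^-congʳ; ^-homo-*; ^-assocʳ)
  open GroupProperties +-group using () renaming (x∙y⁻¹≈ε⇒x≈y to x-y≈0⇒x≈y; x≈y⇒x∙y⁻¹≈ε to x≈y⇒x-y≈0)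
  open MonoidSum +-commutativeMonoid using (sum)
  open SetoidReasoning setoid

  1^n≈1 : ∀ n → 1# ^ n ≈ 1#
  1^n≈1 zero    = refl
  1^n≈1 (suc n) = trans (*-identityˡ _) (1^n≈1 n)

  ^-distrib-* : ∀ x y n → (x * y) ^ n ≈ x ^ n * y ^ n
  ^-distrib-* = MonoidMult.×-distrib-+ *-commutativeMonoid

  ^-comm : ∀ x m n → (x ^ m) ^ n ≈ (x ^ n) ^ m
  ^-comm x m n = trans (^-assocʳ x m n) (trans (^-congʳ x (ℕ.*-comm m n)) (sym (^-assocʳ x n m)))

  -- Extracts a sum that has been computed only twice over; 2 is apart from zero and can be
  -- cancelled.
  halve : ∀ {x y} → x + x ≈ y + y → x ≈ y
  halve {x} {y} eq = #0-cancel (characteristic-zero 2) (begin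
    fromℕ 2 * x  ≈⟨ solve 1 (λ x → 2 :× 𝟙 :* x := x :+ x) refl x ⟩
    x + x        ≈⟨ eq ⟩
    y + y        ≈⟨ solve 1 (λ x → 2 :× 𝟙 :* x := x :+ x) refl y ⟨
    fromℕ 2 * y  ∎)

  x≈-x⇒x≈0 : ∀ {x} → x ≈ - x → x ≈ 0#
  x≈-x⇒x≈0 {x} eq = halve (trans (+-congʳ eq) (trans (-‿inverseˡ x) (sym (+-identityˡ 0#))))

  -- The sixth cyclotomic polynomial. Its vanishing expresses primitivity by an equation, from which
  -- the identities needed later follow by polynomial division.
  Φ₆ : Carrier → Carrier
  Φ₆ x = x * x - x + 1#

  Φ₆-cong : ∀ {x y} → x ≈ y → Φ₆ x ≈ Φ₆ y
  Φ₆-cong eq = +-congʳ (+-cong (*-cong eq eq) (-‿cong eq))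

  module _ {x} (Φ₆x≈0 : Φ₆ x ≈ 0#) where
    modulo-Φ₆ : ∀ {y z w} → y ≈ z + w * Φ₆ x → y ≈ z
    modulo-Φ₆ eq = trans eq (trans (+-congˡ (trans (*-congˡ Φ₆x≈0) (zeroʳ _))) (+-identityʳ _))

    Φ₆-cube : x ^ 3 ≈ - 1#
    Φ₆-cube = modulo-Φ₆ (solve 1 (λ x → x :^ 3 := :- 𝟙 :+ (x :+ 𝟙) :* (x :* x :- x :+ 𝟙)) refl x)

    Φ₆-sixth : x ^ 6 ≈ 1#
    Φ₆-sixth = modulo-Φ₆ (solve 1 (λ x → x :^ 6 := 𝟙 :+ ((x :+ 𝟙) :* (x :^ 3 :- 𝟙)) :* (x :* x :- x :+ 𝟙)) refl x)

    Φ₆-square : 1# + x ^ 2 + x ^ 4 ≈ 0#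
    Φ₆-square = modulo-Φ₆ (solve 1 (λ x → 𝟙 :+ x :^ 2 :+ x :^ 4 := con (+ 0) :+ (x :* x :+ x :+ 𝟙) :* (x :* x :- x :+ 𝟙)) refl x)

    -- Exhibits an inverse of 1 - x. In orthogonality arguments this replaces the statement that a
    -- character value differs from 1.
    Φ₆-1-x : x * (1# - x) ≈ 1#
    Φ₆-1-x = modulo-Φ₆ (solve 1 (λ x → x :* (𝟙 :- x) := 𝟙 :+ (:- 𝟙) :* (x :* x :- x :+ 𝟙)) refl x)

  -1-square : ∀ n → (- 1#) ^ n * (- 1#) ^ n ≈ 1#
  -1-square n = trans (sym (^-distrib-* (- 1#) (- 1#) n)) (trans
    (^-congˡ n (solve 0 ((:- 𝟙) :* (:- 𝟙) := 𝟙) refl)) (1^n≈1 n))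

  private
    2≉0 : ¬ fromℕ 2 ≈ 0#
    2≉0 = #⇒≉ (characteristic-zero 2)

    3≉0 : ¬ fromℕ 3 ≈ 0#
    3≉0 = #⇒≉ (characteristic-zero 3)

  -- A primitive sixth root of unity is a power of a sixth root of unity β only
  -- if the exponent is ±1 modulo 6.
  Φ₆-base : ∀ {β ξ} k → Φ₆ ξ ≈ 0# → β ^ 6 ≈ 1# → β ^ k ≈ ξ → Φ₆ β ≈ 0#
  Φ₆-base {β} {ξ} k Φ₆ξ≈0 β⁶≈1 βᵏ≈ξ = residue (k ℕ.% 6) (m%n<n k 6) (begin
    β ^ (k ℕ.% 6)                             ≈⟨ *-identityʳ _ ⟨
    β ^ (k ℕ.% 6) * 1#                        ≈⟨ *-congˡ (1^n≈1 (k ℕ./ 6)) ⟨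
    β ^ (k ℕ.% 6) * 1# ^ (k ℕ./ 6)            ≈⟨ *-congˡ (^-congˡ (k ℕ./ 6) β⁶≈1) ⟨
    β ^ (k ℕ.% 6) * (β ^ 6) ^ (k ℕ./ 6)       ≈⟨ *-congˡ (^-comm β 6 (k ℕ./ 6)) ⟩
    β ^ (k ℕ.% 6) * (β ^ (k ℕ./ 6)) ^ 6       ≈⟨ *-congˡ (^-assocʳ β (k ℕ./ 6) 6) ⟩
    β ^ (k ℕ.% 6) * β ^ (k ℕ./ 6 ℕ.* 6)       ≈⟨ ^-homo-* β (k ℕ.% 6) _ ⟨
    β ^ (k ℕ.% 6 ℕ.+ k ℕ./ 6 ℕ.* 6)           ≈⟨ ^-congʳ β (≡.sym (m≡m%n+[m/n]*n k 6)) ⟩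
    β ^ k                                     ≈⟨ βᵏ≈ξ ⟩
    ξ                                         ∎)
    where
    cube≉1 : ¬ ξ ^ 3 ≈ 1#
    cube≉1 ξ³≈1 = 2≉0 (begin
      fromℕ 2         ≈⟨ solve 0 (2 :× 𝟙 := 𝟙 :- :- 𝟙) refl ⟩
      1# - - 1#       ≈⟨ +-cong ξ³≈1 (-‿cong (Φ₆-cube Φ₆ξ≈0)) ⟨
      ξ ^ 3 - ξ ^ 3   ≈⟨ -‿inverseʳ _ ⟩
      0#              ∎)

    sixth : ∀ i → (β ^ i) ^ 6 ≈ 1#
    sixth i = trans (^-comm β i 6) (trans (^-congˡ i β⁶≈1) (1^n≈1 i))

    -- Residues 0, 2 and 4 force ξ³ = 1 while ξ³ = -1, so 2 = 0. Residue 3 forces ξ² = 1, which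
    -- together with Φ₆(ξ) = 0 gives 3 = 0. Residues 1 and 5 make β equal to ξ or to its inverse,
    -- the two roots of Φ₆.
    residue : ∀ r → r ℕ.< 6 → β ^ r ≈ ξ → Φ₆ β ≈ 0#
    residue 0 _ eq = contradiction (trans (^-congˡ 3 (sym eq)) (1^n≈1 3)) cube≉1
    residue 1 _ eq = trans (Φ₆-cong (trans (sym (*-identityʳ β)) eq)) Φ₆ξ≈0
    residue 2 _ eq = contradiction (trans (^-congˡ 3 (sym eq)) (trans (^-assocʳ β 2 3) β⁶≈1)) cube≉1
    residue 3 _ eq = contradiction (begin
      fromℕ 3
        ≈⟨ solve 1 (λ x → 3 :× 𝟙 := (x :^ 2 :- 𝟙) :* (:- 𝟙 :- x) :+ (x :+ 2 :× 𝟙) :* (x :* x :- x :+ 𝟙)) refl ξ ⟩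
      (ξ ^ 2 - 1#) * (- 1# - ξ) + (ξ + fromℕ 2) * Φ₆ ξ
        ≈⟨ +-cong (*-congʳ (x≈y⇒x-y≈0 (trans (^-congˡ 2 (sym eq)) (trans (^-assocʳ β 3 2) β⁶≈1)))) (*-congˡ Φ₆ξ≈0) ⟩
      0# * (- 1# - ξ) + (ξ + fromℕ 2) * 0#
        ≈⟨ +-cong (zeroˡ _) (zeroʳ _) ⟩
      0# + 0#
        ≈⟨ +-identityˡ 0# ⟩
      0# ∎) 3≉0
    residue 4 _ eq = contradiction (begin
      ξ ^ 3           ≈⟨ ^-congˡ 3 eq ⟨
      (β ^ 4) ^ 3     ≈⟨ trans (^-assocʳ β 4 3) (sym (^-assocʳ β 2 6)) ⟩
      (β ^ 2) ^ 6     ≈⟨ sixth 2 ⟩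
      1#              ∎) cube≉1
    residue 5 _ eq = modulo-Φ₆ Φ₆ξ≈0 (begin
      Φ₆ β
        ≈⟨ solve 2 (λ β ξ → β :* β :- β :+ 𝟙
             := (𝟙 :- ξ :* β) :* (𝟙 :+ ξ :* β :- β) :+ β :^ 2 :* (ξ :* ξ :- ξ :+ 𝟙)) refl β ξ ⟩
      (1# - ξ * β) * (1# + ξ * β - β) + β ^ 2 * Φ₆ ξ
        ≈⟨ +-congʳ (trans (*-congʳ (x≈y⇒x-y≈0 (sym ξβ≈1))) (zeroˡ _)) ⟩
      0# + β ^ 2 * Φ₆ ξ ∎)
      where
      ξβ≈1 : ξ * β ≈ 1#
      ξβ≈1 = trans (*-congʳ (sym eq)) (trans (*-comm _ _) β⁶≈1)
    residue (suc (suc (suc (suc (suc (suc r)))))) r<6 _ = contradiction r<6 (ℕ.m+n≮m 6 r)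

  ∃-Φ₆-root : ∃ λ ξ → Φ₆ ξ ≈ 0#
  ∃-Φ₆-root with algebraically-closed {1} (λ { zero → 1# ; (suc _) → - 1# })
  ... | ξ , eq = ξ , trans (solve 1 (λ x → x :* x :- x :+ 𝟙
    := x :^ 2 :+ (𝟙 :* x :^ 0 :+ ((:- 𝟙) :* x :^ 1 :+ con (+ 0)))) refl ξ) eq

  ∃-^-root : ∀ n .{{_ : ℕ.NonZero n}} ξ → ∃ λ ζ → ζ ^ n ≈ ξ
  ∃-^-root (suc n) ξ = ζ , x-y≈0⇒x≈y _ _ (begin
    ζ ^ suc n - ξ               ≈⟨ +-congˡ (*-identityʳ (- ξ)) ⟨
    ζ ^ suc n + - ξ * 1#        ≈⟨ +-congˡ (sum-single +-commutativeMonoid terms zero rest) ⟨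
    ζ ^ suc n + sum terms       ≈⟨ proj₂ (algebraically-closed coeff) ⟩
    0#                          ∎)
    where
    coeff : Vector Carrier (suc n)
    coeff zero    = - ξ
    coeff (suc _) = 0#

    ζ : Carrier
    ζ = proj₁ (algebraically-closed coeff)

    terms : Vector Carrier (suc n)
    terms i = coeff i * ζ ^ toℕ i

    rest : ∀ j → j ≢ zero → terms j ≈ 0#
    rest zero    0≢0 = contradiction ≡.refl 0≢0
    rest (suc j) _   = zeroˡ _

-- Multiplicative characters and a generator of their group

module CharacterProperties (F : FiniteField c ℓ₁ ℓ₂) (K : AlgebraicallyClosedField₀ c′ ℓ₁′ ℓ₂′) where
  open FiniteField F hiding (zero)
  open FiniteFieldProperties F
  open PrimitiveRoot F
  open Characters F K
  private
    module K = AlgebraicallyClosedField₀ K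
    module KP = AlgebraicallyClosedFieldProperties K
    module U = AbelianGroup (unitGroup commutativeRing)
    module V = AbelianGroup (unitGroup K.commutativeRing)
    module V-properties = GroupProperties V.group
  open KP using () renaming (_^_ to _^K_)
  open GroupHomomorphism
  open SetoidReasoning K.setoid

  -- The extension by zero evaluates χ at an inverse found by search; equality of units compares
  -- first components only, so any other proof of invertibility gives the same value.
  ⟨⟩-unit : ∀ χ (u : U.Carrier) → χ ⟨ proj₁ u ⟩ K.≈ proj₁ (⟦ χ ⟧ u)
  ⟨⟩-unit χ u with invertible? (proj₁ u)
  ... | yes v = ⟦⟧-cong χ {proj₁ u , v} {u} refl
  ... | no ¬u = contradiction (proj₂ u) ¬u

  ⟨⟩-zero : ∀ χ {x} → x ≈ 0# → χ ⟨ x ⟩ K.≈ K.0#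
  ⟨⟩-zero χ {x} x≈0 with invertible? x
  ... | yes x-inv = contradiction x≈0 (invertible⇒≉0 x-inv)
  ... | no _      = K.refl

  unit : ∀ {x} → ¬ x ≈ 0# → U.Carrier
  unit x≉0 = _ , ≉0⇒invertible x≉0

  ⟨⟩-cong : ∀ χ {x y} → x ≈ y → χ ⟨ x ⟩ K.≈ χ ⟨ y ⟩
  ⟨⟩-cong χ {x} {y} x≈y with x ≟ 0#
  ... | yes x≈0 = K.trans (⟨⟩-zero χ x≈0) (K.sym (⟨⟩-zero χ (trans (sym x≈y) x≈0)))
  ... | no x≉0 = K.trans (⟨⟩-unit χ (unit x≉0)) (K.trans
    (⟦⟧-cong χ {unit x≉0} {unit (≉0-cong x≈y x≉0)} x≈y)
    (K.sym (⟨⟩-unit χ (unit (≉0-cong x≈y x≉0)))))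

  ⟨⟩-* : ∀ χ x y → χ ⟨ x * y ⟩ K.≈ χ ⟨ x ⟩ K.* χ ⟨ y ⟩
  ⟨⟩-* χ x y with x ≟ 0# | y ≟ 0#
  ... | yes x≈0 | _ = K.trans (⟨⟩-zero χ (trans (*-congʳ x≈0) (zeroˡ y)))
    (K.sym (K.trans (K.*-congʳ (⟨⟩-zero χ x≈0)) (K.zeroˡ _)))
  ... | no _ | yes y≈0 = K.trans (⟨⟩-zero χ (trans (*-congˡ y≈0) (zeroʳ x)))
    (K.sym (K.trans (K.*-congˡ (⟨⟩-zero χ y≈0)) (K.zeroʳ _)))
  ... | no x≉0 | no y≉0 = begin
    χ ⟨ x * y ⟩                    ≈⟨ ⟨⟩-unit χ (unit x≉0 U.∙ unit y≉0) ⟩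
    proj₁ (⟦ χ ⟧ (unit x≉0 U.∙ unit y≉0)) ≈⟨ homo χ (unit x≉0) (unit y≉0) ⟩
    proj₁ (⟦ χ ⟧ (unit x≉0)) K.* proj₁ (⟦ χ ⟧ (unit y≉0))
      ≈⟨ K.*-cong (⟨⟩-unit χ (unit x≉0)) (⟨⟩-unit χ (unit y≉0)) ⟨
    χ ⟨ x ⟩ K.* χ ⟨ y ⟩ ∎

  ⟨⟩-one : ∀ χ → χ ⟨ 1# ⟩ K.≈ K.1#
  ⟨⟩-one χ = K.trans (⟨⟩-unit χ U.ε) (ε-homo χ)

  ⟨⟩-^ : ∀ χ x n → χ ⟨ x ^ n ⟩ K.≈ (χ ⟨ x ⟩) ^K n
  ⟨⟩-^ χ x zero    = ⟨⟩-one χ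
  ⟨⟩-^ χ x (suc n) = K.trans (⟨⟩-* χ x (x ^ n)) (K.*-congˡ (⟨⟩-^ χ x n))

  ·χ-⟨⟩ : ∀ χ χ′ x → (χ ·χ χ′) ⟨ x ⟩ K.≈ χ ⟨ x ⟩ K.* χ′ ⟨ x ⟩
  ·χ-⟨⟩ χ χ′ x with invertible? x
  ... | yes _ = K.refl
  ... | no _  = K.sym (K.zeroˡ _)

  ε-⟨⟩ : ∀ {x} → ¬ x ≈ 0# → ε ⟨ x ⟩ K.≈ K.1#
  ε-⟨⟩ x≉0 = ⟨⟩-unit ε (unit x≉0)

  conj-⟨⟩ : ∀ χ {x} → ¬ x ≈ 0# → χ ⟨ x ⟩ K.* conj χ ⟨ x ⟩ K.≈ K.1#
  conj-⟨⟩ χ x≉0 = K.trans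
    (K.*-cong (⟨⟩-unit χ (unit x≉0)) (⟨⟩-unit (conj χ) (unit x≉0)))
    (V.inverseʳ (⟦ χ ⟧ (unit x≉0)))

  ⟨⟩-^χ : ∀ χ n {x} → ¬ x ≈ 0# → (χ ^χ n) ⟨ x ⟩ K.≈ (χ ⟨ x ⟩) ^K n
  ⟨⟩-^χ χ zero    x≉0 = ε-⟨⟩ x≉0
  ⟨⟩-^χ χ (suc n) {x} x≉0 = K.trans (·χ-⟨⟩ χ (χ ^χ n) x) (K.*-congˡ (⟨⟩-^χ χ n x≉0))

  ⟨⟩-N : ∀ χ {x} → ¬ x ≈ 0# → (χ ⟨ x ⟩) ^K N K.≈ K.1#
  ⟨⟩-N χ {x} x≉0 = K.trans (K.sym (⟨⟩-^ χ x N)) (K.trans (⟨⟩-cong χ (fermat x≉0)) (⟨⟩-one χ))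

  χ≈χ′⇒⟨⟩ : ∀ {χ χ′} → (∀ u → ⟦ χ ⟧ u V.≈ ⟦ χ′ ⟧ u) → ∀ {x} → ¬ x ≈ 0# → χ ⟨ x ⟩ K.≈ χ′ ⟨ x ⟩
  χ≈χ′⇒⟨⟩ {χ} {χ′} eq x≉0 = K.trans (⟨⟩-unit χ (unit x≉0))
    (K.trans (eq (unit x≉0)) (K.sym (⟨⟩-unit χ′ (unit x≉0))))

  module _ {ζ : K.Carrier} (ζᴺ≈1 : ζ ^K N K.≈ K.1#) where
    private
      ζ-power : ∀ {k} → N ∣ k → ζ ^K k K.≈ K.1#
      ζ-power (divides s ≡.refl) = K.trans (K.sym (K.trans (KP.^-comm ζ N s) (KP.^-assocʳ ζ s N)))
        (K.trans (KP.^-congˡ s ζᴺ≈1) (KP.1^n≈1 s))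

      ζ-respects-≤ : ∀ {i j} → i ℕ.≤ j → γ ^ i ≈ γ ^ j → ζ ^K i K.≈ ζ ^K j
      ζ-respects-≤ {i} {j} i≤j eq = begin
        ζ ^K i                     ≈⟨ K.*-identityʳ _ ⟨
        ζ ^K i K.* K.1#            ≈⟨ K.*-congˡ (ζ-power (γ-difference i≤j eq)) ⟨
        ζ ^K i K.* ζ ^K (j ℕ.∸ i)  ≈⟨ KP.^-homo-* ζ i _ ⟨
        ζ ^K (i ℕ.+ (j ℕ.∸ i))     ≈⟨ KP.^-congʳ ζ (ℕ.m+[n∸m]≡n i≤j) ⟩
        ζ ^K j                     ∎

      -- The exponent of a power of γ is determined only modulo N, and ζ^N = 1 makes ζ^i depend on
      -- γ^i alone. Every law of the character γ ↦ ζ reduces to this.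
      ζ-respects : ∀ i j → γ ^ i ≈ γ ^ j → ζ ^K i K.≈ ζ ^K j
      ζ-respects i j eq with ℕ.≤-total i j
      ... | inj₁ i≤j = ζ-respects-≤ i≤j eq
      ... | inj₂ j≤i = K.sym (ζ-respects-≤ j≤i (sym eq))

      log : U.Carrier → ℕ
      log (x , x-inv) = proj₁ (discrete-log x (invertible⇒≉0 x-inv))

      γ^log : ∀ u → γ ^ log u ≈ proj₁ u
      γ^log (x , x-inv) = proj₂ (discrete-log x (invertible⇒≉0 x-inv))

      value : U.Carrier → V.Carrier
      -- The inverse has exponent i(N - 1), since i + i(N - 1) = iN.
      value u = ζ ^K i , ζ ^K (i ℕ.* (N ℕ.∸ 1)) , K.trans (K.*-comm _ _) right , right
        where
        i = log u
        right : ζ ^K i K.* ζ ^K (i ℕ.* (N ℕ.∸ 1)) K.≈ K.1#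
        right = K.trans (K.sym (KP.^-homo-* ζ i _)) (ζ-power (divides i
          (≡.trans (≡.sym (ℕ.*-suc i (N ℕ.∸ 1))) (≡.cong (i ℕ.*_) (ℕ.suc-pred N)))))

      value-∙ : ∀ u v → value (u U.∙ v) V.≈ value u V.∙ value v
      value-∙ u v = K.trans
        (ζ-respects (log (u U.∙ v)) (log u ℕ.+ log v) (trans (γ^log (u U.∙ v))
          (sym (trans (^-homo-* γ (log u) (log v)) (*-cong (γ^log u) (γ^log v))))))
        (KP.^-homo-* ζ (log u) (log v))

      value-cong : ∀ {u v} → u U.≈ v → value u V.≈ value v
      value-cong {u} {v} u≈v = ζ-respects (log u) (log v)
        (trans (γ^log u) (trans u≈v (sym (γ^log v))))

      value-ε : value U.ε V.≈ V.ε
      value-ε = ζ-respects (log U.ε) 0 (γ^log U.ε)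

    character : Character
    character = record
      { ⟦_⟧ = value
      ; isGroupHomomorphism = record
          { isMonoidHomomorphism = record
              { isMagmaHomomorphism = record
                  { isRelHomomorphism = record { cong = λ {u} {v} → value-cong {u} {v} }
                  ; homo = value-∙
                  }
              ; ε-homo = value-ε
              }
          ; ⁻¹-homo = λ u → V-properties.inverseˡ-unique (value (u U.⁻¹)) (value u)
              (K.trans (K.sym (value-∙ (u U.⁻¹) u))
                (K.trans (value-cong {(u U.⁻¹) U.∙ u} {U.ε} (U.inverseˡ u)) value-ε))
          }
      }

    character-γ : character ⟨ γ ⟩ K.≈ ζ
    character-γ = K.trans (⟨⟩-unit character (unit γ≉0)) (K.trans
      (ζ-respects (log (unit γ≉0)) 1 (trans (γ^log (unit γ≉0)) (sym (*-identityʳ γ))))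
      (K.*-identityʳ ζ))

  -- As χ(x)^N = 1, the exponent -(n + 1) may be replaced by (n + 1)(N - 1).
  powerℤ-⟨⟩ : ∀ χ k {x} → ¬ x ≈ 0# → ∃ λ n → powerℤ group χ k ⟨ x ⟩ K.≈ (χ ⟨ x ⟩) ^K n
  powerℤ-⟨⟩ χ (+ n) x≉0 = n , ⟨⟩-^χ χ n x≉0
  powerℤ-⟨⟩ χ -[1+ n ] {x} x≉0 = suc n ℕ.* (N ℕ.∸ 1) , (begin
    conj ρ ⟨ x ⟩                        ≈⟨ KP.cancel-invertible s-inv (K.trans (conj-⟨⟩ ρ x≉0) (K.sym power-inverse)) ⟩
    s ^K (N ℕ.∸ 1)                      ≈⟨ KP.^-congˡ (N ℕ.∸ 1) (⟨⟩-^χ χ (suc n) x≉0) ⟩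
    (χ ⟨ x ⟩ ^K suc n) ^K (N ℕ.∸ 1)     ≈⟨ KP.^-assocʳ (χ ⟨ x ⟩) (suc n) (N ℕ.∸ 1) ⟩
    χ ⟨ x ⟩ ^K (suc n ℕ.* (N ℕ.∸ 1))    ∎)
    where
    ρ = χ ^χ suc n
    s = ρ ⟨ x ⟩

    s-inv : Invertible K._≈_ K.1# K._*_ s
    s-inv = conj ρ ⟨ x ⟩ , K.trans (K.*-comm _ _) (conj-⟨⟩ ρ x≉0) , conj-⟨⟩ ρ x≉0

    power-inverse : s K.* s ^K (N ℕ.∸ 1) K.≈ K.1#
    power-inverse = K.trans (KP.^-congʳ s (ℕ.suc-pred N)) (⟨⟩-N ρ x≉0)

  -- For a primitive sixth root of unity ξ and a ζ with ζ^m = ξ, consider the character γ ↦ ζ. As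
  -- `T` generates, ζ = t^e for t = T(γ), so (t^m)^e = ξ. Thus t^m is a sixth root of unity with a
  -- primitive one among its powers, and so is itself primitive.
  generator-Φ₆ : ∀ T → IsGenerator group T → ∀ m → N ≡ 6 ℕ.* m →
                 KP.Φ₆ ((T ^χ m) ⟨ γ ⟩) K.≈ K.0#
  generator-Φ₆ T T-generates m N≡6m =
    KP.Φ₆-base e (proj₂ KP.∃-Φ₆-root) sixth-power base-power
    where
    instance
      m-nonZero : ℕ.NonZero m
      m-nonZero = ℕ.≢-nonZero λ m≡0 → ℕ.≢-nonZero⁻¹ N (≡.trans N≡6m (≡.cong (6 ℕ.*_) m≡0))

    ξ = proj₁ KP.∃-Φ₆-root
    ζ = proj₁ (KP.∃-^-root m ξ)
    ζᵐ≈ξ = proj₂ (KP.∃-^-root m ξ)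

    ^N : ∀ x → x ^K N K.≈ (x ^K m) ^K 6
    ^N x = K.trans (KP.^-congʳ x (≡.trans N≡6m (ℕ.*-comm 6 m))) (K.sym (KP.^-assocʳ x m 6))

    ζᴺ≈1 : ζ ^K N K.≈ K.1#
    ζᴺ≈1 = K.trans (^N ζ) (K.trans (KP.^-congˡ 6 ζᵐ≈ξ) (KP.Φ₆-sixth (proj₂ KP.∃-Φ₆-root)))

    χ = character ζᴺ≈1
    k = proj₁ (T-generates χ)
    e = proj₁ (powerℤ-⟨⟩ T k γ≉0)
    β = (T ^χ m) ⟨ γ ⟩
    t = T ⟨ γ ⟩

    tⁿ≈ζ : t ^K e K.≈ ζ
    tⁿ≈ζ = begin
      t ^K e                    ≈⟨ proj₂ (powerℤ-⟨⟩ T k γ≉0) ⟨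
      powerℤ group T k ⟨ γ ⟩    ≈⟨ χ≈χ′⇒⟨⟩ {χ} {powerℤ group T k} (proj₂ (T-generates χ)) γ≉0 ⟨
      χ ⟨ γ ⟩                   ≈⟨ character-γ ζᴺ≈1 ⟩
      ζ                         ∎

    sixth-power : β ^K 6 K.≈ K.1#
    sixth-power = K.trans (KP.^-congˡ 6 (⟨⟩-^χ T m γ≉0)) (K.trans (K.sym (^N t)) (⟨⟩-N T γ≉0))

    base-power : β ^K e K.≈ ξ
    base-power = begin
      β ^K e            ≈⟨ KP.^-congˡ e (⟨⟩-^χ T m γ≉0) ⟩
      (t ^K m) ^K e     ≈⟨ KP.^-comm t m e ⟩
      (t ^K e) ^K m     ≈⟨ KP.^-congˡ m tⁿ≈ζ ⟩
      ζ ^K m            ≈⟨ ζᵐ≈ξ ⟩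
      ξ                 ∎

-- Sums over the field, counting, and the quadratic character

module CharacterSums (F : FiniteField c ℓ₁ ℓ₂) (K : AlgebraicallyClosedField₀ c′ ℓ₁′ ℓ₂′) where
  open FiniteField F hiding (zero)
  open FiniteFieldProperties F
  open Characters F K using (∑; φ)
  private
    module K = AlgebraicallyClosedField₀ K
    module KR = CommutativeRing K.commutativeRing
    module KSum = SemiringSum K.semiring
  open Sums KR.+-commutativeMonoid public
  open SetoidReasoning K.setoid

  Congruent : (Carrier → K.Carrier) → Set (c ⊔ ℓ₁ ⊔ ℓ₁′)
  Congruent f = ∀ {x y} → x ≈ y → f x K.≈ f y

  ∑-cong : ∀ {f g} → (∀ x → f x K.≈ g x) → ∑ f K.≈ ∑ g
  ∑-cong eq = KSum.sum-cong-≋ (λ i → eq (element i))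

  ∑-+ : ∀ f g → ∑ (λ x → f x K.+ g x) K.≈ ∑ f K.+ ∑ g
  ∑-+ f g = KSum.∑-distrib-+ (f ∘ element) (g ∘ element)

  ∑-*ˡ : ∀ k f → ∑ (λ x → k K.* f x) K.≈ k K.* ∑ f
  ∑-*ˡ k f = K.sym (KSum.*-distribˡ-sum k (f ∘ element))

  ∑-*ʳ : ∀ k f → ∑ (λ x → f x K.* k) K.≈ ∑ f K.* k
  ∑-*ʳ k f = K.sym (KSum.*-distribʳ-sum k (f ∘ element))

  ∑-swap : ∀ (f : Carrier → Carrier → K.Carrier) → ∑ (λ x → ∑ (λ y → f x y)) K.≈ ∑ (λ y → ∑ (λ x → f x y))
  ∑-swap f = KSum.∑-comm (λ i j → f (element i) (element j))

  δ : Carrier → Carrier → K.Carrier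
  δ x y with x ≟ y
  ... | yes _ = K.1#
  ... | no _  = K.0#

  δ-1 : ∀ {x y} → x ≈ y → δ x y K.≈ K.1#
  δ-1 {x} {y} x≈y with x ≟ y
  ... | yes _  = K.refl
  ... | no x≉y = contradiction x≈y x≉y

  δ-0 : ∀ {x y} → ¬ x ≈ y → δ x y K.≈ K.0#
  δ-0 {x} {y} x≉y with x ≟ y
  ... | yes x≈y = contradiction x≈y x≉y
  ... | no _    = K.refl

  δ-⇔ : ∀ {x y z w} → (x ≈ y → z ≈ w) → (z ≈ w → x ≈ y) → δ x y K.≈ δ z w
  δ-⇔ {x} {y} {z} {w} to from with x ≟ y
  ... | yes x≈y = K.sym (δ-1 (to x≈y))
  ... | no x≉y  = K.sym (δ-0 (x≉y ∘ from))

  δ-cong : ∀ {x y z w} → x ≈ z → y ≈ w → δ x y K.≈ δ z w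
  δ-cong x≈z y≈w = δ-⇔ (λ x≈y → trans (sym x≈z) (trans x≈y y≈w)) (λ z≈w → trans x≈z (trans z≈w (sym y≈w)))

  ∑-δ : ∀ y → ∑ (λ x → δ x y) K.≈ K.1#
  ∑-δ y = K.trans (∑-single y (λ x≈x′ → δ-cong x≈x′ refl) (λ x → δ-0)) (δ-1 refl)

  -- Change of variables for a map that need not be injective: each value is weighted by its fibre.
  -- The weight `w` allows points to be left out, such as s = 0 for s + 1/s.
  ∑-fibres : ∀ {g} (h : Carrier → Carrier) (w : Carrier → K.Carrier) → Congruent g →
             ∑ (λ x → w x K.* g (h x)) K.≈ ∑ (λ y → ∑ (λ x → w x K.* δ (h x) y) K.* g y)
  ∑-fibres {g} h w g-cong = begin
    ∑ (λ x → w x K.* g (h x))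
      ≈⟨ ∑-cong (λ x → begin
           w x K.* g (h x)
             ≈⟨ K.*-congʳ (K.trans (K.*-congˡ (δ-1 refl)) (K.*-identityʳ _)) ⟨
           w x K.* δ (h x) (h x) K.* g (h x)
             ≈⟨ ∑-single (h x) (λ eq → K.*-cong (K.*-congˡ (δ-cong refl eq)) (g-cong eq))
                  (λ y y≉hx → K.trans (K.*-congʳ (K.trans (K.*-congˡ (δ-0 (y≉hx ∘ sym))) (K.zeroʳ _))) (K.zeroˡ _)) ⟨
           ∑ (λ y → w x K.* δ (h x) y K.* g y) ∎) ⟩
    ∑ (λ x → ∑ (λ y → w x K.* δ (h x) y K.* g y))
      ≈⟨ ∑-swap (λ x y → w x K.* δ (h x) y K.* g y) ⟩
    ∑ (λ y → ∑ (λ x → w x K.* δ (h x) y K.* g y))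
      ≈⟨ ∑-cong (λ y → ∑-*ʳ (g y) (λ x → w x K.* δ (h x) y)) ⟩
    ∑ (λ y → ∑ (λ x → w x K.* δ (h x) y) K.* g y) ∎

  ∑-fibres₁ : ∀ {g} (h : Carrier → Carrier) → Congruent g →
              ∑ (λ x → g (h x)) K.≈ ∑ (λ y → ∑ (λ x → δ (h x) y) K.* g y)
  ∑-fibres₁ {g} h g-cong = begin
    ∑ (λ x → g (h x))
      ≈⟨ ∑-cong (λ x → K.*-identityˡ (g (h x))) ⟨
    ∑ (λ x → K.1# K.* g (h x))
      ≈⟨ ∑-fibres h (λ _ → K.1#) g-cong ⟩
    ∑ (λ y → ∑ (λ x → K.1# K.* δ (h x) y) K.* g y)
      ≈⟨ ∑-cong (λ y → K.*-congʳ {g y} (∑-cong (λ x → K.*-identityˡ (δ (h x) y)))) ⟩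
    ∑ (λ y → ∑ (λ x → δ (h x) y) K.* g y) ∎

  φ-zero : ∀ {x} → x ≈ 0# → φ x K.≈ K.0#
  φ-zero {x} x≈0 with x ≟ 0# | isSquare? x
  ... | yes _  | _ = K.refl
  ... | no x≉0 | _ = contradiction x≈0 x≉0

  φ-square : ∀ {x y} → ¬ x ≈ 0# → y * y ≈ x → φ x K.≈ K.1#
  φ-square {x} {y} x≉0 y²≈x with x ≟ 0# | isSquare? x
  ... | yes x≈0 | _     = contradiction x≈0 x≉0
  ... | no _    | yes _ = K.refl
  ... | no _    | no ¬s = contradiction (y , y²≈x) ¬s

  φ-nonsquare : ∀ {x} → ¬ (∃ λ y → y * y ≈ x) → φ x K.≈ K.- K.1#
  φ-nonsquare {x} ¬s with x ≟ 0# | isSquare? x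
  ... | yes x≈0 | _     = contradiction (0# , trans (zeroˡ 0#) (sym x≈0)) ¬s
  ... | no _    | yes s = contradiction s ¬s
  ... | no _    | no _  = K.refl

  data QuadraticType (x : Carrier) : Set (c ⊔ ℓ₁) where
    zero      : x ≈ 0# → QuadraticType x
    square    : ¬ x ≈ 0# → ∀ y → y * y ≈ x → QuadraticType x
    nonsquare : ¬ (∃ λ y → y * y ≈ x) → QuadraticType x

  quadraticType : ∀ x → QuadraticType x
  quadraticType x with x ≟ 0# | isSquare? x
  ... | yes x≈0 | _             = zero x≈0
  ... | no x≉0  | yes (y , y²≈x) = square x≉0 y y²≈x
  ... | no _    | no ¬s         = nonsquare ¬s

  φ-cong : Congruent φ
  φ-cong {x} {y} x≈y with quadraticType x
  ... | zero x≈0       = K.trans (φ-zero x≈0) (K.sym (φ-zero (trans (sym x≈y) x≈0)))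
  ... | square x≉0 z z²≈x = K.trans (φ-square x≉0 z²≈x)
    (K.sym (φ-square (≉0-cong x≈y x≉0) (trans z²≈x x≈y)))
  ... | nonsquare ¬s   = K.trans (φ-nonsquare ¬s)
    (K.sym (φ-nonsquare (λ (z , z²≈y) → ¬s (z , trans z²≈y (sym x≈y)))))

  -- A complete list of roots turns the indicator of the equation into a sum of indicators of
  -- points, each of which sums to 1.
  count-solutions : ∀ (h : Carrier → Carrier) u k (root : Fin k → Carrier) →
    (∀ {x y} → x ≈ y → h x ≈ h y) → Injective _≡_ _≈_ root → (∀ i → h (root i) ≈ u) →
    (∀ x → h x ≈ u → ∃ λ i → x ≈ root i) → ∑ (λ x → δ (h x) u) K.≈ K.fromℕ k
  count-solutions h u k root h-cong root-inj sound complete = begin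
    ∑ (λ x → δ (h x) u)                     ≈⟨ ∑-cong δ-roots ⟩
    ∑ (λ x → KSum.sum (λ i → δ x (root i))) ≈⟨ KSum.∑-comm (λ j i → δ (element j) (root i)) ⟩
    KSum.sum (λ i → ∑ (λ x → δ x (root i))) ≈⟨ KSum.sum-cong-≋ (λ i → ∑-δ (root i)) ⟩
    KSum.sum {k} (λ _ → K.1#)               ≈⟨ KSum.sum-replicate k ⟩
    K.fromℕ k                               ∎
    where
    δ-roots : ∀ x → δ (h x) u K.≈ KSum.sum (λ i → δ x (root i))
    δ-roots x with h x ≟ u
    ... | yes hx≈u with complete x hx≈u
    ... | i , x≈rᵢ = K.sym (K.trans
      (sum-single KR.+-commutativeMonoid (λ i → δ x (root i)) i
        (λ j j≢i → δ-0 (λ x≈rⱼ → j≢i (root-inj (trans (sym x≈rⱼ) x≈rᵢ)))))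
      (δ-1 x≈rᵢ))
    δ-roots x | no hx≉u = K.sym (K.trans
      (KSum.sum-cong-≋ (λ i → δ-0 (λ x≈rᵢ → hx≉u (trans (h-cong x≈rᵢ) (sound i)))))
      (KSum.sum-replicate-zero k))

-- A maps the primitive root γ to a primitive sixth root of unity.
IsSextic : (F : FiniteField c ℓ₁ ℓ₂) (K : AlgebraicallyClosedField₀ c′ ℓ₁′ ℓ₂′) →
           Characters.Character F K → Set ℓ₁′
IsSextic F K A = Φ₆ (A ⟨ γ ⟩) ≈ 0#
  where
  open AlgebraicallyClosedField₀ K using (_≈_; 0#)
  open AlgebraicallyClosedFieldProperties K using (Φ₆)
  open Characters F K using (_⟨_⟩)
  open PrimitiveRoot F using (γ)

-- Roots of unity in the finite field, and φ as the cube of a sextic character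

module SexticCharacter
  (F : FiniteField c ℓ₁ ℓ₂) (K : AlgebraicallyClosedField₀ c′ ℓ₁′ ℓ₂′)
  (m : ℕ) (N≡6m : FiniteField.q F ℕ.∸ 1 ≡ 6 ℕ.* m)
  (A : Characters.Character F K)
  (Φ₆[Aγ]≈0 : IsSextic F K A)
  where
  open FiniteField F hiding (zero)
  open FiniteFieldProperties F
  open PrimitiveRoot F
  open Characters F K
  open CharacterProperties F K
  open CharacterSums F K
  private
    module K = AlgebraicallyClosedField₀ K
    module KP = AlgebraicallyClosedFieldProperties K
    module KR = CommutativeRing K.commutativeRing
    module KS = IntegerSolver K.commutativeRing
  open KP using () renaming (_^_ to _^K_)

  private
    instance
      m-nonZero : ℕ.NonZero m
      m-nonZero = ℕ.≢-nonZero λ m≡0 → ℕ.≢-nonZero⁻¹ N (≡.trans N≡6m (≡.cong (6 ℕ.*_) m≡0))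

    γ-root : ℕ → Carrier
    γ-root k = γ ^ (k ℕ.* m)

    γ-root≉1 : ∀ k .{{_ : ℕ.NonZero k}} → k ℕ.< 6 → ¬ γ-root k ≈ 1#
    γ-root≉1 k k<6 eq = ℕ.<⇒≱ (ℕ.*-monoˡ-< m k<6)
      (≡.subst (ℕ._≤ k ℕ.* m) N≡6m (ℕ.∣⇒≤ {{ℕ.m*n≢0 k m}} (γ-order (k ℕ.* m) eq)))

    γ-root-^ : ∀ k l → l ℕ.* k ≡ 6 → γ-root k ^ l ≈ 1#
    γ-root-^ k l lk≡6 = trans (^-assocˡ γ (k ℕ.* m) l)
      (trans (^-congʳ γ (≡.trans (≡.sym (ℕ.*-assoc l k m)) (≡.trans (≡.cong (ℕ._* m) lk≡6) (≡.sym N≡6m))))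
        (fermat γ≉0))

  -- In characteristic 2 or 3, the only second or third root of unity would be 1.
  2≉0 : ¬ 2 · 1# ≈ 0#
  2≉0 2≈0 = γ-root≉1 3 (ℕ.m≤m+n 4 2) (x-y≈0⇒x≈y _ _ (Sum.[ id , id ]′ (zero-product square≈0)))
    where
    open IntegerSolver commutativeRing
    x = γ-root 3
    square≈0 : (x - 1#) * (x - 1#) ≈ 0#
    square≈0 = trans
      (solve 1 (λ x → (x :- 𝟙) :* (x :- 𝟙) := (x :^ 2 :- 𝟙) :+ (2 :× 𝟙) :* (𝟙 :- x)) refl x)
      (trans (+-cong (x≈y⇒x-y≈0 (γ-root-^ 3 2 ≡.refl)) (trans (*-congʳ 2≈0) (zeroˡ _))) (+-identityˡ 0#))

  private
    γ-root-2-relation : γ-root 2 * γ-root 2 + γ-root 2 + 1# ≈ 0#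
    γ-root-2-relation = Sum.[ (λ eq → contradiction (x-y≈0⇒x≈y _ _ eq) (γ-root≉1 2 (ℕ.m≤m+n 3 3))) , id ]′
      (zero-product (trans
        (solve 1 (λ x → (x :- 𝟙) :* (x :* x :+ x :+ 𝟙) := x :^ 3 :- 𝟙) refl (γ-root 2))
        (x≈y⇒x-y≈0 (γ-root-^ 2 3 ≡.refl))))
      where open IntegerSolver commutativeRing

  abstract
    -- The primitive cube root of unity γ^((q-1)/3). It provides the cube roots of a cube and the
    -- square root 2ω + 1 of -3.
    ω : Carrier
    ω = γ-root 2

    ω-relation : ω * ω + ω + 1# ≈ 0#
    ω-relation = γ-root-2-relation

    ω≉1 : ¬ ω ≈ 1#
    ω≉1 = γ-root≉1 2 (ℕ.m≤m+n 3 3)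

  3≉0 : ¬ 3 · 1# ≈ 0#
  3≉0 3≈0 = ω≉1 (x-y≈0⇒x≈y _ _ (Sum.[ id , id ]′ (zero-product square≈0)))
    where
    open IntegerSolver commutativeRing
    square≈0 : (ω - 1#) * (ω - 1#) ≈ 0#
    square≈0 = trans
      (solve 1 (λ x → (x :- 𝟙) :* (x :- 𝟙) := (x :* x :+ x :+ 𝟙) :+ (3 :× 𝟙) :* (:- x)) refl ω)
      (trans (+-cong ω-relation (trans (*-congʳ 3≈0) (zeroˡ _))) (+-identityˡ 0#))

  private
    β : K.Carrier
    β = A ⟨ γ ⟩

    β³≈-1 : β ^K 3 K.≈ K.- K.1#
    β³≈-1 = KP.Φ₆-cube Φ₆[Aγ]≈0

    A-γ^ : ∀ i k → (A ⟨ γ ^ i ⟩) ^K k K.≈ (β ^K k) ^K i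
    A-γ^ i k = K.trans (KP.^-congˡ k (⟨⟩-^ A γ i)) (KP.^-comm β i k)

  module _ where
    open SetoidReasoning K.setoid

    A-sixth : ∀ {x} → ¬ x ≈ 0# → A ⟨ x ⟩ ^K 6 K.≈ K.1#
    A-sixth {x} x≉0 with discrete-log x x≉0
    ... | i , γⁱ≈x = begin
      A ⟨ x ⟩ ^K 6       ≈⟨ KP.^-congˡ 6 (⟨⟩-cong A γⁱ≈x) ⟨
      A ⟨ γ ^ i ⟩ ^K 6   ≈⟨ A-γ^ i 6 ⟩
      (β ^K 6) ^K i      ≈⟨ KP.^-congˡ i (KP.Φ₆-sixth Φ₆[Aγ]≈0) ⟩
      K.1# ^K i          ≈⟨ KP.1^n≈1 i ⟩
      K.1#               ∎

    -- On y² the cube of `A` is A(y)⁶ = 1, and on an odd power of γ it is an odd power of A(γ)³ =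
    -- -1. This is where the multiplicativity of `φ`, which is defined by cases, comes from.
    φ≈A³ : ∀ x → φ x K.≈ A ⟨ x ⟩ ^K 3
    φ≈A³ x with quadraticType x
    ... | zero x≈0 = K.trans (φ-zero x≈0) (K.sym (K.trans (K.*-congʳ (⟨⟩-zero A x≈0)) (K.zeroˡ _)))
    ... | square x≉0 y y²≈x = K.trans (φ-square x≉0 y²≈x) (K.sym (begin
      A ⟨ x ⟩ ^K 3             ≈⟨ KP.^-congˡ 3 (⟨⟩-cong A y²≈x) ⟨
      A ⟨ y * y ⟩ ^K 3         ≈⟨ KP.^-congˡ 3 (⟨⟩-* A y y) ⟩
      (A ⟨ y ⟩ K.* A ⟨ y ⟩) ^K 3 ≈⟨ KS.solve 1 (λ a → (a KS.:* a) KS.:^ 3 KS.:= a KS.:^ 6) K.refl (A ⟨ y ⟩) ⟩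
      A ⟨ y ⟩ ^K 6             ≈⟨ A-sixth (proj₁ (factors-≉0 (≉0-cong (sym y²≈x) x≉0))) ⟩
      K.1#                     ∎))
    ... | nonsquare ¬s with discrete-log x (λ x≈0 → ¬s (0# , trans (zeroˡ 0#) (sym x≈0)))
    ... | i , γⁱ≈x with parity i
    ... | j , inj₁ ≡.refl = contradiction (γ ^ j , trans (sym (^-homo-* γ j j)) γⁱ≈x) ¬s
    ... | j , inj₂ ≡.refl = K.trans (φ-nonsquare ¬s) (K.sym (begin
      A ⟨ x ⟩ ^K 3                          ≈⟨ KP.^-congˡ 3 (⟨⟩-cong A γⁱ≈x) ⟨
      A ⟨ γ ^ suc (j ℕ.+ j) ⟩ ^K 3          ≈⟨ A-γ^ (suc (j ℕ.+ j)) 3 ⟩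
      (β ^K 3) ^K suc (j ℕ.+ j)             ≈⟨ KP.^-congˡ (suc (j ℕ.+ j)) β³≈-1 ⟩
      K.- K.1# K.* (K.- K.1#) ^K (j ℕ.+ j)  ≈⟨ K.*-congˡ (KP.^-homo-* (K.- K.1#) j j) ⟩
      K.- K.1# K.* ((K.- K.1#) ^K j K.* (K.- K.1#) ^K j)  ≈⟨ K.*-congˡ (KP.-1-square j) ⟩
      K.- K.1# K.* K.1#                     ≈⟨ K.*-identityʳ _ ⟩
      K.- K.1#                              ∎))

-- The cubic characters, and square roots

module SexticSums
  (F : FiniteField c ℓ₁ ℓ₂) (K : AlgebraicallyClosedField₀ c′ ℓ₁′ ℓ₂′)
  (m : ℕ) (N≡6m : FiniteField.q F ℕ.∸ 1 ≡ 6 ℕ.* m)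
  (A : Characters.Character F K)
  (Φ₆[Aγ]≈0 : IsSextic F K A)
  where
  open FiniteField F hiding (zero)
  open FiniteFieldProperties F
  open PrimitiveRoot F
  open Characters F K
  open CharacterProperties F K
  open CharacterSums F K
  open SexticCharacter F K m N≡6m A Φ₆[Aγ]≈0
  private
    module K = AlgebraicallyClosedField₀ K
    module KP = AlgebraicallyClosedFieldProperties K
    module KR = CommutativeRing K.commutativeRing
  open KP using () renaming (_^_ to _^K_)

  open SetoidReasoning K.setoid

  φ-* : ∀ x y → φ (x * y) K.≈ φ x K.* φ y
  φ-* x y = begin
    φ (x * y)                        ≈⟨ φ≈A³ (x * y) ⟩
    A ⟨ x * y ⟩ ^K 3                 ≈⟨ KP.^-congˡ 3 (⟨⟩-* A x y) ⟩
    (A ⟨ x ⟩ K.* A ⟨ y ⟩) ^K 3       ≈⟨ KP.^-distrib-* _ _ 3 ⟩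
    A ⟨ x ⟩ ^K 3 K.* A ⟨ y ⟩ ^K 3    ≈⟨ K.*-cong (φ≈A³ x) (φ≈A³ y) ⟨
    φ x K.* φ y                      ∎

  φ-*-square : ∀ {x} → ¬ x ≈ 0# → φ x K.* φ x K.≈ K.1#
  φ-*-square {x} x≉0 = K.trans (K.sym (φ-* x x)) (φ-square (*-≉0 x≉0 x≉0) refl)

  -- The two cubic characters, inverse to each other because A⁶ is trivial. As powers of values they
  -- vanish at zero by themselves.
  η η̄ : Carrier → K.Carrier
  η x = A ⟨ x ⟩ ^K 2
  η̄ x = A ⟨ x ⟩ ^K 4

  η-cong : Congruent η
  η-cong eq = KP.^-congˡ 2 (⟨⟩-cong A eq)

  η̄-cong : Congruent η̄
  η̄-cong eq = KP.^-congˡ 4 (⟨⟩-cong A eq)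

  η-inv : ∀ x → η (inv x) K.≈ η̄ x
  η-inv x with x ≟ 0#
  ... | yes x≈0 = K.trans
    (K.trans (KP.^-congˡ 2 (⟨⟩-zero A (inv-zero x≈0))) (K.zeroˡ _))
    (K.sym (K.trans (KP.^-congˡ 4 (⟨⟩-zero A x≈0)) (K.zeroˡ _)))
  ... | no x≉0 = begin
    η (inv x)                            ≈⟨ K.*-identityʳ _ ⟨
    η (inv x) K.* K.1#                   ≈⟨ K.*-congˡ (A-sixth x≉0) ⟨
    η (inv x) K.* A ⟨ x ⟩ ^K 6           ≈⟨ K.*-congˡ (KP.^-homo-* (A ⟨ x ⟩) 2 4) ⟩
    η (inv x) K.* (η x K.* η̄ x)          ≈⟨ K.*-assoc _ _ _ ⟨
    η (inv x) K.* η x K.* η̄ x            ≈⟨ K.*-congʳ (KP.^-distrib-* _ _ 2) ⟨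
    (A ⟨ inv x ⟩ K.* A ⟨ x ⟩) ^K 2 K.* η̄ x
      ≈⟨ K.*-congʳ (KP.^-congˡ 2 (K.trans (K.sym (⟨⟩-* A (inv x) x))
           (K.trans (⟨⟩-cong A (inv-inverseˡ x≉0)) (⟨⟩-one A)))) ⟩
    K.1# ^K 2 K.* η̄ x                    ≈⟨ K.trans (K.*-congʳ (KP.1^n≈1 2)) (K.*-identityˡ _) ⟩
    η̄ x                                  ∎

  module _ where
    open IntegerSolver commutativeRing
    private module ≈ = SetoidReasoning setoid

    x≈-x⇒x≈0 : ∀ {x} → x ≈ - x → x ≈ 0#
    x≈-x⇒x≈0 {x} x≈-x = *-cancelˡ 2≉0 (trans
      (trans (solve 1 (λ x → (2 :× 𝟙) :* x := x :- :- x) refl x) (x≈y⇒x-y≈0 x≈-x))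
      (sym (zeroʳ _)))

    square-roots : ∀ {x y} → x * x ≈ y * y → x ≈ y ⊎ x ≈ - y
    square-roots {x} {y} x²≈y² = Sum.map (x-y≈0⇒x≈y _ _)
      (λ eq → x-y≈0⇒x≈y _ _ (trans (solve 2 (λ x y → x :- :- y := x :+ y) refl x y) eq))
      (zero-product (trans
        (solve 2 (λ x y → (x :- y) :* (x :+ y) := x :* x :- y :* y) refl x y) (x≈y⇒x-y≈0 x²≈y²)))

    count-square-roots : ∀ u → ∑ (λ x → δ (x * x) u) K.≈ K.1# K.+ φ u
    count-square-roots u with quadraticType u
    ... | zero u≈0 = K.trans
      (count-solutions (λ x → x * x) u 1 (λ _ → 0#) (λ eq → *-cong eq eq)
        (λ { {zero} {zero} _ → ≡.refl }) (λ _ → trans (zeroˡ 0#) (sym u≈0))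
        (λ x x²≈u → zero , Sum.[ id , id ]′ (zero-product (trans x²≈u u≈0))))
      (K.+-congˡ (K.sym (φ-zero u≈0)))
    ... | nonsquare ¬s = K.trans
      (count-solutions (λ x → x * x) u 0 (λ ()) (λ eq → *-cong eq eq) (λ { {()} }) (λ ())
        (λ x x²≈u → contradiction (x , x²≈u) ¬s))
      (K.sym (K.trans (K.+-congˡ (φ-nonsquare ¬s)) (K.-‿inverseʳ K.1#)))
    ... | square u≉0 s s²≈u = K.trans
      (count-solutions (λ x → x * x) u 2 root (λ eq → *-cong eq eq) root-inj
        (λ { zero → s²≈u ; (suc zero) → trans (solve 1 (λ s → (:- s) :* (:- s) := s :* s) refl s) s²≈u })
        complete)
      (K.+-congˡ (K.trans (K.+-identityʳ _) (K.sym (φ-square u≉0 s²≈u))))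
      where
      root : Fin 2 → Carrier
      root zero       = s
      root (suc zero) = - s

      s≉-s : ¬ s ≈ - s
      s≉-s eq = proj₁ (factors-≉0 (≉0-cong (sym s²≈u) u≉0)) (x≈-x⇒x≈0 eq)

      root-inj : Injective _≡_ _≈_ root
      root-inj {zero}     {zero}     _  = ≡.refl
      root-inj {zero}     {suc zero} eq = contradiction eq s≉-s
      root-inj {suc zero} {zero}     eq = contradiction (sym eq) s≉-s
      root-inj {suc zero} {suc zero} _  = ≡.refl

      complete : ∀ x → x * x ≈ u → ∃ λ i → x ≈ root i
      complete x x²≈u = Sum.[ zero ,_ , suc zero ,_ ]′ (square-roots (trans x²≈u (sym s²≈u)))

    ω≉0 : ¬ ω ≈ 0#
    ω≉0 ω≈0 = 1≉0 (≈.begin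
      1#                         ≈.≈⟨ solve 1 (λ x → 𝟙 := (x :* x :+ x :+ 𝟙) :+ x :* (:- x :- 𝟙)) refl ω ⟩
      ω * ω + ω + 1# + ω * (- ω - 1#)  ≈.≈⟨ +-cong ω-relation (trans (*-congʳ ω≈0) (zeroˡ _)) ⟩
      0# + 0#                    ≈.≈⟨ +-identityˡ 0# ⟩
      0#                         ≈.∎)

-- Counting cube roots and roots of quadratics

module RootCounts
  (F : FiniteField c ℓ₁ ℓ₂) (K : AlgebraicallyClosedField₀ c′ ℓ₁′ ℓ₂′)
  (m : ℕ) (N≡6m : FiniteField.q F ℕ.∸ 1 ≡ 6 ℕ.* m)
  (A : Characters.Character F K)
  (Φ₆[Aγ]≈0 : IsSextic F K A)
  where
  open FiniteField F hiding (zero)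
  open FiniteFieldProperties F
  open PrimitiveRoot F
  open Characters F K
  open CharacterProperties F K
  open CharacterSums F K
  open SexticCharacter F K m N≡6m A Φ₆[Aγ]≈0
  open SexticSums F K m N≡6m A Φ₆[Aγ]≈0
  private
    module K = AlgebraicallyClosedField₀ K
    module KP = AlgebraicallyClosedFieldProperties K
    module KR = CommutativeRing K.commutativeRing
    module KS = IntegerSolver K.commutativeRing
  open KP using () renaming (_^_ to _^K_)

  open SetoidReasoning K.setoid

  A-cube : ∀ x y → A ⟨ x ^ 3 * y ⟩ K.≈ A ⟨ x ⟩ ^K 3 K.* A ⟨ y ⟩
  A-cube x y = K.trans (⟨⟩-* A (x ^ 3) y) (K.*-congʳ (⟨⟩-^ A x 3))

  η-cube : ∀ {x} y → ¬ x ≈ 0# → η (x ^ 3 * y) K.≈ η y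
  η-cube {x} y x≉0 = begin
    A ⟨ x ^ 3 * y ⟩ ^K 2                    ≈⟨ KP.^-congˡ 2 (A-cube x y) ⟩
    (A ⟨ x ⟩ ^K 3 K.* A ⟨ y ⟩) ^K 2         ≈⟨ KS.solve 2 (λ a b → (a KS.:^ 3 KS.:* b) KS.:^ 2 KS.:= a KS.:^ 6 KS.:* b KS.:^ 2) K.refl (A ⟨ x ⟩) (A ⟨ y ⟩) ⟩
    A ⟨ x ⟩ ^K 6 K.* η y                    ≈⟨ K.trans (K.*-congʳ (A-sixth x≉0)) (K.*-identityˡ _) ⟩
    η y                                     ∎

  η̄-cube : ∀ {x} y → ¬ x ≈ 0# → η̄ (x ^ 3 * y) K.≈ η̄ y
  η̄-cube {x} y x≉0 = begin
    A ⟨ x ^ 3 * y ⟩ ^K 4                    ≈⟨ KP.^-congˡ 4 (A-cube x y) ⟩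
    (A ⟨ x ⟩ ^K 3 K.* A ⟨ y ⟩) ^K 4         ≈⟨ KS.solve 2 (λ a b → (a KS.:^ 3 KS.:* b) KS.:^ 4 KS.:= (a KS.:^ 6) KS.:^ 2 KS.:* b KS.:^ 4) K.refl (A ⟨ x ⟩) (A ⟨ y ⟩) ⟩
    (A ⟨ x ⟩ ^K 6) ^K 2 K.* η̄ y             ≈⟨ K.trans (K.*-congʳ (K.trans (KP.^-congˡ 2 (A-sixth x≉0)) (KP.1^n≈1 2))) (K.*-identityˡ _) ⟩
    η̄ y                                     ∎

  -- The sum of the characters of order dividing 3, with the trivial one taken as 1 at zero too.
  -- There the sum is 1, matching the single cube root of zero.
  cubicSum : Carrier → K.Carrier
  cubicSum x = K.1# K.+ η x K.+ η̄ x

  cubicSum-cong : Congruent cubicSum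
  cubicSum-cong eq = K.+-cong (K.+-congˡ (η-cong eq)) (η̄-cong eq)

  cubicSum-cube : ∀ {x} y → ¬ x ≈ 0# → cubicSum (x ^ 3 * y) K.≈ cubicSum y
  cubicSum-cube y x≉0 = K.+-cong (K.+-congˡ (η-cube y x≉0)) (η̄-cube y x≉0)

  cubicSum-0 : ∀ {x} → x ≈ 0# → cubicSum x K.≈ K.fromℕ 1
  cubicSum-0 x≈0 = K.trans
    (K.+-cong (K.+-congˡ (KP.^-congˡ 2 (⟨⟩-zero A x≈0))) (KP.^-congˡ 4 (⟨⟩-zero A x≈0)))
    (KS.solve 0 (KS.𝟙 KS.:+ KS.con (+ 0) KS.:^ 2 KS.:+ KS.con (+ 0) KS.:^ 4 KS.:= 1 KS.:× KS.𝟙) K.refl)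

  cubicSum-1 : cubicSum 1# K.≈ K.fromℕ 3
  cubicSum-1 = K.trans
    (K.+-cong (K.+-congˡ (KP.^-congˡ 2 (⟨⟩-one A))) (KP.^-congˡ 4 (⟨⟩-one A)))
    (KS.solve 0 (KS.𝟙 KS.:+ KS.𝟙 KS.:^ 2 KS.:+ KS.𝟙 KS.:^ 4 KS.:= 3 KS.:× KS.𝟙) K.refl)

  cubicSum-γ : cubicSum γ K.≈ K.0#
  cubicSum-γ = KP.Φ₆-square Φ₆[Aγ]≈0

  cubicSum-γ² : cubicSum (γ * γ) K.≈ K.0#
  cubicSum-γ² = begin
    cubicSum (γ * γ)
      ≈⟨ K.+-cong (K.+-congˡ (KP.^-congˡ 2 (⟨⟩-* A γ γ))) (KP.^-congˡ 4 (⟨⟩-* A γ γ)) ⟩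
    K.1# K.+ (β K.* β) ^K 2 K.+ (β K.* β) ^K 4
      ≈⟨ KS.solve 1 (λ b → KS.𝟙 KS.:+ (b KS.:* b) KS.:^ 2 KS.:+ (b KS.:* b) KS.:^ 4
           KS.:= KS.𝟙 KS.:+ b KS.:^ 2 KS.:* b KS.:^ 6 KS.:+ b KS.:^ 4) K.refl β ⟩
    K.1# K.+ β ^K 2 K.* β ^K 6 K.+ β ^K 4
      ≈⟨ K.+-congʳ (K.+-congˡ (K.trans (K.*-congˡ (KP.Φ₆-sixth Φ₆[Aγ]≈0)) (K.*-identityʳ _))) ⟩
    K.1# K.+ β ^K 2 K.+ β ^K 4
      ≈⟨ KP.Φ₆-square Φ₆[Aγ]≈0 ⟩
    K.0# ∎
    where β = A ⟨ γ ⟩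

  module _ where
    open IntegerSolver commutativeRing

    cube-roots : ∀ {x y} → x ^ 3 ≈ y ^ 3 → x ≈ y ⊎ x ≈ ω * y ⊎ x ≈ ω * ω * y
    cube-roots {x} {y} x³≈y³ =
      Sum.map (x-y≈0⇒x≈y _ _) (Sum.map (x-y≈0⇒x≈y _ _) (x-y≈0⇒x≈y _ _) ∘ zero-product)
        (zero-product (trans
          (solve 3 (λ x y w → (x :- y) :* ((x :- w :* y) :* (x :- w :* w :* y))
            := (x :^ 3 :- y :^ 3) :+ (w :* w :+ w :+ 𝟙) :* (w :* x :* y :^ 2 :- x :^ 2 :* y :- (w :- 𝟙) :* y :^ 3))
            refl x y ω)
          (trans (+-cong (x≈y⇒x-y≈0 x³≈y³) (trans (*-congʳ ω-relation) (zeroˡ _))) (+-identityˡ 0#))))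

    ω³≈1 : ω ^ 3 ≈ 1#
    ω³≈1 = trans
      (solve 1 (λ x → x :^ 3 := 𝟙 :+ (x :* x :+ x :+ 𝟙) :* (x :- 𝟙)) refl ω)
      (trans (+-congˡ (trans (*-congʳ ω-relation) (zeroˡ _))) (+-identityʳ 1#))

    ω*≉ : ∀ {y} → ¬ y ≈ 0# → ¬ y ≈ ω * y
    ω*≉ {y} y≉0 eq = ω≉1 (sym (*-cancelˡ y≉0 (trans (*-identityʳ y) (trans eq (*-comm ω y)))))

    count-cubes : ∀ {u s} → ¬ s ≈ 0# → s ^ 3 ≈ u → ∑ (λ x → δ (x ^ 3) u) K.≈ K.fromℕ 3
    count-cubes {u} {s} s≉0 s³≈u =
      count-solutions (_^ 3) u 3 root (^-congˡ 3) root-inj sound complete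
      where
      root : Fin 3 → Carrier
      root zero             = s
      root (suc zero)       = ω * s
      root (suc (suc zero)) = ω * ω * s

      ωs≉ω²s : ¬ ω * s ≈ ω * ω * s
      ωs≉ω²s eq = ω*≉ (*-≉0 ω≉0 s≉0) (trans eq (*-assoc ω ω s))

      s≉ω²s : ¬ s ≈ ω * ω * s
      s≉ω²s eq = ω*≉ s≉0 (sym (trans (*-congˡ eq) (trans
        (solve 2 (λ w s → w :* (w :* w :* s) := w :^ 3 :* s) refl ω s)
        (trans (*-congʳ ω³≈1) (*-identityˡ s)))))

      root-inj : Injective _≡_ _≈_ root
      root-inj {zero}           {zero}           _  = ≡.refl
      root-inj {zero}           {suc zero}       eq = contradiction eq (ω*≉ s≉0)
      root-inj {zero}           {suc (suc zero)} eq = contradiction eq s≉ω²s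
      root-inj {suc zero}       {zero}           eq = contradiction (sym eq) (ω*≉ s≉0)
      root-inj {suc zero}       {suc zero}       _  = ≡.refl
      root-inj {suc zero}       {suc (suc zero)} eq = contradiction eq ωs≉ω²s
      root-inj {suc (suc zero)} {zero}           eq = contradiction (sym eq) s≉ω²s
      root-inj {suc (suc zero)} {suc zero}       eq = contradiction (sym eq) ωs≉ω²s
      root-inj {suc (suc zero)} {suc (suc zero)} _  = ≡.refl

      cube-ω* : ∀ {y} → y ^ 3 ≈ u → (ω * y) ^ 3 ≈ u
      cube-ω* {y} y³≈u = trans (^-distrib-* ω y 3) (trans (*-cong ω³≈1 y³≈u) (*-identityˡ u))

      sound : ∀ i → root i ^ 3 ≈ u
      sound zero             = s³≈u
      sound (suc zero)       = cube-ω* s³≈u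
      sound (suc (suc zero)) = trans (^-congˡ 3 (*-assoc ω ω s)) (cube-ω* (cube-ω* s³≈u))

      complete : ∀ x → x ^ 3 ≈ u → ∃ λ i → x ≈ root i
      complete x x³≈u = Sum.[ zero ,_ , Sum.[ suc zero ,_ , suc (suc zero) ,_ ]′ ]′
        (cube-roots (trans x³≈u (sym s³≈u)))

    -- On a nonzero cube `cubicSum` is 3, which is not zero in `K`; where it vanishes there can be
    -- no cube root.
    count-noncubes : ∀ {u} → ¬ u ≈ 0# → cubicSum u K.≈ K.0# → ∑ (λ x → δ (x ^ 3) u) K.≈ K.fromℕ 0
    count-noncubes {u} u≉0 eq =
      count-solutions (_^ 3) u 0 (λ ()) (^-congˡ 3) (λ { {()} }) (λ ()) complete
      where
      complete : ∀ x → x ^ 3 ≈ u → ∃ λ (i : Fin 0) → x ≈ _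
      complete x x³≈u = contradiction
        (K.trans (K.sym (K.trans (cubicSum-cube 1# x≉0) cubicSum-1))
          (K.trans (cubicSum-cong (trans (*-identityʳ _) x³≈u)) eq))
        (KP.#⇒≉ (K.characteristic-zero 3))
        where
        x≉0 : ¬ x ≈ 0#
        x≉0 x≈0 = u≉0 (trans (sym x³≈u) (trans (*-congʳ x≈0) (zeroˡ _)))

    -- A nonzero u is y³γ^r with r < 3, and both sides depend on r only: they are 3 for r = 0 and 0
    -- for r = 1, 2.
    count-cube-roots : ∀ u → ∑ (λ x → δ (x ^ 3) u) K.≈ cubicSum u
    count-cube-roots u with u ≟ 0#
    ... | yes u≈0 = K.trans
      (count-solutions (_^ 3) u 1 (λ _ → 0#) (^-congˡ 3) (λ { {zero} {zero} _ → ≡.refl })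
        (λ _ → trans (zeroˡ _) (sym u≈0))
        (λ x x³≈u → zero , decidable-stable (x ≟ 0#) (λ x≉0 → ^-≉0 3 x≉0 (trans x³≈u u≈0))))
      (K.sym (cubicSum-0 u≈0))
    ... | no u≉0 with discrete-log u u≉0
    ... | i , γⁱ≈u = residue (i ℕ.% 3) (m%n<n i 3)
      (trans (^-congʳ γ (≡.trans (m≡m%n+[m/n]*n i 3) (ℕ.+-comm (i ℕ.% 3) _))) (^-homo-* γ (i ℕ./ 3 ℕ.* 3) (i ℕ.% 3)))
      where
      y = γ ^ (i ℕ./ 3)
      y≉0 : ¬ y ≈ 0#
      y≉0 = ^-≉0 (i ℕ./ 3) γ≉0

      twist : ∀ z → γ ^ i ≈ γ ^ (i ℕ./ 3 ℕ.* 3) * z → y ^ 3 * z ≈ u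
      twist z eq = trans (*-congʳ (^-assocʳ γ (i ℕ./ 3) 3)) (trans (sym eq) γⁱ≈u)

      noncube : ∀ z → y ^ 3 * z ≈ u → cubicSum z K.≈ K.0# → ∑ (λ x → δ (x ^ 3) u) K.≈ cubicSum u
      noncube z y³z≈u eq = K.trans (count-noncubes u≉0 cubicSum≈0) (K.sym cubicSum≈0)
        where
        cubicSum≈0 : cubicSum u K.≈ K.0#
        cubicSum≈0 = K.trans (cubicSum-cong (sym y³z≈u)) (K.trans (cubicSum-cube z y≉0) eq)

      residue : ∀ r → r ℕ.< 3 → γ ^ i ≈ γ ^ (i ℕ./ 3 ℕ.* 3) * γ ^ r →
                ∑ (λ x → δ (x ^ 3) u) K.≈ cubicSum u
      residue 0 _ eq = K.trans
        (count-cubes y≉0 (trans (sym (*-identityʳ _)) (twist 1# eq)))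
        (K.trans (K.sym cubicSum-1) (K.trans (K.sym (cubicSum-cube 1# y≉0)) (cubicSum-cong (twist 1# eq))))
      residue 1 _ eq = noncube γ (twist γ (trans eq (*-congˡ (*-identityʳ γ)))) cubicSum-γ
      residue 2 _ eq = noncube (γ * γ) (twist (γ * γ) (trans eq (*-congˡ (*-congˡ (*-identityʳ γ))))) cubicSum-γ²
      residue (suc (suc (suc r))) r<3 _ = contradiction r<3 (ℕ.m+n≮m 3 r)

    count-quadratic : ∀ a b c → ¬ a ≈ 0# →
      ∑ (λ x → δ (a * (x * x) + b * x + c) 0#) K.≈ K.1# K.+ φ (b * b - 4 · (a * c))
    count-quadratic a b c a≉0 = begin
      ∑ (λ x → δ (a * (x * x) + b * x + c) 0#)
        ≈⟨ ∑-cong (λ x → δ-⇔ (to x) (from x)) ⟩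
      ∑ (λ x → δ (σ x * σ x) D)
        ≈⟨ ∑-injective {f = λ y → δ (y * y) D} {σ} (λ eq → δ-cong (*-cong eq eq) refl) σ-injective ⟩
      ∑ (λ y → δ (y * y) D)
        ≈⟨ count-square-roots D ⟩
      K.1# K.+ φ D ∎
      where
      D = b * b - 4 · (a * c)

      σ : Carrier → Carrier
      σ x = 2 · a * x + b

      σ-injective : ∀ {x y} → σ x ≈ σ y → x ≈ y
      σ-injective {x} {y} eq = *-cancelˡ (*-≉0 2≉0 a≉0) (x-y≈0⇒x≈y _ _ (trans
        (solve 4 (λ a b x y → (2 :× 𝟙) :* a :* x :- (2 :× 𝟙) :* a :* y
          := ((2 :× a) :* x :+ b) :- ((2 :× a) :* y :+ b)) refl a b x y)
        (x≈y⇒x-y≈0 eq)))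

      complete-square : ∀ x → σ x * σ x - D ≈ (2 · 1# * (2 · 1# * a)) * (a * (x * x) + b * x + c)
      complete-square x = solve 4 (λ a b c x →
        ((2 :× a) :* x :+ b) :* ((2 :× a) :* x :+ b) :- (b :* b :- 4 :× (a :* c))
          := (2 :× 𝟙 :* (2 :× 𝟙 :* a)) :* (a :* (x :* x) :+ b :* x :+ c)) refl a b c x

      to : ∀ x → a * (x * x) + b * x + c ≈ 0# → σ x * σ x ≈ D
      to x eq = x-y≈0⇒x≈y _ _ (trans (complete-square x) (trans (*-congˡ eq) (zeroʳ _)))

      from : ∀ x → σ x * σ x ≈ D → a * (x * x) + b * x + c ≈ 0#
      from x eq = *-cancelˡ (*-≉0 2≉0 (*-≉0 2≉0 a≉0))
        (trans (sym (complete-square x)) (trans (x≈y⇒x-y≈0 eq) (sym (zeroʳ _))))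

-- Sums over the Dickson polynomial v³ - 3v

module DicksonSums
  (F : FiniteField c ℓ₁ ℓ₂) (K : AlgebraicallyClosedField₀ c′ ℓ₁′ ℓ₂′)
  (m : ℕ) (N≡6m : FiniteField.q F ℕ.∸ 1 ≡ 6 ℕ.* m)
  (A : Characters.Character F K)
  (Φ₆[Aγ]≈0 : IsSextic F K A)
  where
  open FiniteField F hiding (zero)
  open FiniteFieldProperties F
  open PrimitiveRoot F
  open Characters F K
  open CharacterProperties F K
  open CharacterSums F K
  open SexticCharacter F K m N≡6m A Φ₆[Aγ]≈0
  open SexticSums F K m N≡6m A Φ₆[Aγ]≈0
  open RootCounts F K m N≡6m A Φ₆[Aγ]≈0
  private
    module K = AlgebraicallyClosedField₀ K
    module KP = AlgebraicallyClosedFieldProperties K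
    module KR = CommutativeRing K.commutativeRing

  private
    -- The discriminant of s² - vs + 1: it is a square exactly if v = s + 1/s for some s in the
    -- field.
    D : Carrier → Carrier
    D v = v * v - 4 · 1#

    D-cong : ∀ {v w} → v ≈ w → D v ≈ D w
    D-cong eq = +-congʳ (*-cong eq eq)

    χ : Carrier → K.Carrier
    χ v = φ (D v)

    χ-cong : Congruent χ
    χ-cong eq = φ-cong (D-cong eq)

    ν : Carrier → K.Carrier
    ν x = ε ⟨ x ⟩

  module _ where
    open IntegerSolver commutativeRing

    private
      joukowski-quadratic : ∀ {s} v → ¬ s ≈ 0# → s * ((s + inv s) - v) ≈ 1# * (s * s) + - v * s + 1#
      joukowski-quadratic {s} v s≉0 = trans
        (solve 3 (λ s t v → s :* ((s :+ t) :- v) := 𝟙 :* (s :* s) :+ :- v :* s :+ s :* t) refl s (inv s) v)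
        (+-congˡ (inv-inverseʳ s≉0))

    joukowski-fibre : ∀ s v → ν s K.* δ (s + inv s) v K.≈ δ (1# * (s * s) + - v * s + 1#) 0#
    joukowski-fibre s v = by-cases (s ≟ 0#)
      where
      by-cases : Dec (s ≈ 0#) → ν s K.* δ (s + inv s) v K.≈ δ (1# * (s * s) + - v * s + 1#) 0#
      by-cases (yes s≈0) = K.trans (K.trans (K.*-congʳ (⟨⟩-zero ε s≈0)) (K.zeroˡ _))
        (K.sym (δ-0 (λ eq → 1≉0 (trans (sym (trans (+-congʳ (trans
          (+-cong (trans (*-congˡ (trans (*-congʳ s≈0) (zeroˡ s))) (zeroʳ 1#)) (trans (*-congˡ s≈0) (zeroʳ _)))
          (+-identityˡ 0#))) (+-identityˡ 1#))) eq))))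
      by-cases (no s≉0) = K.trans (K.trans (K.*-congʳ (ε-⟨⟩ s≉0)) (K.*-identityˡ _)) (δ-⇔
        (λ eq → trans (sym (joukowski-quadratic v s≉0)) (trans (*-congˡ (x≈y⇒x-y≈0 eq)) (zeroʳ s)))
        (λ eq → x-y≈0⇒x≈y _ _ (*-cancelˡ s≉0 (trans (joukowski-quadratic v s≉0) (trans eq (sym (zeroʳ s)))))))

  module _ where
    open SetoidReasoning K.setoid
    open IntegerSolver commutativeRing

    -- The fibre over v consists of the roots of s² - vs + 1, whose number is 1 + χ(v); zero is
    -- never among them, the constant term being 1.
    ∑-joukowski : ∀ {g} → Congruent g →
      ∑ (λ s → ν s K.* g (s + inv s)) K.≈ ∑ (λ v → (K.1# K.+ χ v) K.* g v)
    ∑-joukowski {g} g-cong = begin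
      ∑ (λ s → ν s K.* g (s + inv s))
        ≈⟨ ∑-fibres (λ s → s + inv s) ν g-cong ⟩
      ∑ (λ v → ∑ (λ s → ν s K.* δ (s + inv s) v) K.* g v)
        ≈⟨ ∑-cong (λ v → K.*-congʳ {g v} (begin
             ∑ (λ s → ν s K.* δ (s + inv s) v)                ≈⟨ ∑-cong (λ s → joukowski-fibre s v) ⟩
             ∑ (λ s → δ (1# * (s * s) + - v * s + 1#) 0#)     ≈⟨ count-quadratic 1# (- v) 1# 1≉0 ⟩
             K.1# K.+ φ (- v * - v - 4 · (1# * 1#))
               ≈⟨ K.+-congˡ (φ-cong (solve 1 (λ v → :- v :* :- v :- 4 :× (𝟙 :* 𝟙) := v :* v :- 4 :× 𝟙) refl v)) ⟩
             K.1# K.+ χ v ∎)) ⟩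
      ∑ (λ v → (K.1# K.+ χ v) K.* g v) ∎

  module _ where
    open IntegerSolver commutativeRing

    -- A Dickson polynomial.
    P : Carrier → Carrier
    P v = v ^ 3 - 3 · v

    P-cong : ∀ {v w} → v ≈ w → P v ≈ P w
    P-cong eq = +-cong (^-congˡ 3 eq) (-‿cong (+-cong eq (+-cong eq (+-cong eq refl))))

    P-joukowski : ∀ {s} → ¬ s ≈ 0# → P (s + inv s) ≈ s ^ 3 + inv (s ^ 3)
    P-joukowski {s} s≉0 = trans
      (solve 2 (λ s t → (s :+ t) :^ 3 :- 3 :× (s :+ t)
        := (s :^ 3 :+ t :^ 3) :+ (s :* t :- 𝟙) :* (3 :× (s :+ t))) refl s (inv s))
      (trans (+-congˡ (trans (*-congʳ (x≈y⇒x-y≈0 (inv-inverseʳ s≉0))) (zeroˡ _)))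
      (trans (+-identityʳ _) (+-congˡ (inv-unique
        (trans (sym (^-distrib-* s (inv s) 3)) (trans (^-congˡ 3 (inv-inverseʳ s≉0)) (1^n≈1 3)))))))

    -- For v = s + 1/s one has D(v) = (s - 1/s)² and D(P(v)) = (s³ - 1/s³)², with quotient (s² + 1 +
    -- 1/s²)² = (v² - 1)².
    D-P : ∀ v → D (P v) ≈ D v * ((v * v - 1#) * (v * v - 1#))
    D-P = solve 1 (λ v → (v :^ 3 :- 3 :× v) :* (v :^ 3 :- 3 :× v) :- 4 :× 𝟙
      := (v :* v :- 4 :× 𝟙) :* ((v :* v :- 𝟙) :* (v :* v :- 𝟙))) refl

    IsSquare : Carrier → Set (c ⊔ ℓ₁)
    IsSquare x = ∃ λ y → y * y ≈ x

    square-cancel : ∀ {x z} → ¬ z ≈ 0# → IsSquare (x * (z * z)) → IsSquare x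
    square-cancel {x} {z} z≉0 (y , y²≈xz²) = y * inv z , trans
      (solve 2 (λ y t → (y :* t) :* (y :* t) := (y :* y) :* (t :* t)) refl y (inv z))
      (trans (*-congʳ y²≈xz²) (trans
        (solve 3 (λ x z t → (x :* (z :* z)) :* (t :* t) := x :* ((z :* t) :* (z :* t))) refl x z (inv z))
        (trans (*-congˡ (trans (*-cong (inv-inverseʳ z≉0) (inv-inverseʳ z≉0)) (*-identityˡ 1#))) (*-identityʳ x))))

    √-3 : Carrier
    √-3 = ω + ω + 1#

    √-3-square : √-3 * √-3 ≈ - (3 · 1#)
    √-3-square = trans
      (solve 1 (λ w → (w :+ w :+ 𝟙) :* (w :+ w :+ 𝟙) := :- (3 :× 𝟙) :+ (w :* w :+ w :+ 𝟙) :* (4 :× 𝟙)) refl ω)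
      (trans (+-congˡ (trans (*-congʳ ω-relation) (zeroˡ _))) (+-identityʳ _))

    √-3≉0 : ¬ √-3 ≈ 0#
    √-3≉0 eq = 3≉0 (trans (solve 1 (λ x → x := :- :- x) refl (3 · 1#))
      (trans (-‿cong (trans (sym √-3-square) (trans (*-congʳ eq) (zeroˡ _))))
        (solve 0 (:- con (+ 0) := con (+ 0)) refl)))

    -- By `D-P` the two values differ by the square of v² - 1, which is nonzero: v² = 1 would give
    -- D(v) = -3, a square.
    D-P-nonsquare : ∀ {v} → ¬ IsSquare (D v) → ¬ IsSquare (D (P v))
    D-P-nonsquare {v} ¬s (y , y²≈) = ¬s (square-cancel v²≉1 (y , trans y²≈ (D-P v)))
      where
      v²≉1 : ¬ v * v - 1# ≈ 0#
      v²≉1 eq = ¬s (√-3 , trans √-3-square (sym (trans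
        (solve 1 (λ v → v :* v :- 4 :× 𝟙 := :- (3 :× 𝟙) :+ (v :* v :- 𝟙)) refl v)
        (trans (+-congˡ eq) (+-identityʳ _)))))

    -- If v ≠ w, then P(v) = P(w) means v² + vw + w² = 3. As a quadratic in w this has discriminant
    -- -3D(v), and -3 is a square.
    P-injective-nonsquare : ∀ {v w} → ¬ IsSquare (D v) → P v ≈ P w → v ≈ w
    P-injective-nonsquare {v} {w} ¬s eq =
      Sum.[ x-y≈0⇒x≈y _ _ , (λ conic → contradiction (D-square conic) ¬s) ]′ (zero-product (trans
        (solve 2 (λ v w → (v :- w) :* (v :* v :+ v :* w :+ w :* w :- 3 :× 𝟙)
          := (v :^ 3 :- 3 :× v) :- (w :^ 3 :- 3 :× w)) refl v w)
        (x≈y⇒x-y≈0 eq)))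
      where
      D-square : v * v + v * w + w * w - 3 · 1# ≈ 0# → IsSquare (D v)
      D-square conic = square-cancel √-3≉0 (w + w + v , trans
        (solve 2 (λ v w → (w :+ w :+ v) :* (w :+ w :+ v)
          := (v :* v :- 4 :× 𝟙) :* (:- (3 :× 𝟙)) :+ (v :* v :+ v :* w :+ w :* w :- 3 :× 𝟙) :* (4 :× 𝟙)) refl v w)
        (trans (+-congˡ (trans (*-congʳ conic) (zeroˡ _))) (trans (+-identityʳ _) (*-congˡ (sym √-3-square)))))

    P-fixed : ∀ {v} → D v ≈ 0# → P v ≈ v
    P-fixed {v} Dv≈0 = trans
      (solve 1 (λ v → v :^ 3 :- 3 :× v := v :+ (v :* v :- 4 :× 𝟙) :* v) refl v)
      (trans (+-congˡ (trans (*-congʳ Dv≈0) (zeroˡ _))) (+-identityʳ v))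

  private
    -- Extending `P` by the identity gives an injection of the whole field, as `∑-injective`
    -- requires. The images of the two pieces do not meet because `P` keeps `D v` a nonsquare.
    σ : Carrier → Carrier
    σ v with isSquare? (D v)
    ... | yes _ = v
    ... | no _  = P v

    σ-cases : ∀ v → (IsSquare (D v) × σ v ≡ v) ⊎ (¬ IsSquare (D v) × σ v ≡ P v)
    σ-cases v with isSquare? (D v)
    ... | yes s = inj₁ (s , ≡.refl)
    ... | no ¬s = inj₂ (¬s , ≡.refl)

    σ-injective : ∀ {v w} → σ v ≈ σ w → v ≈ w
    σ-injective {v} {w} eq with isSquare? (D v) | isSquare? (D w)
    ... | yes _ | yes _  = eq
    ... | no ¬s | no _   = P-injective-nonsquare ¬s eq
    ... | no ¬s | yes (y , y²≈) = contradiction (y , trans y²≈ (D-cong (sym eq))) (D-P-nonsquare ¬s)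
    ... | yes (y , y²≈) | no ¬s = contradiction (y , trans y²≈ (D-cong eq)) (D-P-nonsquare ¬s)

    weight : (Carrier → K.Carrier) → Carrier → K.Carrier
    weight g v = (K.1# K.- χ v) K.* g v

    -- If `D v` is a nonzero square the weight is 0. If `D v` is zero, so that v = ±2, the weight is
    -- 1, but `P` fixes v.
    square-weight : ∀ {g} → Congruent g → ∀ v → IsSquare (D v) →
      (K.1# K.- χ v) K.* g (P v) K.≈ weight g v
    square-weight {g} g-cong v (y , y²≈) = by-cases (D v ≟ 0#)
      where
      by-cases : Dec (D v ≈ 0#) → (K.1# K.- χ v) K.* g (P v) K.≈ weight g v
      by-cases (yes Dv≈0) = K.*-congˡ (g-cong (P-fixed Dv≈0))
      by-cases (no Dv≉0) = K.trans (vanish (g (P v))) (K.sym (vanish (g v)))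
        where
        vanish : ∀ k → (K.1# K.- χ v) K.* k K.≈ K.0#
        vanish k = K.trans (K.*-congʳ (K.trans (K.+-congˡ (K.-‿cong (φ-square Dv≉0 y²≈))) (K.-‿inverseʳ K.1#))) (K.zeroˡ k)

    σ-weight : ∀ {g} → Congruent g → ∀ v → (K.1# K.- χ v) K.* g (P v) K.≈ weight g (σ v)
    σ-weight {g} g-cong v = Sum.[
      (λ (s , σv≡v) → K.trans (square-weight g-cong v s) (K.reflexive (≡.cong (weight g) (≡.sym σv≡v)))) ,
      (λ (¬s , σv≡Pv) → K.trans
        (K.*-congʳ (K.+-congˡ (K.-‿cong (K.trans (φ-nonsquare ¬s) (K.sym (φ-nonsquare (D-P-nonsquare ¬s)))))))
        (K.reflexive (≡.cong (weight g) (≡.sym σv≡Pv)))) ]′ (σ-cases v)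

  module _ {g : Carrier → K.Carrier} (g-cong : Congruent g) where
    open SetoidReasoning K.setoid

    private
      G : Carrier → K.Carrier
      G r = ν r K.* g (r + inv r)

      joukowski-cong : ∀ {r s} → r ≈ s → r + inv r ≈ s + inv s
      joukowski-cong eq = +-cong eq (inv-cong eq)

      G-cong : Congruent G
      G-cong eq = K.*-cong (⟨⟩-cong ε eq) (g-cong (joukowski-cong eq))

      E plus minus : K.Carrier
      E = ∑ (λ r → η r K.* g (r + inv r))
      plus = ∑ (λ v → (K.1# K.+ χ v) K.* g v)
      minus = ∑ (λ v → (K.1# K.- χ v) K.* g v)

      ∑-nonsquare : ∑ (λ v → (K.1# K.- χ v) K.* g (P v)) K.≈ minus
      ∑-nonsquare = K.trans (∑-cong (σ-weight g-cong))
        (∑-injective {f = weight g} {σ}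
          (λ eq → K.*-cong (K.+-congˡ (K.-‿cong (χ-cong eq))) (g-cong eq)) σ-injective)

      G-cube : ∀ s → ν s K.* g (P (s + inv s)) K.≈ G (s ^ 3)
      G-cube s = by-cases (s ≟ 0#)
        where
        by-cases : Dec (s ≈ 0#) → ν s K.* g (P (s + inv s)) K.≈ G (s ^ 3)
        by-cases (yes s≈0) = K.trans (K.trans (K.*-congʳ (⟨⟩-zero ε s≈0)) (K.zeroˡ _))
          (K.sym (K.trans (K.*-congʳ (⟨⟩-zero ε (trans (*-congʳ s≈0) (zeroˡ _)))) (K.zeroˡ _)))
        by-cases (no s≉0) = K.*-cong (K.trans (ε-⟨⟩ s≉0) (K.sym (ε-⟨⟩ (^-≉0 3 s≉0))))
          (g-cong (P-joukowski s≉0))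

      weight-G : ∀ {w : Carrier → K.Carrier} r → (r ≈ 0# → w r K.≈ K.0#) → w r K.* G r K.≈ w r K.* g (r + inv r)
      weight-G {w} r w-zero = by-cases (r ≟ 0#)
        where
        by-cases : Dec (r ≈ 0#) → w r K.* G r K.≈ w r K.* g (r + inv r)
        by-cases (yes r≈0) = K.trans (K.trans (K.*-congʳ (w-zero r≈0)) (K.zeroˡ _))
          (K.sym (K.trans (K.*-congʳ (w-zero r≈0)) (K.zeroˡ _)))
        by-cases (no r≉0) = K.*-congˡ (K.trans (K.*-congʳ (ε-⟨⟩ r≉0)) (K.*-identityˡ _))

      ∑-η : ∑ (λ r → η r K.* G r) K.≈ E
      ∑-η = ∑-cong (λ r → weight-G {η} r (λ r≈0 → K.trans (KP.^-congˡ 2 (⟨⟩-zero A r≈0)) (K.zeroˡ _)))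

      -- The substitution r ↦ 1/r fixes r + 1/r and exchanges the two cubic characters.
      ∑-η̄ : ∑ (λ r → η̄ r K.* G r) K.≈ E
      ∑-η̄ = begin
        ∑ (λ r → η̄ r K.* G r)
          ≈⟨ ∑-cong (λ r → weight-G {η̄} r (λ r≈0 → K.trans (KP.^-congˡ 4 (⟨⟩-zero A r≈0)) (K.zeroˡ _))) ⟩
        ∑ (λ r → η̄ r K.* g (r + inv r))
          ≈⟨ ∑-cong (λ r → K.*-cong (K.sym (η-inv r))
               (g-cong (trans (+-comm r (inv r)) (+-congˡ (sym (inv-involutive r)))))) ⟩
        ∑ (λ r → η (inv r) K.* g (inv r + inv (inv r)))
          ≈⟨ ∑-injective {f = λ r → η r K.* g (r + inv r)} {inv}
               (λ eq → K.*-cong (η-cong eq) (g-cong (joukowski-cong eq)))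
               (λ {x} {y} eq → trans (sym (inv-involutive x)) (trans (inv-cong eq) (inv-involutive y))) ⟩
        E ∎

      ∑-square : ∑ (λ v → (K.1# K.+ χ v) K.* g (P v)) K.≈ plus K.+ E K.+ E
      ∑-square = begin
        ∑ (λ v → (K.1# K.+ χ v) K.* g (P v))
          ≈⟨ ∑-joukowski {λ v → g (P v)} (λ eq → g-cong (P-cong eq)) ⟨
        ∑ (λ s → ν s K.* g (P (s + inv s)))
          ≈⟨ ∑-cong G-cube ⟩
        ∑ (λ s → G (s ^ 3))
          ≈⟨ ∑-fibres₁ (_^ 3) G-cong ⟩
        ∑ (λ r → ∑ (λ s → δ (s ^ 3) r) K.* G r)
          ≈⟨ ∑-cong (λ r → K.*-congʳ {G r} (count-cube-roots r)) ⟩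
        ∑ (λ r → cubicSum r K.* G r)
          ≈⟨ ∑-cong (λ r → K.trans (KR.distribʳ (G r) (K.1# K.+ η r) (η̄ r))
               (K.+-congʳ (K.trans (KR.distribʳ (G r) K.1# (η r)) (K.+-congʳ (K.*-identityˡ (G r)))))) ⟩
        ∑ (λ r → G r K.+ η r K.* G r K.+ η̄ r K.* G r)
          ≈⟨ K.trans (∑-+ (λ r → G r K.+ η r K.* G r) (λ r → η̄ r K.* G r)) (K.+-congʳ (∑-+ G (λ r → η r K.* G r))) ⟩
        ∑ G K.+ ∑ (λ r → η r K.* G r) K.+ ∑ (λ r → η̄ r K.* G r)
          ≈⟨ K.+-cong (K.+-cong (∑-joukowski g-cong) ∑-η) ∑-η̄ ⟩
        plus K.+ E K.+ E ∎

      split-weight : ∀ f → ∑ (λ v → (K.1# K.+ χ v) K.* f v) K.+ ∑ (λ v → (K.1# K.- χ v) K.* f v) K.≈ ∑ f K.+ ∑ f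
      split-weight f = begin
        ∑ (λ v → (K.1# K.+ χ v) K.* f v) K.+ ∑ (λ v → (K.1# K.- χ v) K.* f v)
          ≈⟨ ∑-+ (λ v → (K.1# K.+ χ v) K.* f v) (λ v → (K.1# K.- χ v) K.* f v) ⟨
        ∑ (λ v → (K.1# K.+ χ v) K.* f v K.+ (K.1# K.- χ v) K.* f v)
          ≈⟨ ∑-cong (λ v → two-halves (χ v) (f v)) ⟩
        ∑ (λ v → f v K.+ f v)
          ≈⟨ ∑-+ f f ⟩
        ∑ f K.+ ∑ f ∎
        where
        open IntegerSolver K.commutativeRing
        two-halves : ∀ a b → (K.1# K.+ a) K.* b K.+ (K.1# K.- a) K.* b K.≈ b K.+ b
        two-halves = solve 2 (λ a b → (𝟙 :+ a) :* b :+ (𝟙 :- a) :* b := b :+ b) K.refl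

    -- For v = s + s⁻¹ the substitution r = s³ turns P v into r + r⁻¹, and v ↦ P v
    -- permutes the remaining v, those with v² − 4 a nonsquare.
    ∑-dickson : ∑ (λ v → g (P v)) K.≈ ∑ g K.+ ∑ (λ r → η r K.* g (r + inv r))
    ∑-dickson = KP.halve (begin
      ∑ (λ v → g (P v)) K.+ ∑ (λ v → g (P v))     ≈⟨ split-weight (λ v → g (P v)) ⟨
      ∑ (λ v → (K.1# K.+ χ v) K.* g (P v)) K.+ ∑ (λ v → (K.1# K.- χ v) K.* g (P v))
                                                  ≈⟨ K.+-cong ∑-square ∑-nonsquare ⟩
      plus K.+ E K.+ E K.+ minus                  ≈⟨ rearrange plus minus E ⟩
      plus K.+ minus K.+ (E K.+ E)                ≈⟨ K.+-congʳ (split-weight g) ⟩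
      ∑ g K.+ ∑ g K.+ (E K.+ E)                   ≈⟨ rearrange′ (∑ g) E ⟩
      (∑ g K.+ E) K.+ (∑ g K.+ E)                 ∎)
      where
      open IntegerSolver K.commutativeRing
      rearrange : ∀ p m e → p K.+ e K.+ e K.+ m K.≈ p K.+ m K.+ (e K.+ e)
      rearrange = solve 3 (λ p m e → p :+ e :+ e :+ m := p :+ m :+ (e :+ e)) K.refl
      rearrange′ : ∀ y e → y K.+ y K.+ (e K.+ e) K.≈ (y K.+ e) K.+ (y K.+ e)
      rearrange′ = solve 2 (λ y e → y :+ y :+ (e :+ e) := (y :+ e) :+ (y :+ e)) K.refl

-- From the sum over a cubic to Greene's series

module EllipticSums
  (F : FiniteField c ℓ₁ ℓ₂) (K : AlgebraicallyClosedField₀ c′ ℓ₁′ ℓ₂′)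
  (m : ℕ) (N≡6m : FiniteField.q F ℕ.∸ 1 ≡ 6 ℕ.* m)
  (A : Characters.Character F K)
  (Φ₆[Aγ]≈0 : IsSextic F K A)
  where
  open FiniteField F hiding (zero)
  open FiniteFieldProperties F
  open PrimitiveRoot F
  open Characters F K
  open CharacterProperties F K
  open CharacterSums F K
  open SexticCharacter F K m N≡6m A Φ₆[Aγ]≈0
  open SexticSums F K m N≡6m A Φ₆[Aγ]≈0
  open RootCounts F K m N≡6m A Φ₆[Aγ]≈0
  open DicksonSums F K m N≡6m A Φ₆[Aγ]≈0
  private
    module K = AlgebraicallyClosedField₀ K
    module KP = AlgebraicallyClosedFieldProperties K
    module KR = CommutativeRing K.commutativeRing
    module KS = IntegerSolver K.commutativeRing
    module KRing = RingProperties KR.ring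
  open KP using () renaming (_^_ to _^K_)

  -- This is ηφ = A²A³, and also the inverse of `A`; the sum coming from the cubic and Greene's sum
  -- meet in it.
  B : Carrier → K.Carrier
  B x = A ⟨ x ⟩ ^K 5

  B-zero : ∀ {x} → x ≈ 0# → B x K.≈ K.0#
  B-zero x≈0 = K.trans (K.*-congʳ (⟨⟩-zero A x≈0)) (K.zeroˡ _)

  B-cong : Congruent B
  B-cong eq = KP.^-congˡ 5 (⟨⟩-cong A eq)

  B-* : ∀ x y → B (x * y) K.≈ B x K.* B y
  B-* x y = K.trans (KP.^-congˡ 5 (⟨⟩-* A x y)) (KP.^-distrib-* _ _ 5)

  η*φ : ∀ x → η x K.* φ x K.≈ B x
  η*φ x = K.trans (K.*-congˡ (φ≈A³ x)) (K.sym (KP.^-homo-* (A ⟨ x ⟩) 2 3))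

  module _ where
    open SetoidReasoning K.setoid

    B[-1]≈φ[-1] : B (- 1#) K.≈ φ (- 1#)
    B[-1]≈φ[-1] = begin
      B (- 1#)                       ≈⟨ η*φ (- 1#) ⟨
      η (- 1#) K.* φ (- 1#)          ≈⟨ K.*-congʳ (⟨⟩-^ A (- 1#) 2) ⟨
      A ⟨ (- 1#) ^ 2 ⟩ K.* φ (- 1#)  ≈⟨ K.*-congʳ (K.trans (⟨⟩-cong A (solve 0 ((:- 𝟙) :^ 2 := 𝟙) refl)) (⟨⟩-one A)) ⟩
      K.1# K.* φ (- 1#)              ≈⟨ K.*-identityˡ _ ⟩
      φ (- 1#)                       ∎
      where open IntegerSolver commutativeRing

    ∑φ≈0 : ∑ φ K.≈ K.0#
    ∑φ≈0 = KP.x≈-x⇒x≈0 (begin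
      ∑ φ                         ≈⟨ ∑-injective {f = φ} {γ *_} φ-cong (*-cancelˡ γ≉0) ⟨
      ∑ (λ x → φ (γ * x))         ≈⟨ ∑-cong (λ x → φ-* γ x) ⟩
      ∑ (λ x → φ γ K.* φ x)       ≈⟨ ∑-*ˡ (φ γ) φ ⟩
      φ γ K.* ∑ φ                 ≈⟨ K.*-congʳ (K.trans (φ≈A³ γ) (KP.Φ₆-cube Φ₆[Aγ]≈0)) ⟩
      K.- K.1# K.* ∑ φ            ≈⟨ KRing.-1*x≈-x (∑ φ) ⟩
      K.- ∑ φ                     ∎)

    -- Scaling by γ gives βS = S for the sum S. Since β(1 - β) = 1, this yields S = β(S - βS) = 0
    -- without deciding any equality in `K`.
    ∑B≈0 : ∑ B K.≈ K.0#
    ∑B≈0 = begin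
      S                              ≈⟨ K.*-identityˡ S ⟨
      K.1# K.* S                     ≈⟨ K.*-congʳ (KP.Φ₆-1-x Φ₆[Aγ]≈0) ⟨
      β K.* (K.1# K.- β) K.* S       ≈⟨ expand β S ⟩
      β K.* (S K.- β K.* S)          ≈⟨ K.*-congˡ (K.+-congˡ (K.-‿cong βS≈S)) ⟩
      β K.* (S K.- S)                ≈⟨ K.trans (K.*-congˡ (K.-‿inverseʳ S)) (K.zeroʳ β) ⟩
      K.0#                           ∎
      where
      open IntegerSolver K.commutativeRing
      β = A ⟨ γ ⟩
      S = ∑ B

      expand : ∀ b s → b K.* (K.1# K.- b) K.* s K.≈ b K.* (s K.- b K.* s)
      expand = solve 2 (λ b s → b :* (𝟙 :- b) :* s := b :* (s :- b :* s)) K.refl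

      βS≈S : β K.* S K.≈ S
      βS≈S = begin
        β K.* S                       ≈⟨ K.*-congˡ (∑-injective {f = B} {γ *_} B-cong (*-cancelˡ γ≉0)) ⟨
        β K.* ∑ (λ x → B (γ * x))     ≈⟨ K.*-congˡ (∑-cong (λ x → B-* γ x)) ⟩
        β K.* ∑ (λ x → B γ K.* B x)   ≈⟨ K.*-congˡ (∑-*ˡ (B γ) B) ⟩
        β K.* (B γ K.* S)             ≈⟨ K.*-assoc β (B γ) S ⟨
        β K.* B γ K.* S               ≈⟨ K.*-congʳ (KP.Φ₆-sixth Φ₆[Aγ]≈0) ⟩
        K.1# K.* S                    ≈⟨ K.*-identityˡ S ⟩
        S                             ∎

    ∑-elliptic : ∀ k → ∑ (λ v → φ (P v + k)) K.≈ ∑ (λ r → B r K.* φ (r * r + k * r + 1#))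
    ∑-elliptic k = begin
      ∑ (λ v → φ (P v + k))
        ≈⟨ ∑-dickson {λ c → φ (c + k)} (λ eq → φ-cong (+-congʳ eq)) ⟩
      ∑ (λ c → φ (c + k)) K.+ ∑ (λ r → η r K.* φ (r + inv r + k))
        -- The first sum is a translate of `∑ φ` and vanishes. In the second, φ(r)² = 1 is inserted
        -- to clear the denominator of r + 1/r + k.
        ≈⟨ K.+-cong (K.trans (∑-injective {f = φ} {_+ k} φ-cong (+-cancelʳ k _ _)) ∑φ≈0) (∑-cong (λ r → term r (r ≟ 0#))) ⟩
      K.0# K.+ ∑ (λ r → B r K.* φ (r * r + k * r + 1#))
        ≈⟨ K.+-identityˡ _ ⟩
      ∑ (λ r → B r K.* φ (r * r + k * r + 1#)) ∎
      where
      open IntegerSolver commutativeRing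
      open RingProperties ring using (+-cancelʳ)

      quadratic : ∀ {r} → ¬ r ≈ 0# → r * (r + inv r + k) ≈ r * r + k * r + 1#
      quadratic {r} r≉0 = trans
        (solve 3 (λ r t k → r :* (r :+ t :+ k) := r :* r :+ k :* r :+ r :* t) refl r (inv r) k)
        (+-congˡ (inv-inverseʳ r≉0))

      term : ∀ r → Dec (r ≈ 0#) → η r K.* φ (r + inv r + k) K.≈ B r K.* φ (r * r + k * r + 1#)
      term r (yes r≈0) = K.trans
        (K.trans (K.*-congʳ (K.trans (K.*-congʳ (⟨⟩-zero A r≈0)) (K.zeroˡ _))) (K.zeroˡ _))
        (K.sym (K.trans (K.*-congʳ (B-zero r≈0)) (K.zeroˡ _)))
      term r (no r≉0) = begin
        η r K.* φ (r + inv r + k)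
          ≈⟨ K.*-congˡ (K.*-identityˡ (φ (r + inv r + k))) ⟨
        η r K.* (K.1# K.* φ (r + inv r + k))
          ≈⟨ K.*-congˡ (K.*-congʳ (φ-*-square r≉0)) ⟨
        η r K.* (φ r K.* φ r K.* φ (r + inv r + k))
          ≈⟨ K.*-congˡ (K.*-assoc (φ r) (φ r) (φ (r + inv r + k))) ⟩
        η r K.* (φ r K.* (φ r K.* φ (r + inv r + k)))
          ≈⟨ K.*-assoc (η r) (φ r) (φ r K.* φ (r + inv r + k)) ⟨
        η r K.* φ r K.* (φ r K.* φ (r + inv r + k))
          ≈⟨ K.*-cong (η*φ r) (K.trans (K.sym (φ-* r (r + inv r + k))) (φ-cong (quadratic r≉0))) ⟩
        B r K.* φ (r * r + k * r + 1#) ∎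

  module _ where
    open SetoidReasoning K.setoid

    conj-⟨inv⟩ : ∀ χ z → conj χ ⟨ z ⟩ K.≈ χ ⟨ inv z ⟩
    conj-⟨inv⟩ χ z = by-cases (z ≟ 0#)
      where
      by-cases : Dec (z ≈ 0#) → conj χ ⟨ z ⟩ K.≈ χ ⟨ inv z ⟩
      by-cases (yes z≈0) = K.trans (⟨⟩-zero (conj χ) z≈0) (K.sym (⟨⟩-zero χ (inv-zero z≈0)))
      by-cases (no z≉0) = KP.cancel-invertible
        (conj χ ⟨ z ⟩ , K.trans (K.*-comm _ _) (conj-⟨⟩ χ z≉0) , conj-⟨⟩ χ z≉0)
        (K.trans (conj-⟨⟩ χ z≉0) (K.sym (K.trans (K.sym (⟨⟩-* χ z (inv z)))
          (K.trans (⟨⟩-cong χ (inv-inverseʳ z≉0)) (⟨⟩-one χ)))))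

    ·χ-ε : ∀ χ z → (χ ·χ ε) ⟨ z ⟩ K.≈ χ ⟨ z ⟩
    ·χ-ε χ z = by-cases (z ≟ 0#)
      where
      by-cases : Dec (z ≈ 0#) → (χ ·χ ε) ⟨ z ⟩ K.≈ χ ⟨ z ⟩
      by-cases (yes z≈0) = K.trans (⟨⟩-zero (χ ·χ ε) z≈0) (K.sym (⟨⟩-zero χ z≈0))
      by-cases (no z≉0) = K.trans (·χ-⟨⟩ χ ε z) (K.trans (K.*-congˡ (ε-⟨⟩ z≉0)) (K.*-identityʳ _))

    conj-A : ∀ z → conj A ⟨ z ⟩ K.≈ B z
    conj-A z = by-cases (z ≟ 0#)
      where
      by-cases : Dec (z ≈ 0#) → conj A ⟨ z ⟩ K.≈ B z
      by-cases (yes z≈0) = K.trans (⟨⟩-zero (conj A) z≈0) (K.sym (B-zero z≈0))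
      by-cases (no z≉0) = KP.cancel-invertible
        (conj A ⟨ z ⟩ , K.trans (K.*-comm _ _) (conj-⟨⟩ A z≉0) , conj-⟨⟩ A z≉0)
        (K.trans (conj-⟨⟩ A z≉0) (K.sym (A-sixth z≉0)))

  -- `A⁵` stands for T^(5(q-1)/6), known through its values on nonzero elements.
  module _ (A⁵ : Character) (A⁵≈B : ∀ {x} → ¬ x ≈ 0# → A⁵ ⟨ x ⟩ K.≈ B x) where
    open SetoidReasoning K.setoid

    private
      A⁵-B : ∀ z → A⁵ ⟨ z ⟩ K.≈ B z
      A⁵-B z = by-cases (z ≟ 0#)
        where
        by-cases : Dec (z ≈ 0#) → A⁵ ⟨ z ⟩ K.≈ B z
        by-cases (yes z≈0) = K.trans (⟨⟩-zero A⁵ z≈0) (K.sym (B-zero z≈0))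
        by-cases (no z≉0) = A⁵≈B z≉0

    module _ (x : Carrier) (x≉0 : ¬ x ≈ 0#) (x≉1 : ¬ x ≈ 1#) where
      open IntegerSolver commutativeRing

      private
        R : Carrier → Carrier
        R y = y * inv (1# - y) * (1# - x * y)

        -- The second parameter is inverse to the first and the third is trivial, so the three
        -- factors are values of one character and merge into its value at y(1 - xy)/(1 - y).
        greene-term : ∀ y →
          A⁵ ⟨ y ⟩ K.* (conj A⁵ ·χ ε) ⟨ 1# - y ⟩ K.* conj A ⟨ 1# - x * y ⟩ K.≈ B (R y)
        greene-term y = begin
          A⁵ ⟨ y ⟩ K.* (conj A⁵ ·χ ε) ⟨ 1# - y ⟩ K.* conj A ⟨ 1# - x * y ⟩
            ≈⟨ K.*-cong (K.*-cong (A⁵-B y) (K.trans (·χ-ε (conj A⁵) (1# - y))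
                 (K.trans (conj-⟨inv⟩ A⁵ (1# - y)) (A⁵-B (inv (1# - y)))))) (conj-A (1# - x * y)) ⟩
          B y K.* B (inv (1# - y)) K.* B (1# - x * y)
            ≈⟨ K.*-congʳ (B-* y (inv (1# - y))) ⟨
          B (y * inv (1# - y)) K.* B (1# - x * y)
            ≈⟨ B-* (y * inv (1# - y)) (1# - x * y) ⟨
          B (R y) ∎

        R-quadratic : ∀ r {y} → ¬ 1# - y ≈ 0# →
          x * (y * y) + - (1# + r) * y + r ≈ (1# - y) * (r - R y)
        R-quadratic r {y} 1-y≉0 = sym (trans
          (solve 4 (λ x r y t → (𝟙 :- y) :* (r :- y :* t :* (𝟙 :- x :* y))
            := (x :* (y :* y) :+ :- (𝟙 :+ r) :* y :+ r) :+ ((𝟙 :- y) :* t :- 𝟙) :* (y :* (x :* y :- 𝟙))) refl x r y (inv (1# - y)))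
          (trans (+-congˡ (trans (*-congʳ (x≈y⇒x-y≈0 (inv-inverseʳ 1-y≉0))) (zeroˡ _))) (+-identityʳ _)))

        -- At y = 1 the convention 1/0 = 0 makes `R y` zero, so y = 1 is not in the fibre over r ≠
        -- 0. The quadratic takes the value x - 1 there, and x ≠ 1 keeps y = 1 from being a root.
        R-fibre : ∀ {r} → ¬ r ≈ 0# → ∀ y → δ (R y) r K.≈ δ (x * (y * y) + - (1# + r) * y + r) 0#
        R-fibre {r} r≉0 y = by-cases (1# - y ≟ 0#)
          where
          by-cases : Dec (1# - y ≈ 0#) → δ (R y) r K.≈ δ (x * (y * y) + - (1# + r) * y + r) 0#
          by-cases (no 1-y≉0) = δ-⇔
            (λ eq → trans (R-quadratic r 1-y≉0) (trans (*-congˡ (x≈y⇒x-y≈0 (sym eq))) (zeroʳ _)))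
            (λ eq → sym (x-y≈0⇒x≈y _ _ (*-cancelˡ 1-y≉0
              (trans (sym (R-quadratic r 1-y≉0)) (trans eq (sym (zeroʳ _)))))))
          by-cases (yes 1-y≈0) = K.trans
            (δ-0 (λ eq → r≉0 (trans (sym eq) (trans (*-congʳ (trans (*-congˡ (inv-zero 1-y≈0)) (zeroʳ y))) (zeroˡ _)))))
            (K.sym (δ-0 (λ eq → x≉1 (x-y≈0⇒x≈y _ _ (trans
              (solve 3 (λ x r y → x :- 𝟙 := (x :* (y :* y) :+ :- (𝟙 :+ r) :* y :+ r) :+ (𝟙 :- y) :* (x :* (𝟙 :+ y) :- 𝟙 :- r)) refl x r y)
              (trans (+-cong eq (trans (*-congʳ 1-y≈0) (zeroˡ _))) (+-identityˡ 0#)))))))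

        k : Carrier
        k = 2 · 1# - 4 · x

        -- The factor `B r` removes r = 0, where the fibre is {0, 1, 1/x} and the discriminant
        -- formula would count only two points.
        R-count : ∀ r → ∑ (λ y → δ (R y) r) K.* B r K.≈ B r K.+ B r K.* φ (r * r + k * r + 1#)
        R-count r = by-cases (r ≟ 0#)
          where
          by-cases : Dec (r ≈ 0#) → ∑ (λ y → δ (R y) r) K.* B r K.≈ B r K.+ B r K.* φ (r * r + k * r + 1#)
          by-cases (yes r≈0) = K.trans (K.trans (K.*-congˡ (B-zero r≈0)) (K.zeroʳ _))
            (K.sym (K.trans (K.+-cong (B-zero r≈0) (K.trans (K.*-congʳ (B-zero r≈0)) (K.zeroˡ _))) (K.+-identityˡ K.0#)))
          by-cases (no r≉0) = begin
            ∑ (λ y → δ (R y) r) K.* B r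
              ≈⟨ K.*-congʳ (∑-cong (R-fibre r≉0)) ⟩
            ∑ (λ y → δ (x * (y * y) + - (1# + r) * y + r) 0#) K.* B r
              ≈⟨ K.*-congʳ (count-quadratic x (- (1# + r)) r x≉0) ⟩
            (K.1# K.+ φ (- (1# + r) * - (1# + r) - 4 · (x * r))) K.* B r
              ≈⟨ K.*-congʳ (K.+-congˡ (φ-cong (solve 2 (λ x r →
                   :- (𝟙 :+ r) :* :- (𝟙 :+ r) :- 4 :× (x :* r)
                   := r :* r :+ (2 :× 𝟙 :- 4 :× x) :* r :+ 𝟙) refl x r))) ⟩
            (K.1# K.+ φ (r * r + k * r + 1#)) K.* B r
              ≈⟨ K.trans (K.*-comm _ (B r)) (K.trans (KR.distribˡ (B r) K.1# _) (K.+-congʳ (K.*-identityʳ (B r)))) ⟩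
            B r K.+ B r K.* φ (r * r + k * r + 1#) ∎

        ∑-R : ∑ (λ y → B (R y)) K.≈ ∑ (λ v → φ (P v + k))
        ∑-R = begin
          ∑ (λ y → B (R y))
            ≈⟨ ∑-fibres₁ R B-cong ⟩
          ∑ (λ r → ∑ (λ y → δ (R y) r) K.* B r)
            ≈⟨ ∑-cong R-count ⟩
          ∑ (λ r → B r K.+ B r K.* φ (r * r + k * r + 1#))
            ≈⟨ ∑-+ B (λ r → B r K.* φ (r * r + k * r + 1#)) ⟩
          ∑ B K.+ ∑ (λ r → B r K.* φ (r * r + k * r + 1#))
            ≈⟨ K.+-cong ∑B≈0 (K.sym (∑-elliptic k)) ⟩
          K.0# K.+ ∑ (λ v → φ (P v + k))
            ≈⟨ K.+-identityˡ _ ⟩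
          ∑ (λ v → φ (P v + k)) ∎

      hypergeometric : K.fromℕ q K.* ₂F₁ A A⁵ ε x K.≈ φ (- 1#) K.* ∑ (λ v → φ (P v + (2 · 1# - 4 · x)))
      hypergeometric = begin
        Q K.* (ε ⟨ x ⟩ K.* ((A⁵ ·χ ε) ⟨ - 1# ⟩ K.* q⁻¹) K.* greene)
          ≈⟨ K.*-congˡ (K.*-congʳ (K.trans (K.*-congʳ (ε-⟨⟩ x≉0)) (K.*-identityˡ _))) ⟩
        Q K.* ((A⁵ ·χ ε) ⟨ - 1# ⟩ K.* q⁻¹ K.* greene)
          ≈⟨ rearrange Q ((A⁵ ·χ ε) ⟨ - 1# ⟩) q⁻¹ greene ⟩
        q⁻¹ K.* Q K.* ((A⁵ ·χ ε) ⟨ - 1# ⟩ K.* greene)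
          ≈⟨ K.trans (K.*-congʳ q⁻¹-inverse) (K.*-identityˡ _) ⟩
        (A⁵ ·χ ε) ⟨ - 1# ⟩ K.* greene
          ≈⟨ K.*-cong (K.trans (·χ-ε A⁵ (- 1#)) (K.trans (A⁵-B (- 1#)) B[-1]≈φ[-1]))
               (K.trans (∑-cong greene-term) ∑-R) ⟩
        φ (- 1#) K.* ∑ (λ v → φ (P v + (2 · 1# - 4 · x))) ∎
        where
        Q greene : K.Carrier
        Q = K.fromℕ q
        greene = ∑ (λ y → A⁵ ⟨ y ⟩ K.* (conj A⁵ ·χ ε) ⟨ 1# - y ⟩ K.* conj A ⟨ 1# - x * y ⟩)

        rearrange : ∀ a b c d → a K.* (b K.* c K.* d) K.≈ c K.* a K.* (b K.* d)
        rearrange = KS.solve 4 (λ a b c d → a KS.:* (b KS.:* c KS.:* d) KS.:= c KS.:* a KS.:* (b KS.:* d)) K.refl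

        q⁻¹-inverse : q⁻¹ K.* Q K.≈ K.1#
        q⁻¹-inverse = K.trans (K.*-congˡ (K.sym (KP.x-0≈x Q)))
          (proj₁ (proj₂ (K.#⇒invertible (K.characteristic-zero q))))

-- Cubics with three distinct roots and a critical point in the field

module CubicSums
  (F : FiniteField c ℓ₁ ℓ₂) (K : AlgebraicallyClosedField₀ c′ ℓ₁′ ℓ₂′)
  (m : ℕ) (N≡6m : FiniteField.q F ℕ.∸ 1 ≡ 6 ℕ.* m)
  (A : Characters.Character F K)
  (Φ₆[Aγ]≈0 : IsSextic F K A)
  where
  open FiniteField F hiding (zero)
  open FiniteFieldProperties F
  open PrimitiveRoot F
  open Characters F K
  open CharacterProperties F K
  open CharacterSums F K
  open SexticCharacter F K m N≡6m A Φ₆[Aγ]≈0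
  open SexticSums F K m N≡6m A Φ₆[Aγ]≈0
  open RootCounts F K m N≡6m A Φ₆[Aγ]≈0
  open DicksonSums F K m N≡6m A Φ₆[Aγ]≈0
  open EllipticSums F K m N≡6m A Φ₆[Aγ]≈0
  private
    module K = AlgebraicallyClosedField₀ K
    module KR = CommutativeRing K.commutativeRing
    module KS = IntegerSolver K.commutativeRing

  φ-cube : ∀ {x} y → ¬ x ≈ 0# → φ (x ^ 3 * y) K.≈ φ x K.* φ y
  φ-cube {x} y x≉0 = K.trans (φ-* (x ^ 3) y) (K.*-congʳ (K.trans
    (φ-cong (solve 1 (λ x → x :^ 3 := (x :* x) :* x) refl x))
    (K.trans (φ-* (x * x) x) (K.trans (K.*-congʳ (φ-square (*-≉0 x≉0 x≉0) refl)) (K.*-identityˡ _)))))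
    where open IntegerSolver commutativeRing

  module _ where
    open IntegerSolver commutativeRing

    ·≈ : ∀ n x → n · x ≈ n · 1# * x
    ·≈ zero    x = sym (zeroˡ x)
    ·≈ (suc n) x = trans (+-cong (sym (*-identityˡ x)) (·≈ n x)) (sym (distribʳ x 1# (n · 1#)))

    3·≉0 : ∀ {x} → ¬ x ≈ 0# → ¬ 3 · x ≈ 0#
    3·≉0 {x} x≉0 = ≉0-cong (sym (·≈ 3 x)) (*-≉0 3≉0 x≉0)

    4·≉0 : ∀ {x} → ¬ x ≈ 0# → ¬ 4 · x ≈ 0#
    4·≉0 {x} x≉0 = ≉0-cong (solve 1 (λ x → 2 :× 𝟙 :* (2 :× 𝟙 :* x) := 4 :× x) refl x) (*-≉0 2≉0 (*-≉0 2≉0 x≉0))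

    27·≉0 : ∀ {x} → ¬ x ≈ 0# → ¬ 27 · x ≈ 0#
    27·≉0 {x} x≉0 = ≉0-cong (solve 1 (λ x → 3 :× (3 :× (3 :× x)) := 27 :× x) refl x) (3·≉0 (3·≉0 (3·≉0 x≉0)))

    ⅓ : Carrier
    ⅓ = inv (3 · 1#)

    3⅓≈1 : 3 · 1# * ⅓ ≈ 1#
    3⅓≈1 = inv-inverseʳ 3≉0

    ⅓≉0 : ¬ ⅓ ≈ 0#
    ⅓≉0 = inv-≉0 3≉0

    -- For u = (d/3)(v - 1) one gets u³ + du² = (d/3)³((v - 1)³ + 3(v - 1)²), and the last bracket
    -- is v³ - 3v + 2. The remaining term needs κ = 27e/d³.
    dickson-form : ∀ d e κ v → d ^ 3 * κ ≈ 27 · e →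
      (d * ⅓ * (v - 1#)) ^ 3 + d * (d * ⅓ * (v - 1#)) ^ 2 + e ≈ (d * ⅓) ^ 3 * (P v + (2 · 1# + κ))
    dickson-form d e κ v d³κ≈27e = trans
      (solve 5 (λ d e k v t →
        (d :* t :* (v :- 𝟙)) :^ 3 :+ d :* (d :* t :* (v :- 𝟙)) :^ 2 :+ e
        := (d :* t) :^ 3 :* ((v :^ 3 :- 3 :× v) :+ (2 :× 𝟙 :+ k))
           :+ ((3 :× 𝟙 :* t :- 𝟙) :* (:- (d :^ 3 :* t :^ 2 :* (v :- 𝟙) :^ 2 :+ e :* (𝟙 :+ 3 :× t :+ 9 :× (t :* t))))
           :+ (d :^ 3 :* k :- 27 :× e) :* (:- (t :^ 3)))) refl d e κ v ⅓)
      (trans (+-congˡ (trans (+-cong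
          (trans (*-congʳ (x≈y⇒x-y≈0 3⅓≈1)) (zeroˡ _))
          (trans (*-congʳ (x≈y⇒x-y≈0 d³κ≈27e)) (zeroˡ _))) (+-identityˡ 0#)))
        (+-identityʳ _))

  module _ where
    open SetoidReasoning K.setoid

    ∑-depressed : ∀ {d} e κ → ¬ d ≈ 0# → d ^ 3 * κ ≈ 27 · e →
      ∑ (λ u → φ (u ^ 3 + d * u ^ 2 + e)) K.≈ φ (3 · d) K.* ∑ (λ v → φ (P v + (2 · 1# + κ)))
    ∑-depressed {d} e κ d≉0 d³κ≈27e = begin
      ∑ (λ u → φ (u ^ 3 + d * u ^ 2 + e))
        ≈⟨ ∑-injective {f = λ u → φ (u ^ 3 + d * u ^ 2 + e)} {τ}
             (λ eq → φ-cong (+-congʳ (+-cong (^-congˡ 3 eq) (*-congˡ (^-congˡ 2 eq)))))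
             (λ eq → +-cancelʳ (- 1#) _ _ (*-cancelˡ d⅓≉0 eq)) ⟨
      ∑ (λ v → φ (τ v ^ 3 + d * τ v ^ 2 + e))
        ≈⟨ ∑-cong (λ v → K.trans (φ-cong (dickson-form d e κ v d³κ≈27e)) (φ-cube (P v + (2 · 1# + κ)) d⅓≉0)) ⟩
      ∑ (λ v → φ (d * ⅓) K.* φ (P v + (2 · 1# + κ)))
        ≈⟨ ∑-*ˡ (φ (d * ⅓)) (λ v → φ (P v + (2 · 1# + κ))) ⟩
      φ (d * ⅓) K.* ∑ (λ v → φ (P v + (2 · 1# + κ)))
        ≈⟨ K.*-congʳ φ[d⅓]≈φ[3d] ⟩
      φ (3 · d) K.* ∑ (λ v → φ (P v + (2 · 1# + κ))) ∎
      where
      open IntegerSolver commutativeRing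
      open RingProperties ring using (+-cancelʳ)

      d⅓≉0 : ¬ d * ⅓ ≈ 0#
      d⅓≉0 = *-≉0 d≉0 ⅓≉0

      τ : Carrier → Carrier
      τ v = d * ⅓ * (v - 1#)

      φ[d⅓]≈φ[3d] : φ (d * ⅓) K.≈ φ (3 · d)
      φ[d⅓]≈φ[3d] = K.sym (begin
        φ (3 · d)
          ≈⟨ φ-cong (trans (solve 2 (λ d t → 3 :× d := (3 :× 𝟙 :* (3 :× 𝟙)) :* (d :* t) :+ (3 :× 𝟙 :* t :- 𝟙) :* (:- (3 :× d))) refl d ⅓)
               (trans (+-congˡ (trans (*-congʳ (x≈y⇒x-y≈0 3⅓≈1)) (zeroˡ _))) (+-identityʳ _))) ⟩
        φ (3 · 1# * (3 · 1#) * (d * ⅓))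
          ≈⟨ φ-* (3 · 1# * (3 · 1#)) (d * ⅓) ⟩
        φ (3 · 1# * (3 · 1#)) K.* φ (d * ⅓)
          ≈⟨ K.trans (K.*-congʳ (φ-square (*-≉0 3≉0 3≉0) refl)) (K.*-identityˡ _) ⟩
        φ (d * ⅓) ∎)

  module _ where
    open IntegerSolver commutativeRing

    -- The discriminant of a cubic in the elementary symmetric functions, arranged so that all but
    -- the first term contains the second symmetric function, which vanishes after translation by a
    -- critical point.
    discriminant : ∀ a b c → ((a - b) * (b - c) * (c - a)) ^ 2 ≈
      - (a * b * c * (4 · (a + b + c) ^ 3 + 27 · (a * b * c)))
      + (a * b + b * c + c * a) * ((a + b + c) ^ 2 * (a * b + b * c + c * a)
          - 4 · (a * b + b * c + c * a) ^ 2 + 18 · ((a + b + c) * (a * b * c)))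
    discriminant = solve 3 (λ a b c → ((a :- b) :* (b :- c) :* (c :- a)) :^ 2 :=
      :- (a :* b :* c :* (4 :× (a :+ b :+ c) :^ 3 :+ 27 :× (a :* b :* c)))
      :+ (a :* b :+ b :* c :+ c :* a) :* ((a :+ b :+ c) :^ 2 :* (a :* b :+ b :* c :+ c :* a)
           :- 4 :× (a :* b :+ b :* c :+ c :* a) :^ 2 :+ 18 :× ((a :+ b :+ c) :* (a :* b :* c)))) refl

    -≉0⇒≉0 : ∀ {x} → ¬ - x ≈ 0# → ¬ x ≈ 0#
    -≉0⇒≉0 -x≉0 x≈0 = -x≉0 (trans (-‿cong x≈0) (solve 0 (:- con (+ 0) := con (+ 0)) refl))

    -- Distinct roots make -s₃(4s₁³ + 27s₃) nonzero, hence both factors. They will say that x ≠ 0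
    -- and x ≠ 1 in Greene's series; for the second cubic this is how g ≠ 0 is obtained.
    depressed-discriminant : ∀ {a b c} → ¬ a ≈ b → ¬ b ≈ c → ¬ c ≈ a → a * b + b * c + c * a ≈ 0# →
      ¬ a * b * c ≈ 0# × ¬ 4 · (a + b + c) ^ 3 + 27 · (a * b * c) ≈ 0#
    depressed-discriminant {a} {b} {c} a≉b b≉c c≉a s₂≈0 = factors-≉0 (-≉0⇒≉0
      (≉0-cong (trans (discriminant a b c) (trans (+-congˡ (trans (*-congʳ s₂≈0) (zeroˡ _))) (+-identityʳ _)))
        (^-≉0 2 (*-≉0 (*-≉0 (a≉b ∘ x-y≈0⇒x≈y a b) (b≉c ∘ x-y≈0⇒x≈y b c)) (c≉a ∘ x-y≈0⇒x≈y c a)))))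

  module _ (A⁵ : Character) (A⁵≈B : ∀ {x} → ¬ x ≈ 0# → A⁵ ⟨ x ⟩ K.≈ B x) where
    open SetoidReasoning K.setoid

    ∑-depressed-greene : ∀ {d e x} → ¬ d ≈ 0# → ¬ e ≈ 0# → ¬ 4 · d ^ 3 + 27 · e ≈ 0# →
      4 · d ^ 3 * x ≈ - (27 · e) →
      ∑ (λ u → φ (u ^ 3 + d * u ^ 2 + e)) K.≈ K.fromℕ q K.* φ (- (3 · d)) K.* ₂F₁ A A⁵ ε x
    ∑-depressed-greene {d} {e} {x} d≉0 e≉0 disc≉0 4d³x≈-27e = begin
      ∑ (λ u → φ (u ^ 3 + d * u ^ 2 + e))
        ≈⟨ ∑-depressed {d} e κ d≉0 d³κ≈27e ⟩
      φ (3 · d) K.* S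
        -- `hypergeometric` carries a factor φ(-1). Inserting φ(-1)² = 1 leaves one copy over, which
        -- turns φ(3d) into φ(-3d).
        ≈⟨ K.*-congˡ (K.trans (K.*-congʳ (φ-*-square -1≉0)) (K.*-identityˡ S)) ⟨
      φ (3 · d) K.* (φ (- 1#) K.* φ (- 1#) K.* S)
        ≈⟨ K.*-congˡ (K.*-assoc (φ (- 1#)) (φ (- 1#)) S) ⟩
      φ (3 · d) K.* (φ (- 1#) K.* (φ (- 1#) K.* S))
        ≈⟨ K.*-congˡ (K.*-congˡ (hypergeometric A⁵ A⁵≈B x x≉0 x≉1)) ⟨
      φ (3 · d) K.* (φ (- 1#) K.* (K.fromℕ q K.* ₂F₁ A A⁵ ε x))
        ≈⟨ rearrange (φ (3 · d)) (φ (- 1#)) (K.fromℕ q) (₂F₁ A A⁵ ε x) ⟩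
      K.fromℕ q K.* (φ (- 1#) K.* φ (3 · d)) K.* ₂F₁ A A⁵ ε x
        ≈⟨ K.*-congʳ (K.*-congˡ (K.trans (K.sym (φ-* (- 1#) (3 · d)))
             (φ-cong (solve 1 (λ x → :- 𝟙 :* x := :- x) refl (3 · d))))) ⟩
      K.fromℕ q K.* φ (- (3 · d)) K.* ₂F₁ A A⁵ ε x ∎
      where
      open IntegerSolver commutativeRing

      κ = - (4 · x)
      S = ∑ (λ v → φ (P v + (2 · 1# + κ)))

      -1≉0 : ¬ - 1# ≈ 0#
      -1≉0 eq = 1≉0 (trans (solve 0 (𝟙 := :- :- 𝟙) refl) (trans (-‿cong eq) (solve 0 (:- con (+ 0) := con (+ 0)) refl)))

      rearrange : ∀ a b c d → a K.* (b K.* (c K.* d)) K.≈ c K.* (b K.* a) K.* d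
      rearrange = KS.solve 4 (λ a b c d → a KS.:* (b KS.:* (c KS.:* d)) KS.:= c KS.:* (b KS.:* a) KS.:* d) K.refl

      d³κ≈27e : d ^ 3 * κ ≈ 27 · e
      d³κ≈27e = trans
        (solve 2 (λ p x → p :* :- (4 :× x) := :- (4 :× p :* x)) refl (d ^ 3) x)
        (trans (-‿cong 4d³x≈-27e) (solve 1 (λ x → :- :- x := x) refl (27 · e)))

      x≉0 : ¬ x ≈ 0#
      x≉0 = proj₂ (factors-≉0 (≉0-cong (sym 4d³x≈-27e)
        (-≉0⇒≉0 (≉0-cong (solve 1 (λ x → x := :- :- x) refl (27 · e)) (27·≉0 e≉0)))))

      x≉1 : ¬ x ≈ 1#
      x≉1 x≈1 = disc≉0 (trans (+-congʳ (trans (sym (*-identityʳ _)) (trans (*-congˡ (sym x≈1)) 4d³x≈-27e))) (-‿inverseˡ _))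

    -- The derivative of the cubic at h is the second symmetric function of h + a, h + b, h + c, so
    -- criticality removes the linear term after translation. The symmetric functions are parameters
    -- with equations because for the second cubic they are written as fractions over bc.
    ∑-cubic : ∀ {a b c} s₁ s₂ s₃ h {d e x} →
      a + b + c ≈ s₁ → a * b + b * c + c * a ≈ s₂ → a * b * c ≈ s₃ →
      ¬ a ≈ b → ¬ b ≈ c → ¬ c ≈ a →
      3 · h ^ 2 + 2 · s₁ * h + s₂ ≈ 0# →
      3 · h + s₁ ≈ d → h ^ 3 + s₁ * h ^ 2 + s₂ * h + s₃ ≈ e → ¬ d ≈ 0# →
      4 · d ^ 3 * x ≈ - (27 · e) →
      ∑ (λ u → φ ((u + a) * (u + b) * (u + c))) K.≈
      K.fromℕ q K.* φ (- (3 · d)) K.* ₂F₁ A A⁵ ε x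
    ∑-cubic {a} {b} {c} s₁ s₂ s₃ h {d} {e} {x} s₁≈ s₂≈ s₃≈ a≉b b≉c c≉a critical d≈ e≈ d≉0 4d³x≈-27e = begin
      ∑ (λ u → φ ((u + a) * (u + b) * (u + c)))
        ≈⟨ ∑-injective {f = λ u → φ ((u + a) * (u + b) * (u + c))} {_+ h}
             (λ eq → φ-cong (*-cong (*-cong (+-congʳ eq) (+-congʳ eq)) (+-congʳ eq))) (+-cancelʳ h _ _) ⟨
      ∑ (λ u → φ ((u + h + a) * (u + h + b) * (u + h + c)))
        ≈⟨ ∑-cong (λ u → φ-cong (shifted u)) ⟩
      ∑ (λ u → φ (u ^ 3 + d * u ^ 2 + e))
        ≈⟨ ∑-depressed-greene {d} {e} {x} d≉0 e≉0 disc≉0 4d³x≈-27e ⟩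
      K.fromℕ q K.* φ (- (3 · d)) K.* ₂F₁ A A⁵ ε x ∎
      where
      open IntegerSolver commutativeRing
      open RingProperties ring using (+-cancelʳ; +-cancelˡ)

      α β γ′ : Carrier
      α = h + a
      β = h + b
      γ′ = h + c

      s₁′≈d : α + β + γ′ ≈ d
      s₁′≈d = trans
        (solve 4 (λ a b c h → (h :+ a) :+ (h :+ b) :+ (h :+ c) := 3 :× h :+ (a :+ b :+ c)) refl a b c h)
        (trans (+-congˡ s₁≈) d≈)

      s₂′≈0 : α * β + β * γ′ + γ′ * α ≈ 0#
      s₂′≈0 = trans
        (solve 4 (λ a b c h → (h :+ a) :* (h :+ b) :+ (h :+ b) :* (h :+ c) :+ (h :+ c) :* (h :+ a)
          := 3 :× h :^ 2 :+ 2 :× (a :+ b :+ c) :* h :+ (a :* b :+ b :* c :+ c :* a)) refl a b c h)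
        (trans (+-cong (+-congˡ (*-congʳ (+-cong s₁≈ (+-congʳ s₁≈)))) s₂≈) critical)

      s₃′≈e : α * β * γ′ ≈ e
      s₃′≈e = trans
        (solve 4 (λ a b c h → (h :+ a) :* (h :+ b) :* (h :+ c)
          := h :^ 3 :+ (a :+ b :+ c) :* h :^ 2 :+ (a :* b :+ b :* c :+ c :* a) :* h :+ a :* b :* c) refl a b c h)
        (trans (+-cong (+-cong (+-congˡ (*-congʳ s₁≈)) (*-congʳ s₂≈)) s₃≈) e≈)

      shifted : ∀ u → (u + h + a) * (u + h + b) * (u + h + c) ≈ u ^ 3 + d * u ^ 2 + e
      shifted u = trans
        (solve 5 (λ a b c h u → (u :+ h :+ a) :* (u :+ h :+ b) :* (u :+ h :+ c)
          := (u :^ 3 :+ ((h :+ a) :+ (h :+ b) :+ (h :+ c)) :* u :^ 2 :+ (h :+ a) :* (h :+ b) :* (h :+ c))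
             :+ ((h :+ a) :* (h :+ b) :+ (h :+ b) :* (h :+ c) :+ (h :+ c) :* (h :+ a)) :* u) refl a b c h u)
        (trans (+-cong (+-cong (+-congˡ (*-congʳ s₁′≈d)) s₃′≈e) (trans (*-congʳ s₂′≈0) (zeroˡ u))) (+-identityʳ _))

      nonvanishing = depressed-discriminant (a≉b ∘ +-cancelˡ h a b) (b≉c ∘ +-cancelˡ h b c) (c≉a ∘ +-cancelˡ h c a) s₂′≈0

      e≉0 : ¬ e ≈ 0#
      e≉0 = ≉0-cong s₃′≈e (proj₁ nonvanishing)

      disc≉0 : ¬ 4 · d ^ 3 + 27 · e ≈ 0#
      disc≉0 eq = proj₂ nonvanishing (trans (+-cong
        (trans (·≈ 4 _) (trans (*-congˡ (^-congˡ 3 s₁′≈d)) (sym (·≈ 4 _))))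
        (trans (·≈ 27 _) (trans (*-congˡ s₃′≈e) (sym (·≈ 27 _))))) eq)

-- Splitting ψ₂₂₂ into two cubic sums

module PsiSums
  (F : FiniteField c ℓ₁ ℓ₂) (K : AlgebraicallyClosedField₀ c′ ℓ₁′ ℓ₂′)
  (m : ℕ) (N≡6m : FiniteField.q F ℕ.∸ 1 ≡ 6 ℕ.* m)
  (A : Characters.Character F K)
  (Φ₆[Aγ]≈0 : IsSextic F K A)
  where
  open FiniteField F hiding (zero)
  open FiniteFieldProperties F
  open PrimitiveRoot F
  open Characters F K
  open CharacterProperties F K
  open CharacterSums F K
  open SexticCharacter F K m N≡6m A Φ₆[Aγ]≈0
  open SexticSums F K m N≡6m A Φ₆[Aγ]≈0
  open EllipticSums F K m N≡6m A Φ₆[Aγ]≈0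
  open CubicSums F K m N≡6m A Φ₆[Aγ]≈0
  private
    module K = AlgebraicallyClosedField₀ K
    module KP = AlgebraicallyClosedFieldProperties K
    module KR = CommutativeRing K.commutativeRing
    module KS = IntegerSolver K.commutativeRing
    module KRing = RingProperties KR.ring
  open KP using () renaming (_^_ to _^K_)

  module _ (a b c : Carrier) (a≉0 : ¬ a ≈ 0#) (b≉0 : ¬ b ≈ 0#) (c≉0 : ¬ c ≈ 0#) where
    open IntegerSolver commutativeRing

    private
      cubic reversedCubic : Carrier → Carrier
      cubic u = (u + a) * (u + b) * (u + c)
      reversedCubic w = (w + 1#) * (w + a / b) * (w + a / c)

      cubic-cong : ∀ {u v} → u ≈ v → cubic u ≈ cubic v
      cubic-cong eq = *-cong (*-cong (+-congʳ eq) (+-congʳ eq)) (+-congʳ eq)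

      b/b≈1 : b * inv b ≈ 1#
      b/b≈1 = inv-inverseʳ b≉0

      c/c≈1 : c * inv c ≈ 1#
      c/c≈1 = inv-inverseʳ c≉0

      modulo-relations : ∀ {x y z w v} → x ≈ y + (z * (w - 1#)) → w ≈ 1# → y ≈ v → x ≈ v
      modulo-relations x≈ w≈1 y≈v = trans x≈ (trans (+-congˡ (trans (*-congˡ (x≈y⇒x-y≈0 w≈1)) (zeroʳ _))) (trans (+-identityʳ _) y≈v))

      reversedCubic-scaled : ∀ w → b * c * reversedCubic w ≈ (w + 1#) * (b * w + a) * (c * w + a)
      reversedCubic-scaled w = modulo-relations
        (solve 6 (λ a b c i j w → b :* c :* ((w :+ 𝟙) :* (w :+ a :* i) :* (w :+ a :* j))
          := (w :+ 𝟙) :* (b :* w :+ a) :* (c :* w :+ a :* (c :* j))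
             :+ ((w :+ 𝟙) :* a :* (c :* w :+ a :* (c :* j))) :* (b :* i :- 𝟙)) refl a b c (inv b) (inv c) w)
        b/b≈1
        (*-congˡ (+-congˡ (trans (*-congˡ c/c≈1) (*-identityʳ a))))

      -- The three factors of the cubic at a/w bring the denominator w³; the weight u = a/w
      -- completes it to w⁴ and a to a², so what is split off is a square, invisible to `φ`.
      inverted : ∀ {w} → ¬ w ≈ 0# →
        a * inv w * cubic (a * inv w) ≈
        (a * inv w * inv w) * (a * inv w * inv w) * ((w + 1#) * (b * w + a) * (c * w + a))
      inverted {w} w≉0 = modulo-relations
        (solve 5 (λ a b c w t → a :* t :* ((a :* t :+ a) :* (a :* t :+ b) :* (a :* t :+ c))
          := (a :* t) :* ((a :* t :+ a :* (w :* t)) :* (a :* t :+ b :* (w :* t)) :* (a :* t :+ c :* (w :* t)))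
             :+ (:- (a :* t :* (a :* (a :* t :+ b) :* (a :* t :+ c)
                  :+ b :* (a :* t :+ a :* (w :* t)) :* (a :* t :+ c)
                  :+ c :* (a :* t :+ a :* (w :* t)) :* (a :* t :+ b :* (w :* t))))) :* (w :* t :- 𝟙)) refl a b c w (inv w))
        (inv-inverseʳ w≉0)
        (solve 5 (λ a b c w t →
          (a :* t) :* ((a :* t :+ a :* (w :* t)) :* (a :* t :+ b :* (w :* t)) :* (a :* t :+ c :* (w :* t)))
          := (a :* t :* t) :* (a :* t :* t) :* ((w :+ 𝟙) :* (b :* w :+ a) :* (c :* w :+ a))) refl a b c w (inv w))

    module _ where
      open SetoidReasoning K.setoid

      private
        φ-reversedCubic : ∀ w → φ ((w + 1#) * (b * w + a) * (c * w + a)) K.≈ φ (b * c) K.* φ (reversedCubic w)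
        φ-reversedCubic w = K.trans (φ-cong (sym (reversedCubic-scaled w))) (φ-* (b * c) (reversedCubic w))

        -- At w = 0 the convention a/0 = 0 makes the left side vanish, while the reversed cubic
        -- contributes φ(a²) = 1. The correction by `δ` sums to the -1 of the theorem.
        inverted-term : ∀ w → φ (a * inv w) K.* φ (cubic (a * inv w)) K.≈
                              φ (b * c) K.* φ (reversedCubic w) K.- δ w 0#
        inverted-term w = by-cases (w ≟ 0#)
          where
          f = φ (a * inv w) K.* φ (cubic (a * inv w))
          g = φ (b * c) K.* φ (reversedCubic w)

          by-cases : Dec (w ≈ 0#) → f K.≈ g K.- δ w 0#
          by-cases (yes w≈0) = begin
            f              ≈⟨ K.trans (K.*-congʳ (φ-zero (trans (*-congˡ (inv-zero w≈0)) (zeroʳ a)))) (K.zeroˡ _) ⟩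
            K.0#           ≈⟨ K.-‿inverseʳ K.1# ⟨
            K.1# K.- K.1#  ≈⟨ K.+-cong g≈1 (K.-‿cong (δ-1 w≈0)) ⟨
            g K.- δ w 0#   ∎
            where
            g≈1 : g K.≈ K.1#
            g≈1 = K.trans (K.sym (φ-reversedCubic w)) (φ-square
              (≉0-cong (sym a²≈) (*-≉0 a≉0 a≉0)) (sym a²≈))
              where
              a²≈ : (w + 1#) * (b * w + a) * (c * w + a) ≈ a * a
              a²≈ = trans (*-cong (*-cong (+-congʳ w≈0) (+-congʳ (*-congˡ w≈0))) (+-congʳ (*-congˡ w≈0)))
                (solve 3 (λ a b c → (con (+ 0) :+ 𝟙) :* (b :* con (+ 0) :+ a) :* (c :* con (+ 0) :+ a) := a :* a) refl a b c)
          by-cases (no w≉0) = begin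
            f
              ≈⟨ φ-* (a * inv w) (cubic (a * inv w)) ⟨
            φ (a * inv w * cubic (a * inv w))
              ≈⟨ φ-cong (inverted w≉0) ⟩
            φ (s * s * ((w + 1#) * (b * w + a) * (c * w + a)))
              ≈⟨ φ-* (s * s) _ ⟩
            φ (s * s) K.* φ ((w + 1#) * (b * w + a) * (c * w + a))
              ≈⟨ K.*-cong (φ-square (*-≉0 s≉0 s≉0) refl) (φ-reversedCubic w) ⟩
            K.1# K.* g
              ≈⟨ K.*-identityˡ g ⟩
            g
              ≈⟨ K.+-identityʳ g ⟨
            g K.+ K.0#
              ≈⟨ K.+-congˡ (K.trans (K.-‿cong (δ-0 w≉0)) KRing.-0#≈0#) ⟨
            g K.- δ w 0# ∎
            where
            s = a * inv w * inv w
            s≉0 : ¬ s ≈ 0#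
            s≉0 = *-≉0 (*-≉0 a≉0 (inv-≉0 w≉0)) (inv-≉0 w≉0)

      ∑-inverted : ∑ (λ u → φ u K.* φ (cubic u)) K.≈
                   φ (b * c) K.* ∑ (λ w → φ ((w + 1#) * (w + a / b) * (w + a / c))) K.- K.1#
      ∑-inverted = begin
        ∑ (λ u → φ u K.* φ (cubic u))
          ≈⟨ ∑-injective {f = λ u → φ u K.* φ (cubic u)} {λ w → a * inv w}
               (λ eq → K.*-cong (φ-cong eq) (φ-cong (cubic-cong eq)))
               (λ {x} {y} eq → trans (sym (inv-involutive x)) (trans (inv-cong (*-cancelˡ a≉0 eq)) (inv-involutive y))) ⟨
        ∑ (λ w → φ (a * inv w) K.* φ (cubic (a * inv w)))
          ≈⟨ ∑-cong inverted-term ⟩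
        ∑ (λ w → φ (b * c) K.* φ (reversedCubic w) K.- δ w 0#)
          ≈⟨ ∑-cong (λ w → K.+-congˡ {φ (b * c) K.* φ (reversedCubic w)} (K.sym (KRing.-1*x≈-x (δ w 0#)))) ⟩
        ∑ (λ w → φ (b * c) K.* φ (reversedCubic w) K.+ K.- K.1# K.* δ w 0#)
          ≈⟨ ∑-+ (λ w → φ (b * c) K.* φ (reversedCubic w)) (λ w → K.- K.1# K.* δ w 0#) ⟩
        ∑ (λ w → φ (b * c) K.* φ (reversedCubic w)) K.+ ∑ (λ w → K.- K.1# K.* δ w 0#)
          ≈⟨ K.+-cong (∑-*ˡ (φ (b * c)) (λ w → φ (reversedCubic w)))
               (K.trans (∑-*ˡ (K.- K.1#) (λ w → δ w 0#)) (K.trans (K.*-congˡ (∑-δ 0#)) (K.*-identityʳ _))) ⟩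
        φ (b * c) K.* ∑ (λ w → φ (reversedCubic w)) K.- K.1# ∎

      ψ₂₂₂-cubics : ψ₂₂₂ a b c K.≈ ∑ (λ u → φ ((u + a) * (u + b) * (u + c)))
        K.+ (φ (b * c) K.* ∑ (λ w → φ ((w + 1#) * (w + a / b) * (w + a / c))) K.- K.1#)
      ψ₂₂₂-cubics = begin
        ∑ (λ x → φ (x ^ 2 + a) K.* φ (x ^ 2 + b) K.* φ (x ^ 2 + c))
          ≈⟨ ∑-cong (λ x → K.trans
               (K.sym (K.trans (φ-* ((x ^ 2 + a) * (x ^ 2 + b)) (x ^ 2 + c)) (K.*-congʳ (φ-* (x ^ 2 + a) (x ^ 2 + b)))))
               (φ-cong (cubic-cong (*-congˡ (*-identityʳ x))))) ⟩
        ∑ (λ x → φ (cubic (x * x)))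
          ≈⟨ ∑-fibres₁ {λ u → φ (cubic u)} (λ x → x * x) (λ eq → φ-cong (cubic-cong eq)) ⟩
        ∑ (λ u → ∑ (λ x → δ (x * x) u) K.* φ (cubic u))
          ≈⟨ ∑-cong (λ u → K.trans (K.*-congʳ {φ (cubic u)} (count-square-roots u))
               (K.trans (KR.distribʳ (φ (cubic u)) K.1# (φ u)) (K.+-congʳ (K.*-identityˡ _)))) ⟩
        ∑ (λ u → φ (cubic u) K.+ φ u K.* φ (cubic u))
          ≈⟨ ∑-+ (λ u → φ (cubic u)) (λ u → φ u K.* φ (cubic u)) ⟩
        ∑ (λ u → φ (cubic u)) K.+ ∑ (λ u → φ u K.* φ (cubic u))
          ≈⟨ K.+-congˡ ∑-inverted ⟩
        ∑ (λ u → φ (cubic u)) K.+ (φ (b * c) K.* ∑ (λ w → φ (reversedCubic w)) K.- K.1#) ∎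

  greene-argument : ∀ {d} e → ¬ d ≈ 0# → 4 · d ^ 3 * - ((27 · e) / (4 · d ^ 3)) ≈ - (27 · e)
  greene-argument {d} e d≉0 = trans
    (solve 3 (λ p e j → p :* :- (e :* j) := :- e :* (p :* j)) refl (4 · d ^ 3) (27 · e) (inv (4 · d ^ 3)))
    (trans (*-congˡ (inv-inverseʳ (4·≉0 (^-≉0 3 d≉0)))) (*-identityʳ _))
    where open IntegerSolver commutativeRing

  module _ (A⁵ : Character) (A⁵≈B : ∀ {x} → ¬ x ≈ 0# → A⁵ ⟨ x ⟩ K.≈ B x)
    (a b c : Carrier) (a≉0 : ¬ a ≈ 0#) (b≉0 : ¬ b ≈ 0#) (c≉0 : ¬ c ≈ 0#)
    (a≉b : ¬ a ≈ b) (b≉c : ¬ b ≈ c) (a≉c : ¬ a ≈ c) where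
    open IntegerSolver commutativeRing

    private
      a/-injective : ∀ {x y} → a / x ≈ a / y → x ≈ y
      a/-injective {x} {y} eq = trans (sym (inv-involutive x)) (trans (inv-cong (*-cancelˡ a≉0 eq)) (inv-involutive y))

      a/x≉1 : ∀ {x} → ¬ x ≈ 0# → ¬ a ≈ x → ¬ a / x ≈ 1#
      a/x≉1 x≉0 a≉x eq = a≉x (sym (a/-injective (trans eq (sym (inv-inverseʳ a≉0)))))

    -- Here `k` is 1/(bc), to which the fractions over bc unfold, whereas the roots of the reversed
    -- cubic contain 1/b and 1/c separately; `ij≈k` reconciles the two. The arguments of the series
    -- are given by the equations they satisfy.
    ψ₂₂₂-greene : ∀ {h d f k x₁ x₂} → ¬ d ≈ 0# → ¬ f ≈ 0# →
      3 · h ^ 2 + 2 · ((a * b + b * c + c * a) * k) * h + (a * b + c * a + a ^ 2) * k ≈ 0# →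
      3 · h ^ 2 + 2 · (a + b + c) * h + (a * b + b * c + c * a) ≈ 0# →
      3 · h + a + b + c ≈ d → 3 · h + (a * b + b * c + c * a) * k ≈ f → b * c * k ≈ 1# →
      let e = h ^ 3 + (a + b + c) * h ^ 2 + (a * b + b * c + c * a) * h + a * b * c
          g = h ^ 3 + ((a * b + b * c + c * a) * k) * h ^ 2
                + ((a * b + c * a + a ^ 2) * k) * h + a ^ 2 * k
      in
      4 · d ^ 3 * x₁ ≈ - (27 · e) → 4 · f ^ 3 * x₂ ≈ - (27 · g) →
      ψ₂₂₂ a b c K.≈
        K.- K.1# K.+ K.fromℕ q K.* φ (- (3 · d)) K.* ₂F₁ A A⁵ ε x₁
        K.+ K.fromℕ q K.* φ (b * c) K.* φ (- (3 · f)) K.* ₂F₁ A A⁵ ε x₂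
    ψ₂₂₂-greene {h} {d} {f} {k} {x₁} {x₂} d≉0 f≉0 critical′ critical d≈ f≈ bck≈1 x₁≈ x₂≈ = K.trans
      (ψ₂₂₂-cubics a b c a≉0 b≉0 c≉0)
      (assemble (φ (b * c)) (K.fromℕ q) first second)
      where
      i = inv b
      j = inv c
      e = h ^ 3 + (a + b + c) * h ^ 2 + (a * b + b * c + c * a) * h + a * b * c
      g = h ^ 3 + ((a * b + b * c + c * a) * k) * h ^ 2
            + ((a * b + c * a + a ^ 2) * k) * h + a ^ 2 * k

      bi≈1 : b * i ≈ 1#
      bi≈1 = inv-inverseʳ b≉0

      cj≈1 : c * j ≈ 1#
      cj≈1 = inv-inverseʳ c≉0

      ij≈k : i * j ≈ k
      ij≈k = *-cancelˡ (*-≉0 b≉0 c≉0) (trans (trans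
        (solve 4 (λ b c i j → b :* c :* (i :* j) := (b :* i) :* (c :* j)) refl b c i j)
        (trans (*-cong bi≈1 cj≈1) (*-identityˡ 1#))) (sym bck≈1))

      e₁ : 1# + a / b + a / c ≈ (a * b + b * c + c * a) * k
      e₁ = sym (trans (*-congˡ (sym ij≈k)) (trans
        (solve 5 (λ a b c i j → (a :* b :+ b :* c :+ c :* a) :* (i :* j)
          := a :* j :* (b :* i) :+ (b :* i) :* (c :* j) :+ a :* i :* (c :* j)) refl a b c i j)
        (trans (+-cong (+-cong (trans (*-congˡ bi≈1) (*-identityʳ _)) (trans (*-cong bi≈1 cj≈1) (*-identityˡ 1#)))
          (trans (*-congˡ cj≈1) (*-identityʳ _)))
        (solve 3 (λ x y z → x :+ z :+ y := z :+ y :+ x) refl (a * j) (a * i) 1#))))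

      e₂ : 1# * (a / b) + a / b * (a / c) + a / c * 1# ≈ (a * b + c * a + a ^ 2) * k
      e₂ = sym (trans (*-congˡ (sym ij≈k)) (trans
        (solve 5 (λ a b c i j → (a :* b :+ c :* a :+ a :^ 2) :* (i :* j)
          := a :* j :* (b :* i) :+ a :* i :* (c :* j) :+ a :* i :* (a :* j)) refl a b c i j)
        (trans (+-congʳ (+-cong (*-congˡ bi≈1) (*-congˡ cj≈1)))
        (solve 3 (λ x y z → x :* z :+ y :* z :+ y :* x := z :* y :+ y :* x :+ x :* z) refl (a * j) (a * i) 1#))))

      e₃ : 1# * (a / b) * (a / c) ≈ a ^ 2 * k
      e₃ = trans (solve 3 (λ a i j → 𝟙 :* (a :* i) :* (a :* j) := a :^ 2 :* (i :* j)) refl a i j) (*-congˡ ij≈k)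

      first : ∑ (λ u → φ ((u + a) * (u + b) * (u + c))) K.≈ K.fromℕ q K.* φ (- (3 · d)) K.* ₂F₁ A A⁵ ε x₁
      first = ∑-cubic A⁵ A⁵≈B {a} {b} {c} (a + b + c) (a * b + b * c + c * a) (a * b * c) h {d} {e}
        refl refl refl a≉b b≉c (a≉c ∘ sym) critical
        (trans (solve 4 (λ a b c h → 3 :× h :+ (a :+ b :+ c) := 3 :× h :+ a :+ b :+ c) refl a b c h) d≈) refl d≉0 x₁≈

      second : ∑ (λ w → φ ((w + 1#) * (w + a / b) * (w + a / c))) K.≈ K.fromℕ q K.* φ (- (3 · f)) K.* ₂F₁ A A⁵ ε x₂
      second = ∑-cubic A⁵ A⁵≈B {1#} {a / b} {a / c}
        ((a * b + b * c + c * a) * k) ((a * b + c * a + a ^ 2) * k) (a ^ 2 * k) h {f} {g} e₁ e₂ e₃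
        (λ eq → a/x≉1 b≉0 a≉b (sym eq)) (λ eq → b≉c (a/-injective eq)) (a/x≉1 c≉0 a≉c) critical′ f≈ refl f≉0 x₂≈

      assemble : ∀ {S₁ S₂ x s y} p n → S₁ K.≈ x → S₂ K.≈ n K.* s K.* y →
        S₁ K.+ (p K.* S₂ K.- K.1#) K.≈ K.- K.1# K.+ x K.+ n K.* p K.* s K.* y
      assemble {x = x} {s} {y} p n S₁≈ S₂≈ = K.trans (K.+-cong S₁≈ (K.+-congʳ (K.*-congˡ S₂≈)))
        (KS.solve 5 (λ x p n s y → x KS.:+ (p KS.:* (n KS.:* s KS.:* y) KS.:- KS.𝟙)
          KS.:= KS.:- KS.𝟙 KS.:+ x KS.:+ n KS.:* p KS.:* s KS.:* y) K.refl x p n s y)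

theorem1p5 :
  ∀ {c ℓ₁ ℓ₂ c′ ℓ₁′ ℓ₂′ : Level}
    (F : FiniteField c ℓ₁ ℓ₂) (K : AlgebraicallyClosedField₀ c′ ℓ₁′ ℓ₂′) →
  let open FiniteField F
      open Characters F K
      module K = AlgebraicallyClosedField₀ K
  in
  (p : ℕ) → HasCharacteristic p → ¬ (2 ∣ p) →
  q ℕ.% 6 ≡ 1 →
  (T : Character) → IsGenerator group T →
  (a b c h : Carrier) →
  ¬ (h ≈ 0#) →
  3 · h ^ 2 + 2 · ((a * b + b * c + c * a) / (b * c)) * h
    + (a * b + c * a + a ^ 2) / (b * c) ≈ 0# →
  3 · h ^ 2 + 2 · (a + b + c) * h + (a * b + b * c + c * a) ≈ 0# →
  let d = 3 · h + a + b + c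
      e = h ^ 3 + (a + b + c) * h ^ 2 + (a * b + b * c + c * a) * h + a * b * c
      f = 3 · h + (a * b + b * c + c * a) / (b * c)
      g = h ^ 3 + ((a * b + b * c + c * a) / (b * c)) * h ^ 2
            + ((a * b + c * a + a ^ 2) / (b * c)) * h + a ^ 2 / (b * c)
  in
  All (λ x → ¬ (x ≈ 0#)) (a ∷ b ∷ c ∷ d ∷ e ∷ f ∷ []) →
  Unique setoid (a ∷ b ∷ c ∷ d ∷ e ∷ f ∷ []) →
  let A = T ^χ ((q ∸ 1) ℕ./ 6)
      B = T ^χ ((5 ℕ.* (q ∸ 1)) ℕ./ 6)
  in
  ψ₂₂₂ a b c K.≈
    K.- K.1#
    K.+ K.fromℕ q K.* φ (- (3 · d))
          K.* ₂F₁ A B ε (- (((3 ℕ.^ 3) · e) / ((2 ℕ.^ 2) · d ^ 3)))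
    K.+ K.fromℕ q K.* φ (b * c) K.* φ (- (3 · f))
          K.* ₂F₁ A B ε (- (((3 ℕ.^ 3) · g) / ((2 ℕ.^ 2) · f ^ 3)))
theorem1p5 F K _ _ _ q%6≡1 T T-generates a b c h _ critical′ critical
  (a≉0 ∷ b≉0 ∷ c≉0 ∷ d≉0 ∷ _ ∷ f≉0 ∷ [])
  ((a≉b ∷ a≉c ∷ _) ∷ (b≉c ∷ _) ∷ _) =
  ψ₂₂₂-greene (T ^χ ((5 ℕ.* (q ∸ 1)) ℕ./ 6)) T⁵ᵐ
    a b c a≉0 b≉0 c≉0 a≉b b≉c a≉c
    d≉0 f≉0 critical′ critical refl refl (inv-inverseʳ (*-≉0 b≉0 c≉0))
    (greene-argument _ d≉0) (greene-argument _ f≉0)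
  where
  open FiniteField F
  open Characters F K
  open FiniteFieldProperties F using (inv-inverseʳ; *-≉0)
  open CharacterProperties F K using (generator-Φ₆; ⟨⟩-^χ)
  module K = AlgebraicallyClosedField₀ K
  open AlgebraicallyClosedFieldProperties K using (^-congˡ; ^-congʳ; ^-assocʳ) renaming (_^_ to _^K_)

  q∸1≡ : q ∸ 1 ≡ q ℕ./ 6 ℕ.* 6
  q∸1≡ = ≡.trans (≡.cong (_∸ 1) (m≡m%n+[m/n]*n q 6)) (≡.cong (λ r → (r ℕ.+ q ℕ./ 6 ℕ.* 6) ∸ 1) q%6≡1)

  N≡6m : q ∸ 1 ≡ 6 ℕ.* ((q ∸ 1) ℕ./ 6)
  N≡6m = ≡.trans q∸1≡ (≡.trans (ℕ.*-comm (q ℕ./ 6) 6)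
    (≡.cong (6 ℕ.*_) (≡.sym (≡.trans (≡.cong (ℕ._/ 6) q∸1≡) (m*n/n≡m (q ℕ./ 6) 6)))))

  -- The exponent 5(q-1)/6 is a floor division; it is exact because 6 divides q - 1, which
  -- identifies the second parameter with the fifth power of the first.
  5m≡m*5 : (5 ℕ.* (q ∸ 1)) ℕ./ 6 ≡ (q ∸ 1) ℕ./ 6 ℕ.* 5
  5m≡m*5 = ≡.trans (≡.cong (ℕ._/ 6) (≡.trans (≡.cong (5 ℕ.*_) (≡.trans N≡6m (ℕ.*-comm 6 m)))
    (≡.sym (ℕ.*-assoc 5 m 6)))) (≡.trans (m*n/n≡m (5 ℕ.* m) 6) (ℕ.*-comm 5 m))
    where m = (q ∸ 1) ℕ./ 6

  T⁵ᵐ : ∀ {x} → ¬ x ≈ 0# →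
        (T ^χ ((5 ℕ.* (q ∸ 1)) ℕ./ 6)) ⟨ x ⟩ K.≈ ((T ^χ ((q ∸ 1) ℕ./ 6)) ⟨ x ⟩) ^K 5
  T⁵ᵐ {x} x≉0 = K.trans (⟨⟩-^χ T ((5 ℕ.* (q ∸ 1)) ℕ./ 6) x≉0) (K.trans (^-congʳ (T ⟨ x ⟩) 5m≡m*5)
    (K.trans (K.sym (^-assocʳ (T ⟨ x ⟩) ((q ∸ 1) ℕ./ 6) 5))
      (K.sym (^-congˡ 5 (⟨⟩-^χ T ((q ∸ 1) ℕ./ 6) x≉0)))))

  open PsiSums F K ((q ∸ 1) ℕ./ 6) N≡6m (T ^χ ((q ∸ 1) ℕ./ 6))
    (generator-Φ₆ T T-generates ((q ∸ 1) ℕ./ 6) N≡6m) using (ψ₂₂₂-greene; greene-argument)
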